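{- There is a fixed-parameter tractable (FPT) algorithm for the (decoupled) \textsc{Spanner} problem parameterized by the total removed weight $\overline{W}$ and the tightness $\tau$ of the instance. Precisely: given a connected undirected graph $G=(V,E)$ with $n=|V|$, $m=|E|$, edge weights $w\colon E\to\mathbb{N}_{\ge 0}$, edge lengths $\ell\colon E\to\mathbb{N}_{\ge 1}$, a stretch factor $\alpha\ge 1$ and a number $\overline{W}\in\mathbb{N}$, the algorithm decides whether $G$ has an $\alpha$-spanner $H=(V,F)$ with $w(E\setminus F)\ge \overline{W}$ in time $$\mathcal{T}\in\mathcal{O}\big(\overline{W}^{\,2\overline{W}+1}\,\tau^{2\overline{W}}\cdot \mathrm{SPSP}(n,m)+\mathrm{APSP}_2(n,m)\big),$$ where $\tau$ is the tightness of the instance, and it identifies a witness (i.e., such a spanner $H$), if one exists, in $\mathcal{O}(\mathcal{T}+n^2m^2)$ time.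
   Context: For a subgraph $G'\subseteq G$ and $u,v\in V$, $\ell_{G'}[u,v]$ is the length of a shortest $u$-$v$-path in $G'$ w.r.t. $\ell$. A subgraph $H=(V,F)$, $F\subseteq E$, is an $\alpha$-spanner of $G$ if $\ell_H[u,v]\le\alpha\,\ell_G[u,v]$ for all $u,v\in V$; equivalently, for all $\{u,v\}\in E$. The set of terminal pairs is $K=E$. For a set $X$ of edges, $w(X)=\sum_{e\in X}w(e)$. "Decoupled" means that $w$ and $\ell$ are independent and arbitrary. For $\{u,v\}\in E$, a simple $u$-$v$-path $P$ is settling if $\ell(P)\le\alpha\,\ell_G[u,v]$; it is alternative if it does not contain the edge $\{u,v\}$. $\mathcal{P}_{uv}$ is the set of all settling $u$-$v$-paths. As a preprocessing convention, edges that do not settle themselves (i.e., $\ell(\{u,v\})>\alpha\,\ell_G[u,v]$) are assumed to have been removed from the instance. An edge $\{u,v\}$ is mandatory if $\mathcal{P}_{uv}$ contains no alternative path. The trivial edges $T\subseteq E$ are the mandatory edges and the edges of weight $0$; the nontrivial edges are $N=E\setminus T$. A terminal pair $\{u,v\}\in E$ is critical if no settling $u$-$v$-path consists only of trivial edges; $C$ denotes the set of critical terminal pairs ($C\subseteq N$). For $\{u,v\}\in C$, the tightest alternative path $A_{uv}\in\mathcal{P}_{uv}$ is an alternative settling path with the minimum number of nontrivial edges, and $A^N_{uv}=A_{uv}\cap N$ is its set of nontrivial edges. The tightness of the instance is $\tau=\max\{|A^N_{uv}| : \{u,v\}\in C\}$. $\mathrm{SPSP}(n,m)$ and $\mathrm{APSP}_2(n,m)$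 denote the running time of suitable algorithms for the single-pair shortest path problem and for the all-pairs-2-shortest-paths problem (two shortest paths for each node pair), respectively, on a graph with $n$ nodes and $m$ edges; $\mathrm{APSP}_2(n,m)\in\mathcal{O}(nm+n^2\log n)$. An algorithm is FPT w.r.t. a (possibly combined) parameter $k$ if on instance $I$ it runs in $\mathcal{O}(f(k)\cdot p(\langle I\rangle))$ time for a computable function $f$ and a polynomial $p$ in the encoding length $\langle I\rangle$. -}

module Defs where

open import Data.Bool.Base using (Bool; true; false; if_then_else_; _∧_)
open import Data.Fin.Base using (Fin; toℕ)
open import Data.Fin.Subset using (Subset; ⊤; ∁; ⋃; ⁅_⁆; _∩_; ∣_∣; _∈_)
open import Data.Integer.Base as ℤ using (+_)
open import Data.List.Base using (List; []; _∷_; _++_; map; sum; length; upTo; allFin; concatMap)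
open import Data.List.Relation.Unary.All using (All)
open import Data.List.Relation.Unary.Unique.Propositional using (Unique)
import Data.List.Membership.Propositional as List
open import Data.Nat.Base using (ℕ; zero; suc; _+_; _*_; _∸_; _^_; _≤_; _≤ᵇ_; _<ᵇ_; _≡ᵇ_)
open import Data.Nat.Logarithm using (⌊log₂_⌋)
open import Data.Product.Base using (Σ; ∃; ∃₂; _×_; _,_; proj₁; proj₂)
open import Data.Rational.Base as ℚ using (ℚ; 1ℚ; ↥_; ↧ₙ_)
open import Data.Sum.Base using (_⊎_)
open import Data.Vec.Base using (lookup)
open import Function.Bundles using (_⇔_)
open import Relation.Binary.PropositionalEquality using (_≡_; _≢_)
open import Relation.Nullary using (¬_)

-- Finite simple undirected graphs; the edge set is Fin m.
record Network : Set where
  field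
    n m  : ℕ
    ends : Fin m → Fin n × Fin n
    ℓ    : Fin m → ℕ

  Joins : Fin m → Fin n → Fin n → Set
  Joins e u v = (ends e ≡ (u , v)) ⊎ (ends e ≡ (v , u))

  field
    loopless   : ∀ e u → ¬ Joins e u u
    noParallel : ∀ e f u v → Joins e u v → Joins f u v → e ≡ f
    ℓ-positive : ∀ e → 1 ≤ ℓ e

  src tgt : Fin m → Fin n
  src e = proj₁ (ends e)
  tgt e = proj₂ (ends e)

  data Path : Fin n → Fin n → Set where
    stop : ∀ {u} → Path u u
    step : ∀ {u x v} (e : Fin m) → Joins e u x → Path x v → Path u v

  edges : ∀ {u v} → Path u v → List (Fin m)
  edges stop         = []
  edges (step e _ P) = e ∷ edges P

  vertices : ∀ {u v} → Path u v → List (Fin n)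
  vertices (stop {u})         = u ∷ []
  vertices (step {u} _ _ P)   = u ∷ vertices P

  Simple : ∀ {u v} → Path u v → Set
  Simple P = Unique (vertices P)

  pathLength : ∀ {u v} → Path u v → ℕ
  pathLength P = sum (map ℓ (edges P))

  edgeSet : ∀ {u v} → Path u v → Subset m
  edgeSet P = ⋃ (map ⁅_⁆ (edges P))

  _Within_ : ∀ {u v} → Path u v → Subset m → Set
  P Within F = All (_∈ F) (edges P)

  -- d = ℓ_H[u,v] for H = (V,F); no d qualifies if v is unreachable from u in H.
  Dist : Subset m → Fin n → Fin n → ℕ → Set
  Dist F u v d =
    (Σ (Path u v) λ P → P Within F × pathLength P ≡ d) ×
    (∀ (Q : Path u v) → Q Within F → d ≤ pathLength Q)

  Connected : Set
  Connected = ∀ u v → Path u v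

toℚ : ℕ → ℚ
toℚ k = + k ℚ./ 1

record Instance : Set where
  field
    G         : Network
    connected : Network.Connected G
  open Network G public
  field
    w   : Fin m → ℕ
    α   : ℚ
    1≤α : 1ℚ ℚ.≤ α
    W̄   : ℕ

  weight : Subset m → ℕ
  weight X = sum (map (λ e → if lookup X e then w e else 0) (allFin m))

  IsSpanner : Subset m → Set
  IsSpanner F = ∀ u v d → Dist ⊤ u v d →
    ∃ λ d′ → Dist F u v d′ × toℚ d′ ℚ.≤ α ℚ.* toℚ d

  IsSolution : Subset m → Set
  IsSolution F = IsSpanner F × W̄ ≤ weight (∁ F)

  WithinStretch : Fin n → Fin n → ℕ → Set
  WithinStretch u v k = ∃ λ d → Dist ⊤ u v d × toℚ k ℚ.≤ α ℚ.* toℚ d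

  -- Edges that do not settle themselves count as deleted in all notions
  -- below: they are neither terminal pairs nor usable on a settling path.
  -- They lie on no shortest path, so Dist ⊤ is unaffected by the deletion.
  SettlesItself : Fin m → Set
  SettlesItself e = WithinStretch (src e) (tgt e) (ℓ e)

  TerminalPath : Fin m → Set
  TerminalPath e = Path (src e) (tgt e)

  Settling : (e : Fin m) → TerminalPath e → Set
  Settling e P = Simple P × All SettlesItself (edges P) ×
                 WithinStretch (src e) (tgt e) (pathLength P)

  Alternative : (e : Fin m) → TerminalPath e → Set
  Alternative e P = ¬ (e List.∈ edges P)

  Mandatory : Fin m → Set
  Mandatory e = SettlesItself e × (∀ P → Settling e P → ¬ Alternative e P)

  Trivial : Fin m → Set
  Trivial e = SettlesItself e × (Mandatory e ⊎ w e ≡ 0)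

  Nontrivial : Fin m → Set
  Nontrivial e = SettlesItself e × ¬ Trivial e

  Critical : Fin m → Set
  Critical e = SettlesItself e × (∀ P → Settling e P → ¬ All Trivial (edges P))

  -- P is a possible choice of A_uv, given the set N of nontrivial edges.
  TightestAlternative : Subset m → (e : Fin m) → TerminalPath e → Set
  TightestAlternative N e P =
    Settling e P × Alternative e P ×
    (∀ Q → Settling e Q → Alternative e Q →
       ∣ edgeSet P ∩ N ∣ ≤ ∣ edgeSet Q ∩ N ∣)

  -- "τ is the tightness", with max ∅ = 0.
  IsTightness : ℕ → Set
  IsTightness τ = Σ (Subset m) λ N →
    (∀ e → e ∈ N ⇔ Nontrivial e) ×
    (∀ e P → Critical e → TightestAlternative N e P → ∣ edgeSet P ∩ N ∣ ≤ τ) ×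
    ( (∃₂ λ e P → Critical e × TightestAlternative N e P × ∣ edgeSet P ∩ N ∣ ≡ τ)
    ⊎ ((∀ e → ¬ Critical e) × τ ≡ 0) )

-- Machine model: a unit-cost RAM, presented as a structured language over
-- countably many arrays of naturals.
Memory : Set
Memory = ℕ → ℕ → ℕ

data Exp : Set where
  lit     : ℕ → Exp
  _⟦_⟧    : (array : ℕ) → Exp → Exp
  _⊕_ _⊖_ : Exp → Exp → Exp

-- Products occur only in comparisons (needed for ℓ(P) ≤ α ℓ[u,v] with
-- rational α).  Stored numbers thus gain O(1) bits per step, which rules out
-- the well-known abuses of unit-cost multiplication.
data Test : Set where
  _·_≤_·_ : (a b c d : Exp) → Test

data Cmd : Set where
  skip   : Cmd
  _⟦_⟧≔_ : (array : ℕ) → Exp → Exp → Cmd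
  _⨾_    : Cmd → Cmd → Cmd
  ifte   : Test → Cmd → Cmd → Cmd
  while  : Test → Cmd → Cmd
  -- call p a k b j: run p in a fresh memory on the input a[0..k), then copy
  -- the first j output cells to b[0..j).  All copying is paid for.
  call   : (p : Cmd) (a : ℕ) (k : Exp) (b : ℕ) (j : Exp) → Cmd

eval : Memory → Exp → ℕ
eval σ (lit k)   = k
eval σ (a ⟦ e ⟧) = σ a (eval σ e)
eval σ (e ⊕ f)   = eval σ e + eval σ f
eval σ (e ⊖ f)   = eval σ e ∸ eval σ f

size : Exp → ℕ
size (lit _)   = 1
size (_ ⟦ e ⟧) = suc (size e)
size (e ⊕ f)   = suc (size e + size f)
size (e ⊖ f)   = suc (size e + size f)

test : Memory → Test → Bool
test σ (a · b ≤ c · d) = eval σ a * eval σ b ≤ᵇ eval σ c * eval σ d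

testSize : Test → ℕ
testSize (a · b ≤ c · d) = suc (size a + size b + size c + size d)

write : Memory → ℕ → ℕ → ℕ → Memory
write σ a i x b j = if (a ≡ᵇ b) ∧ (i ≡ᵇ j) then x else σ b j

copy : (from : Memory) (a k : ℕ) (to : Memory) (b : ℕ) → Memory
copy from a k to b c j = if (b ≡ᵇ c) ∧ (j <ᵇ k) then from a j else to c j

cells : Memory → ℕ → ℕ → List ℕ
cells σ a k = map (σ a) (upTo k)

nth : List ℕ → ℕ → ℕ
nth []       _       = 0
nth (x ∷ xs) zero    = x
nth (x ∷ xs) (suc i) = nth xs i

-- Input is presented in array 0; output is expected in array 1.
load : List ℕ → Memory
load xs zero    = nth xs
load xs (suc _) = λ _ → 0

infix 4 _,_⇓[_]_

-- p , σ ⇓[ t ] ρ: started in σ, p halts in ρ after t steps.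
data _,_⇓[_]_ : Cmd → Memory → ℕ → Memory → Set where
  ⇓skip : ∀ {σ} → skip , σ ⇓[ 1 ] σ
  ⇓assign : ∀ {σ a i e} →
    (a ⟦ i ⟧≔ e) , σ ⇓[ suc (size i + size e) ] write σ a (eval σ i) (eval σ e)
  ⇓seq : ∀ {σ ρ υ p q s t} →
    p , σ ⇓[ s ] ρ → q , ρ ⇓[ t ] υ → (p ⨾ q) , σ ⇓[ s + t ] υ
  ⇓then : ∀ {σ ρ b p q t} → test σ b ≡ true →
    p , σ ⇓[ t ] ρ → ifte b p q , σ ⇓[ testSize b + t ] ρ
  ⇓else : ∀ {σ ρ b p q t} → test σ b ≡ false →
    q , σ ⇓[ t ] ρ → ifte b p q , σ ⇓[ testSize b + t ] ρ
  ⇓done : ∀ {σ b p} → test σ b ≡ false →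
    while b p , σ ⇓[ testSize b ] σ
  ⇓loop : ∀ {σ ρ υ b p s t} → test σ b ≡ true →
    p , σ ⇓[ s ] ρ → while b p , ρ ⇓[ t ] υ →
    while b p , σ ⇓[ testSize b + s + t ] υ
  ⇓call : ∀ {σ ρ p a k b j t} →
    p , load (cells σ a (eval σ k)) ⇓[ t ] ρ →
    call p a k b j , σ
      ⇓[ suc (size k + size j + eval σ k + t + eval σ j) ]
      copy ρ 1 (eval σ j) σ b

-- On input xs, p outputs ys in time at most t; reading the input and writing
-- the output are part of the running time.  In particular, a time bound for a
-- graph algorithm is at least linear in m.
Outputs : Cmd → List ℕ → List ℕ → ℕ → Set
Outputs p xs ys t = ∃₂ λ s ρ →
  p , load xs ⇓[ s ] ρ ×
  cells ρ 1 (length ys) ≡ ys ×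
  length xs + s + length ys ≤ t

Computable₂ : (ℕ → ℕ → ℕ) → Set
Computable₂ f = ∃ λ p → ∀ x y → ∃ λ t → Outputs p (x ∷ y ∷ []) (f x y ∷ []) t

encodeNetwork : Network → List ℕ
encodeNetwork G =
  n ∷ m ∷ map (λ e → toℕ (src e)) (allFin m)
       ++ map (λ e → toℕ (tgt e)) (allFin m)
       ++ map ℓ (allFin m)
  where open Network G

encode : Instance → List ℕ
encode I = ℤ.∣ ↥ α ∣ ∷ ↧ₙ α ∷ W̄ ∷ encodeNetwork G ++ map w (allFin m)
  where open Instance I

encodingLength : Instance → ℕ
encodingLength I = sum (map (λ k → suc ⌊log₂ k ⌋) (encode I))

bits : ∀ {m} → Subset m → List ℕ
bits {m} F = map (λ e → if lookup F e then 1 else 0) (allFin m)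

-- In shortest-path outputs a length d is written as suc d, and ∞ as 0.

module _ (G : Network) where
  open Network G

  ShortestCode : Fin n → Fin n → ℕ → Set
  ShortestCode u v o =
    (¬ Path u v × o ≡ 0) ⊎ (∃ λ d → Dist ⊤ u v d × o ≡ suc d)

  SecondCode : ∀ {u v} → Path u v → ℕ → Set
  SecondCode {u} {v} P o =
      ((∀ (Q : Path u v) → Simple Q → edges Q ≡ edges P) × o ≡ 0)
    ⊎ (Σ (Path u v) λ Q → Simple Q × edges Q ≢ edges P ×
         (∀ (R : Path u v) → Simple R → edges R ≢ edges P →
            pathLength Q ≤ pathLength R) ×
         o ≡ suc (pathLength Q))

  TwoShortestCode : Fin n → Fin n → ℕ → ℕ → Set
  TwoShortestCode u v o₁ o₂ =
      (¬ Path u v × o₁ ≡ 0 × o₂ ≡ 0)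
    ⊎ (Σ (Path u v) λ P → Simple P ×
         (∀ (R : Path u v) → Simple R → pathLength P ≤ pathLength R) ×
         o₁ ≡ suc (pathLength P) × SecondCode P o₂)

  pairTable : (Fin n → Fin n → ℕ) → (Fin n → Fin n → ℕ) → List ℕ
  pairTable d₁ d₂ = concatMap
    (λ u → concatMap (λ v → d₁ u v ∷ d₂ u v ∷ []) (allFin n)) (allFin n)

SolvesSPSP : Cmd → (ℕ → ℕ → ℕ) → Set
SolvesSPSP p T = ∀ G → let open Network G in ∀ u v → ∃ λ o →
  ShortestCode G u v o ×
  Outputs p (toℕ u ∷ toℕ v ∷ encodeNetwork G) (o ∷ []) (T n m)

SolvesAPSP₂ : Cmd → (ℕ → ℕ → ℕ) → Set
SolvesAPSP₂ p T = ∀ G → let open Network G in ∃₂ λ d₁ d₂ →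
  (∀ u v → TwoShortestCode G u v (d₁ u v) (d₂ u v)) ×
  Outputs p (encodeNetwork G) (pairTable G d₁ d₂) (T n m)

PolynomiallyBounded : (ℕ → ℕ → ℕ) → Set
PolynomiallyBounded T = ∃₂ λ c k → ∀ n m → T n m ≤ c * suc (n + m) ^ k

DecidesSpanner : Cmd → (Instance → ℕ) → Set
DecidesSpanner p 𝓣 = ∀ I → let open Instance I in
    (∃ IsSolution   × Outputs p (encode I) (1 ∷ []) (𝓣 I))
  ⊎ (¬ ∃ IsSolution × Outputs p (encode I) (0 ∷ []) (𝓣 I))

FindsSpanner : Cmd → (Instance → ℕ) → Set
FindsSpanner p 𝓣 = ∀ I → let open Instance I in
    (∃ λ F → IsSolution F × Outputs p (encode I) (1 ∷ bits F) (𝓣 I))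
  ⊎ (¬ ∃ IsSolution       × Outputs p (encode I) (0 ∷ []) (𝓣 I))

-- 𝓣 is an FPT time bound w.r.t. the combined parameter (W̄ , τ).
FPT : (Instance → ℕ) → Set
FPT 𝓣 = ∃ λ f → Computable₂ f × ∃₂ λ c k →
  ∀ I τ → let open Instance I in IsTightness τ →
    𝓣 I ≤ c * (f W̄ τ * encodingLength I ^ k)

{-# OPTIONS --safe #-}
module Submission where

-- Edges that do not settle themselves can always be removed. A nontrivial edge can be
-- removed alone, since its tightest alternative path remains, and a set of nontrivial
-- edges can be removed if no chosen alternative path of one of them uses another one.
-- So it suffices that the set is independent in a digraph with out-degrees at most τ,
-- and any W̄ (2 τ + 1) nontrivial edges contain such a set of W̄ edges, which has weight
-- at least W̄. On the other hand, a solution that removes any edges yields one that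
-- removes at most W̄ nontrivial edges, apart from those that do not settle themselves.
--
-- The program therefore numbers the nontrivial edges and, for b = 1, 2, …, tries all
-- W̄-tuples over the first b - 1 of them (and a blank); it need not know τ to succeed as
-- soon as b exceeds W̄ (2 τ + 1). Each trial costs at most W̄ shortest paths. Removed
-- edges are kept in the graph with a prohibitive length, so that the subroutines always
-- run on graphs with n nodes and m edges. If the trivial edges already form a spanner
-- (in particular if τ = 0), then no search is needed. An edge is nonmandatory iff a
-- second shortest path joins its ends within the stretch.

open import Defs
open import Data.Bool.Base using (Bool; true; false; if_then_else_; _∧_; _∨_; not; T)
open import Data.Bool.Properties using (¬-not; not-involutive; ∨-zeroʳ) renaming (_≟_ to _≟ᵇ_)
open import Data.Empty using (⊥)
open import Data.Fin.Base using (Fin; zero; suc; toℕ; fromℕ<)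
open import Data.Fin.Properties as Finₚ using (any?; toℕ-injective; toℕ<n; toℕ-fromℕ<; injective⇒≤)
open import Data.Fin.Subset using (Subset; ∣_∣; ⊤; ∁; ⋃; ⁅_⁆; _∩_) renaming (_∈_ to _∈ˢ_; ⊥ to ∅)
open import Data.Fin.Subset.Properties using (_∈?_; ∈⊤; x∉p⇒x∈∁p; x∈∁p⇒x∉p; x∈⁅x⁆; p⊆p∪q; q⊆p∪q; x∈p∩q⁺)
import Data.Integer.Base as ℤ
import Data.Integer.Properties as ℤ
open import Data.List.Base using (List; []; _∷_; _++_; map; length; upTo; applyUpTo; allFin; tabulate; concatMap; filter; take)
import Data.List.Membership.DecPropositional as DecList
import Data.List.Membership.Propositional as List
open import Data.List.Membership.Propositional.Properties using (∈-filter⁺; ∈-allFin)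
open import Data.List.Properties using (map-applyUpTo; map-tabulate; length-map; length-++; length-tabulate; length-take; ++-assoc; ∷-injective)
open import Data.List.Relation.Unary.All as All using (All; []; _∷_)
open import Data.List.Relation.Unary.All.Properties using (++⁺; ¬Any⇒All¬; All¬⇒¬Any; all-filter; take⁺)
open import Data.List.Relation.Unary.Any using (here; there)
open import Data.List.Relation.Unary.Unique.Propositional using (Unique; []; _∷_)
import Data.List.Relation.Unary.Unique.Propositional.Properties as Unique
open import Data.Nat.Base
import Data.Nat.Coprimality as Coprime
open import Data.Nat.Induction using (<-rec)
open import Data.Nat.ListAction using (sum)
open import Data.Nat.Logarithm using (⌊log₂_⌋)
open import Data.Nat.Properties
open import Data.Nat.Tactic.RingSolver using (solve-∀)
open import Data.Product.Base using (Σ; ∃; ∃₂; _×_; _,_; proj₁; proj₂)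
open import Data.Product.Properties using (,-injective; ≡-dec)
open import Data.Rational.Base as ℚ using (ℚ; mkℚ; 1ℚ; ↥_; ↧ₙ_; toℚᵘ)
import Data.Rational.Properties as ℚ
open import Data.Rational.Unnormalised.Base as ℚᵘ using (mkℚᵘ)
import Data.Rational.Unnormalised.Properties as ℚᵘ
open import Data.Sum.Base using (_⊎_; inj₁; inj₂; [_,_]′)
open import Data.Vec.Base as Vec using (lookup; []; _∷_)
open import Data.Vec.Properties using ([]=⇒lookup; lookup⇒[]=; lookup-map; lookup-replicate; lookup∘tabulate; tabulate-cong)
open import Function.Base using (_∘_; id; case_of_)
open import Function.Bundles using (module Equivalence)
open import Relation.Binary.Definitions using (tri<; tri≈; tri>)
open import Relation.Binary.PropositionalEquality
open import Relation.Nullary using (¬_; yes; no; contradiction; Dec; does)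
open import Relation.Nullary.Decidable using (_×-dec_; _⊎-dec_; map′; dec-true; ¬¬-excluded-middle)

-- Neither criticality nor tightest alternative paths are ever decided: the program classifies edges
-- only by comparing numbers that the subroutines return. The tightness enters through the bound on
-- the number of trials alone. There a tightest path for every edge is available only under a double
-- negation, which does no harm because the goal is an inequality of natural numbers. Restarting the
-- enumeration for each b repeats tuples and leads to at most (W̄ (2 τ + 1) + 1) ^ (W̄ + 1) trials,
-- one factor more than a single pass would need. The claimed bound has room for this. Once τ is
-- positive, the base is at most 4 W̄ τ; the exponent W̄ + 1 of τ is at most 2 W̄; and trials with
-- W̄ queries each use W̄ + 2 of the 2 W̄ + 1 factors W̄, so that the remaining W̄ - 1 absorb the
-- powers of 4 up to a constant. For W̄ = 0 the first term of the bound vanishes, and the little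
-- work that is left is charged to the all-pairs term.

≡ᵇ-refl : ∀ i → (i ≡ᵇ i) ≡ true
≡ᵇ-refl zero    = refl
≡ᵇ-refl (suc i) = ≡ᵇ-refl i

≡ᵇ-true : ∀ {i j} → (i ≡ᵇ j) ≡ true → i ≡ j
≡ᵇ-true {i} {j} p = ≡ᵇ⇒≡ i j (subst T (sym p) _)

≡ᵇ-false : ∀ {i j} → i ≢ j → (i ≡ᵇ j) ≡ false
≡ᵇ-false {i} {j} i≢j with i ≡ᵇ j in eq
... | true  = contradiction (≡ᵇ-true eq) i≢j
... | false = refl

≤ᵇ-true : ∀ {i j} → i ≤ j → (i ≤ᵇ j) ≡ true
≤ᵇ-true {i} {j} p with i ≤ᵇ j | ≤⇒≤ᵇ p
... | true | _ = refl

≤ᵇ-false : ∀ {i j} → ¬ i ≤ j → (i ≤ᵇ j) ≡ false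
≤ᵇ-false {i} {j} p with i ≤ᵇ j in eq
... | true  = contradiction (≤ᵇ⇒≤ i j (subst T (sym eq) _)) p
... | false = refl

≤ᵇ-true⁻¹ : ∀ {i j} → (i ≤ᵇ j) ≡ true → i ≤ j
≤ᵇ-true⁻¹ {i} {j} eq = ≤ᵇ⇒≤ i j (subst T (sym eq) _)

≤ᵇ-false⁻¹ : ∀ {i j} → (i ≤ᵇ j) ≡ false → ¬ i ≤ j
≤ᵇ-false⁻¹ eq i≤j with () ← trans (sym eq) (≤ᵇ-true i≤j)

<ᵇ-true : ∀ {i j} → i < j → (i <ᵇ j) ≡ true
<ᵇ-true {i} {j} p with i <ᵇ j | <⇒<ᵇ p
... | true | _ = refl

<ᵇ-false : ∀ {i j} → ¬ i < j → (i <ᵇ j) ≡ false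
<ᵇ-false {i} {j} p with i <ᵇ j in eq
... | true  = contradiction (<ᵇ⇒< i j (subst T (sym eq) _)) p
... | false = refl

-- Running times on the RAM

-- A coefficient for the running time: every program below runs in time at
-- most cost p * X, where X depends on the input only (through the numbers of
-- iterations of the loops and the running times of the subroutines).
cost : Cmd → ℕ
cost skip             = 1
cost (_ ⟦ i ⟧≔ e)     = suc (size i + size e)
cost (p ⨾ q)          = cost p + cost q
cost (ifte b p q)     = testSize b + (cost p + cost q)
cost (while b p)      = testSize b + cost p
cost (call p a k b j) = 4 + size k + size j

record Runs (p : Cmd) (σ : Memory) (X : ℕ) (Q : Memory → Set) : Set where
  constructor runs
  field
    steps : ℕ
    end   : Memory
    run   : p , σ ⇓[ steps ] end
    fast  : steps ≤ cost p * X
    post  : Q end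

runs-weaken : ∀ {p σ X Y Q R} → X ≤ Y → (∀ ρ → Q ρ → R ρ) → Runs p σ X Q → Runs p σ Y R
runs-weaken {p} X≤Y f (runs s ρ r s≤ q) =
  runs s ρ r (≤-trans s≤ (*-monoʳ-≤ (cost p) X≤Y)) (f ρ q)

runs-slower : ∀ {p σ X Y Q} → X ≤ Y → Runs p σ X Q → Runs p σ Y Q
runs-slower X≤Y = runs-weaken X≤Y (λ _ q → q)

-- Both parts are charged against the same `X` and only the syntactic coefficients add up, so
-- sequences of any length keep the factor that depends on the instance.
runs-seq : ∀ {p q σ X Q R} → Runs p σ X Q → (∀ ρ → Q ρ → Runs q ρ X R) → Runs (p ⨾ q) σ X R
runs-seq {p} {q} {X = X} (runs s ρ r s≤ h) k with k ρ h
... | runs t υ r′ t≤ h′ = runs (s + t) υ (⇓seq r r′)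
  (≤-trans (+-mono-≤ s≤ t≤) (≤-reflexive (sym (*-distribʳ-+ X (cost p) (cost q))))) h′

module _ {b : Test} {p q : Cmd} {σ : Memory} {X : ℕ} {Q : Memory → Set} (1≤X : 1 ≤ X) where

  private
    c = testSize b

    scale : c ≤ c * X
    scale = subst (_≤ c * X) (*-identityʳ c) (*-monoʳ-≤ c 1≤X)

  runs-then : test σ b ≡ true → Runs p σ X Q → Runs (ifte b p q) σ X Q
  runs-then eq (runs s ρ r s≤ h) = runs (c + s) ρ (⇓then eq r)
    (≤-trans (+-mono-≤ scale (≤-trans s≤ (*-monoˡ-≤ X (m≤m+n (cost p) (cost q)))))
             (≤-reflexive (sym (*-distribʳ-+ X c (cost p + cost q))))) h

  runs-else : test σ b ≡ false → Runs q σ X Q → Runs (ifte b p q) σ X Q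
  runs-else eq (runs s ρ r s≤ h) = runs (c + s) ρ (⇓else eq r)
    (≤-trans (+-mono-≤ scale (≤-trans s≤ (*-monoˡ-≤ X (m≤n+m (cost q) (cost p)))))
             (≤-reflexive (sym (*-distribʳ-+ X c (cost p + cost q))))) h

runs-skip : ∀ {σ X} {Q : Memory → Set} → 1 ≤ X → Q σ → Runs skip σ X Q
runs-skip {σ} {X} 1≤X q = runs 1 σ ⇓skip (subst (1 ≤_) (sym (*-identityˡ X)) 1≤X) q

-- Assignments of conditional expressions

-- A body that chooses between values thus counts as one assignment with a computed `value`, the
-- only shape that the rules for array loops below have to handle.
data Tree : Set where
  ret  : Exp → Tree
  cond : Test → Tree → Tree → Tree

value : Memory → Tree → ℕ
value σ (ret e)      = eval σ e
value σ (cond b s t) = if test σ b then value σ s else value σ t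

infix 19 _⟦_⟧←_

_⟦_⟧←_ : ℕ → Exp → Tree → Cmd
a ⟦ x ⟧← ret e      = a ⟦ x ⟧≔ e
a ⟦ x ⟧← cond b s t = ifte b (a ⟦ x ⟧← s) (a ⟦ x ⟧← t)

runs-assign : ∀ {a x σ X} V {Q : Memory → Set} → 1 ≤ X →
  Q (write σ a (eval σ x) (value σ V)) → Runs (a ⟦ x ⟧← V) σ X Q
runs-assign {a} {x} {σ} {X} (ret e) 1≤X q =
  runs _ _ ⇓assign (subst (_≤ c * X) (*-identityʳ c) (*-monoʳ-≤ c 1≤X)) q
  where c = suc (size x + size e)
runs-assign {a} {x} {σ} (cond b s t) {Q} 1≤X q with test σ b in eq
... | true  = runs-then {b} 1≤X eq (runs-assign s 1≤X q)
... | false = runs-else {b} 1≤X eq (runs-assign t 1≤X q)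

-- Cells that a program leaves alone

-- Tracked per array, so that `writes p c ≡ false` holds by computation for the programs below. A
-- `call` touches its result array only, whatever the subroutine does, because that runs in a fresh
-- memory.
writes : Cmd → ℕ → Bool
writes skip             c = false
writes (a ⟦ _ ⟧≔ _)     c = a ≡ᵇ c
writes (p ⨾ q)          c = writes p c ∨ writes q c
writes (ifte _ p q)     c = writes p c ∨ writes q c
writes (while _ p)      c = writes p c
writes (call _ _ _ b _) c = b ≡ᵇ c

Frame : Cmd → Memory → Memory → Set
Frame p σ ρ = ∀ c → writes p c ≡ false → ∀ j → ρ c j ≡ σ c j

∨-falseˡ : ∀ {x y} → x ∨ y ≡ false → x ≡ false
∨-falseˡ {false} _ = refl

∨-falseʳ : ∀ {x y} → x ∨ y ≡ false → y ≡ false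
∨-falseʳ {false} p = p

frame : ∀ {p σ t ρ} → p , σ ⇓[ t ] ρ → Frame p σ ρ
frame ⇓skip c _ j = refl
frame (⇓assign {σ} {a} {i}) c eq j rewrite eq = refl
frame (⇓seq {p = p} r s) c eq j =
  trans (frame s c (∨-falseʳ {writes p c} eq) j) (frame r c (∨-falseˡ eq) j)
frame (⇓then _ r) c eq j = frame r c (∨-falseˡ eq) j
frame (⇓else {p = p} _ r) c eq j = frame r c (∨-falseʳ {writes p c} eq) j
frame (⇓done _) c eq j = refl
frame (⇓loop _ r s) c eq j = trans (frame s c eq j) (frame r c eq j)
frame (⇓call _) c eq j rewrite eq = refl

framed : ∀ {p σ X Q} → Runs p σ X Q → Runs p σ X (λ ρ → Frame p σ ρ × Q ρ)
framed (runs s ρ r s≤ h) = runs s ρ r s≤ (frame r , h)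

-- Counting loops

-- One counter cell serves all loops: no `for` contains another, and subroutines have a memory of
-- their own.
ctr : ℕ
ctr = 2

idx : Exp
idx = ctr ⟦ lit 0 ⟧

below : Exp → Test
below k = lit 1 · (idx ⊕ lit 1) ≤ lit 1 · k

for : Exp → Cmd → Cmd
for k p = (ctr ⟦ lit 0 ⟧≔ lit 0) ⨾ while (below k) (p ⨾ (ctr ⟦ lit 0 ⟧≔ (idx ⊕ lit 1)))

module _ {k : Exp} {p : Cmd} (Inv : ℕ → Memory → Set) (K Y : ℕ)
  (set : ∀ i σ x → Inv i σ → Inv i (write σ ctr 0 x))
  (bound : ∀ i σ → Inv i σ → eval σ k ≡ K)
  (body : ∀ (e : Fin K) σ → σ ctr 0 ≡ toℕ e → Inv (toℕ e) σ →
          Runs p σ Y (λ ρ → ρ ctr 0 ≡ toℕ e × Inv (suc (toℕ e)) ρ))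
  where

  private
    c = testSize (below k)
    -- The 6 is the running time of the assignment that increments the counter.
    d = cost p * Y + 6

    next : ∀ {i r} → i + suc r ≡ K → i < K
    next {i} {r} eq = ≤-trans (≤-reflexive (+-comm 1 i)) (≤-trans (+-monoʳ-≤ i (s≤s z≤n)) (≤-reflexive eq))

    iterate : ∀ r i σ → i + r ≡ K → σ ctr 0 ≡ i → Inv i σ →
      ∃₂ λ s ρ → (while (below k) (p ⨾ (ctr ⟦ lit 0 ⟧≔ (idx ⊕ lit 1))) , σ ⇓[ s ] ρ) ×
        s ≤ c + r * (c + d) × Inv K ρ
    iterate zero i σ i+0≡K at inv = c , σ , ⇓done fails , m≤m+n c 0 , subst (λ i → Inv i σ) i≡K inv
      where
      i≡K = trans (sym (+-identityʳ i)) i+0≡K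
      fails : test σ (below k) ≡ false
      fails = ≤ᵇ-false λ le → 1+n≰n (subst₂ _≤_
        (trans (+-identityʳ _) (trans (+-comm (σ ctr 0) 1) (cong suc (trans at i≡K))))
        (trans (+-identityʳ _) (bound i σ inv)) le)
    iterate (suc r) i σ i+r≡K at inv
      with body (fromℕ< (next i+r≡K)) σ (trans at (sym (toℕ-fromℕ< (next i+r≡K))))
             (subst (λ i → Inv i σ) (sym (toℕ-fromℕ< (next i+r≡K))) inv)
    ... | runs s ρ run s≤ (at′ , inv′) rewrite toℕ-fromℕ< (next i+r≡K)
      with iterate r (suc i) (write ρ ctr 0 (ρ ctr 0 + 1)) (trans (sym (+-suc i r)) i+r≡K)
             (trans (+-comm (ρ ctr 0) 1) (cong suc at′)) (set (suc i) ρ _ inv′)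
    ... | t , υ , rest , t≤ , inv″ = c + (s + 6) + t , υ ,
      ⇓loop holds (⇓seq run ⇓assign) rest ,
      ≤-trans (+-mono-≤ (+-monoʳ-≤ c (+-monoˡ-≤ 6 s≤)) t≤) (≤-reflexive (shuffle c d (r * (c + d)))) , inv″
      where
      shuffle : ∀ c d x → (c + d) + (c + x) ≡ c + (c + d + x)
      shuffle = solve-∀
      holds : test σ (below k) ≡ true
      holds = ≤ᵇ-true (subst₂ _≤_
        (sym (trans (+-identityʳ _) (trans (+-comm (σ ctr 0) 1) (cong suc at))))
        (sym (trans (+-identityʳ _) (bound i σ inv))) (next i+r≡K))

  -- The `suc` pays for initialising the counter and for the failing test, which are due even if `K`
  -- is 0.
  runs-for : ∀ {σ} → 1 ≤ Y → Inv 0 σ → Runs (for k p) σ (suc (K * Y)) (Inv K)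
  runs-for {σ} 1≤Y inv with iterate K 0 (write σ ctr 0 0) refl refl (set 0 σ 0 inv)
  ... | s , ρ , run , s≤ , inv′ =
    runs (3 + s) ρ (⇓seq ⇓assign run) (≤-trans (+-monoʳ-≤ 3 s≤) total) inv′
    where
    total : 3 + (c + K * (c + (cost p * Y + 6))) ≤ (3 + (c + (cost p + 6))) * suc (K * Y)
    total = begin
      3 + (c + K * (c + (cost p * Y + 6)))
        ≤⟨ +-monoʳ-≤ 3 (+-monoʳ-≤ c (*-monoʳ-≤ K (≤-trans (+-monoʳ-≤ c (+-monoʳ-≤ (cost p * Y) (m≤m*n 6 Y {{>-nonZero 1≤Y}})))
             (+-monoˡ-≤ _ (m≤m*n c Y {{>-nonZero 1≤Y}}))))) ⟩
      3 + (c + K * (c * Y + (cost p * Y + 6 * Y)))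
        ≤⟨ m≤m+n _ (cost p + 6 + 3 * (K * Y)) ⟩
      3 + (c + K * (c * Y + (cost p * Y + 6 * Y))) + (cost p + 6 + 3 * (K * Y))
        ≡⟨ shuffle c (cost p) K Y ⟩
      (3 + (c + (cost p + 6))) * suc (K * Y) ∎
      where
      open ≤-Reasoning
      shuffle : ∀ c x K Y → 3 + (c + K * (c * Y + (x * Y + 6 * Y))) + (x + 6 + 3 * (K * Y))
                          ≡ (3 + (c + (x + 6))) * suc (K * Y)
      shuffle = solve-∀

-- Loops that modify a single array: F i is its content after i iterations.

overlay : ℕ → (ℕ → ℕ) → Memory → Memory
overlay a f σ b j = if a ≡ᵇ b then f j else σ b j

-- Memories are functions, so loop states are compared cell by cell, and evaluation has to be shown
-- to respect this.
_≈_ : Memory → Memory → Set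
σ ≈ τ = ∀ b j → σ b j ≡ τ b j

eval-cong : ∀ {σ τ} → σ ≈ τ → ∀ e → eval σ e ≡ eval τ e
eval-cong h (lit k)       = refl
eval-cong {σ} h (a ⟦ e ⟧) = trans (cong (σ a) (eval-cong h e)) (h a _)
eval-cong h (e ⊕ f)       = cong₂ _+_ (eval-cong h e) (eval-cong h f)
eval-cong h (e ⊖ f)       = cong₂ _∸_ (eval-cong h e) (eval-cong h f)

test-cong : ∀ {σ τ} → σ ≈ τ → ∀ b → test σ b ≡ test τ b
test-cong h (a · b ≤ c · d) =
  cong₂ _≤ᵇ_ (cong₂ _*_ (eval-cong h a) (eval-cong h b)) (cong₂ _*_ (eval-cong h c) (eval-cong h d))

value-cong : ∀ {σ τ} → σ ≈ τ → ∀ V → value σ V ≡ value τ V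
value-cong h (ret e)      = eval-cong h e
value-cong h (cond b s t) rewrite test-cong h b | value-cong h s | value-cong h t = refl

at : Memory → ℕ → Memory
at σ x = write σ ctr 0 x

module _ (a : ℕ) {k x : Exp} {V : Tree} {σ : Memory} (K : ℕ) (F : ℕ → ℕ → ℕ)
  (a≢ctr : (a ≡ᵇ ctr) ≡ false)
  (initial : ∀ j → σ a j ≡ F 0 j)
  (bound : ∀ i y → eval (overlay a (F i) (at σ y)) k ≡ K)
  (step : ∀ (e : Fin K) j →
          (if eval (overlay a (F (toℕ e)) (at σ (toℕ e))) x ≡ᵇ j
           then value (overlay a (F (toℕ e)) (at σ (toℕ e))) V else F (toℕ e) j) ≡ F (suc (toℕ e)) j)
  where

  private
    State : ℕ → Memory → Set
    State i τ = τ ≈ overlay a (F i) (at σ (τ ctr 0))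

    a≢ : ∀ {b} → (a ≡ᵇ b) ≡ true → (ctr ≡ᵇ b) ≡ false
    a≢ {b} eq = ≡ᵇ-false λ ctr≡b → case trans (sym eq) (trans (cong (a ≡ᵇ_) (sym ctr≡b)) a≢ctr) of λ ()

    set : ∀ i τ y → State i τ → State i (at τ y)
    set i τ y h b j with a ≡ᵇ b in eq | h b j
    ... | true  | hb rewrite a≢ {b} eq = hb
    ... | false | hb with ctr ≡ᵇ b | 0 ≡ᵇ j
    ...   | true  | true  = refl
    ...   | true  | false = hb
    ...   | false | _     = hb

    body : 1 ≤ 1 → ∀ (e : Fin K) τ → τ ctr 0 ≡ toℕ e → State (toℕ e) τ →
      Runs (a ⟦ x ⟧← V) τ 1 (λ ρ → ρ ctr 0 ≡ toℕ e × State (suc (toℕ e)) ρ)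
    body 1≤1 e τ τe h = runs-assign V 1≤1 (kept , state)
      where
      S = overlay a (F (toℕ e)) (at σ (toℕ e))
      τ≈S : τ ≈ S
      τ≈S = subst (λ z → τ ≈ overlay a (F (toℕ e)) (at σ z)) τe h
      kept : write τ a (eval τ x) (value τ V) ctr 0 ≡ toℕ e
      kept rewrite a≢ctr = τe
      state : State (suc (toℕ e)) (write τ a (eval τ x) (value τ V))
      state b j rewrite a≢ctr with a ≡ᵇ b in eq | h b j
      ... | false | hb = hb
      ... | true  | hb with refl ← ≡ᵇ-true {a} {b} eq =
        trans (cong₂ (λ u v → if u ≡ᵇ j then v else τ a j) (eval-cong τ≈S x) (value-cong τ≈S V))
              (trans (cong (λ v → if eval S x ≡ᵇ j then value S V else v) hb) (step e j))

  runs-loop : Runs (for k (a ⟦ x ⟧← V)) σ (suc (K * 1)) (λ ρ → ∀ j → ρ a j ≡ F K j)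
  runs-loop = runs-weaken ≤-refl final (runs-for State K 1 set bounded (body ≤-refl) ≤-refl start)
    where
    bounded : ∀ i τ → State i τ → eval τ k ≡ K
    bounded i τ h = trans (eval-cong h k) (bound i _)
    start : State 0 σ
    start b j with a ≡ᵇ b in eq
    ... | true with refl ← ≡ᵇ-true {a} {b} eq = initial j
    ... | false with ctr ≡ᵇ b in eq′ | 0 ≡ᵇ j in eq″
    ...   | true  | true  with refl ← ≡ᵇ-true {ctr} {b} eq′ | refl ← ≡ᵇ-true {0} {j} eq″ = refl
    ...   | true  | false = refl
    ...   | false | _     = refl
    final : ∀ ρ → State K ρ → ∀ j → ρ a j ≡ F K j
    final ρ h j = trans (h a j) (cong (λ z → if z then F K j else at σ (ρ ctr 0) a j) (≡ᵇ-refl a))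

-- Serves as the `F` of `runs-loop` for a fill from left to right: `i` values of `f` have replaced
-- the cells of `g` from offset `o` on.
patch : ℕ → (ℕ → ℕ) → (ℕ → ℕ) → ℕ → ℕ → ℕ
patch o f g i j = if j <ᵇ o then g j else (if j <ᵇ o + i then f (j ∸ o) else g j)

patch-below : ∀ o f g i {j} → j < o → patch o f g i j ≡ g j
patch-below o f g i j<o rewrite <ᵇ-true j<o = refl

patch-written : ∀ o f g i {j} → j < i → patch o f g i (o + j) ≡ f j
patch-written o f g i {j} j<i
  rewrite <ᵇ-false (m+n≮m o j) | <ᵇ-true (+-monoʳ-< o j<i) = cong f (m+n∸m≡n o j)

patch-above : ∀ o f g i {j} → i ≤ j → patch o f g i (o + j) ≡ g (o + j)
patch-above o f g i {j} i≤j
  rewrite <ᵇ-false (m+n≮m o j) | <ᵇ-false (≤⇒≯ (+-monoʳ-≤ o i≤j)) = refl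

patch-suc : ∀ o f g i j → (if o + i ≡ᵇ j then f i else patch o f g i j) ≡ patch o f g (suc i) j
patch-suc o f g i j with j <? o
... | yes j<o rewrite <ᵇ-true j<o | ≡ᵇ-false {o + i} {j} (λ eq → m+n≮m o i (subst (_< o) (sym eq) j<o)) = refl
... | no j≮o with o + i ≟ j
...   | yes refl rewrite ≡ᵇ-refl (o + i) | <ᵇ-false j≮o | <ᵇ-true (+-monoʳ-< o (n<1+n i)) = cong f (sym (m+n∸m≡n o i))
...   | no o+i≢j rewrite ≡ᵇ-false o+i≢j | <ᵇ-false j≮o with j <? o + i
...     | yes j<o+i rewrite <ᵇ-true j<o+i | <ᵇ-true (<-trans j<o+i (+-monoʳ-< o (n<1+n i))) = refl
...     | no j≮o+i rewrite <ᵇ-false j≮o+i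
            | <ᵇ-false (λ j<o+1+i → j≮o+i (≤∧≢⇒< (s≤s⁻¹ (subst (j <_) (+-suc o i) j<o+1+i)) (o+i≢j ∘ sym))) = refl

module _ (a : ℕ) {k off : Exp} {V : Tree} {σ : Memory} (K o : ℕ)
  (a≢ctr : (a ≡ᵇ ctr) ≡ false)
  (bound : ∀ g y → eval (overlay a g (at σ y)) k ≡ K)
  (offset : ∀ g y → eval (overlay a g (at σ y)) off ≡ o)
  (reads : ∀ e → value (overlay a (patch o (λ i → value (at σ i) V) (σ a) e) (at σ e)) V ≡ value (at σ e) V)
  where

  -- By the hypothesis reads, V does not see the cells that the loop has modified.
  runs-fill : Runs (for k (a ⟦ off ⊕ idx ⟧← V)) σ (suc (K * 1))
    (λ ρ → (∀ i → i < K → ρ a (o + i) ≡ value (at σ i) V) × (∀ j → j < o → ρ a j ≡ σ a j))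
  runs-fill = runs-weaken ≤-refl
    (λ ρ h → (λ i i<K → trans (h (o + i)) (patch-written o f (σ a) K i<K)) ,
             (λ j j<o → trans (h j) (patch-below o f (σ a) K j<o)))
    (runs-loop a K (patch o f (σ a)) a≢ctr start (λ i y → bound _ y) step)
    where
    f : ℕ → ℕ
    f i = value (at σ i) V
    start : ∀ j → σ a j ≡ patch o f (σ a) 0 j
    start j with j <ᵇ o in eq
    ... | true = refl
    ... | false rewrite +-identityʳ o | eq = refl
    step : ∀ (e : Fin K) → let S = overlay a (patch o f (σ a) (toℕ e)) (at σ (toℕ e)) in
           ∀ j → (if eval S (off ⊕ idx) ≡ᵇ j then value S V else patch o f (σ a) (toℕ e) j)
                 ≡ patch o f (σ a) (suc (toℕ e)) j
    step e j rewrite offset (patch o f (σ a) (toℕ e)) (toℕ e) | a≢ctr | reads (toℕ e) =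
      patch-suc o f (σ a) (toℕ e) j

module _ (a : ℕ) {k : Exp} {V : Tree} {σ : Memory} (K : ℕ) (r : ℕ → ℕ)
  (a≢ctr : (a ≡ᵇ ctr) ≡ false)
  (bound : ∀ g y → eval (overlay a g (at σ y)) k ≡ K)
  where

  runs-fold : σ a 0 ≡ r 0 →
    (∀ (e : Fin K) g → g 0 ≡ r (toℕ e) → value (overlay a g (at σ (toℕ e))) V ≡ r (suc (toℕ e))) →
    Runs (for k (a ⟦ lit 0 ⟧← V)) σ (suc (K * 1)) (λ ρ → ρ a 0 ≡ r K)
  runs-fold start step = runs-weaken ≤-refl (λ ρ h → h 0)
    (runs-loop a K F a≢ctr start′ (λ i y → bound _ y) step′)
    where
    F : ℕ → ℕ → ℕ
    F i zero    = r i
    F i (suc j) = σ a (suc j)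
    start′ : ∀ j → σ a j ≡ F 0 j
    start′ zero    = start
    start′ (suc j) = refl
    step′ : ∀ (e : Fin K) → let S = overlay a (F (toℕ e)) (at σ (toℕ e)) in
      ∀ j → (if 0 ≡ᵇ j then value S V else F (toℕ e) j) ≡ F (suc (toℕ e)) j
    step′ e zero    = step e (F (toℕ e)) refl
    step′ e (suc j) = refl

  runs-scan : σ a 0 ≡ r 0 →
    (∀ (e : Fin K) g → g (toℕ e) ≡ r (toℕ e) → value (overlay a g (at σ (toℕ e))) V ≡ r (suc (toℕ e))) →
    Runs (for k (a ⟦ lit 1 ⊕ idx ⟧← V)) σ (suc (K * 1)) (λ ρ → ∀ i → i ≤ K → ρ a i ≡ r i)
  runs-scan start step = runs-weaken ≤-refl (λ ρ h i i≤K → trans (h i) (F-written K i≤K))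
    (runs-loop a K F a≢ctr start′ (λ i y → bound _ y) step′)
    where
    F : ℕ → ℕ → ℕ
    -- `suc i` and not `i`: cell 0 has its final value before the loop starts.
    F i = patch 0 r (σ a) (suc i)
    F-written : ∀ i {j} → j ≤ i → F i j ≡ r j
    F-written i j≤i = patch-written 0 r (σ a) (suc i) (s≤s j≤i)
    start′ : ∀ j → σ a j ≡ F 0 j
    start′ zero    = start
    start′ (suc j) = refl
    step′ : ∀ (e : Fin K) → let S = overlay a (F (toℕ e)) (at σ (toℕ e)) in
      ∀ j → (if eval S (lit 1 ⊕ idx) ≡ᵇ j then value S V else F (toℕ e) j) ≡ F (suc (toℕ e)) j
    step′ e j rewrite a≢ctr | step e (F (toℕ e)) (F-written (toℕ e) ≤-refl) =
      patch-suc 0 r (σ a) (suc (toℕ e)) j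

-- Subroutine calls

nth-ext : ∀ {f : ℕ → ℕ} xs → (∀ i → i < length xs → f i ≡ nth xs i) → map f (upTo (length xs)) ≡ xs
nth-ext {f} xs h = trans (map-applyUpTo id f (length xs)) (go f xs h)
  where
  go : ∀ (f : ℕ → ℕ) xs → (∀ i → i < length xs → f i ≡ nth xs i) → applyUpTo (λ i → f i) (length xs) ≡ xs
  go f []       h = refl
  go f (x ∷ xs) h = cong₂ _∷_ (h 0 (s≤s z≤n)) (go (f ∘ suc) xs (λ i i< → h (suc i) (s≤s i<)))

cells-nth : ∀ {f : ℕ → ℕ} {xs} → map f (upTo (length xs)) ≡ xs → ∀ i → i < length xs → f i ≡ nth xs i
cells-nth {f} {xs} eq = go f xs (trans (sym (map-applyUpTo id f (length xs))) eq)
  where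
  go : ∀ (f : ℕ → ℕ) xs → applyUpTo (λ i → f i) (length xs) ≡ xs → ∀ i → i < length xs → f i ≡ nth xs i
  go f (x ∷ xs) eq zero    _        = proj₁ (∷-injective eq)
  go f (x ∷ xs) eq (suc i) (s≤s i<) = go (f ∘ suc) xs (proj₂ (∷-injective eq)) i i<

-- Copying needs no budget of its own, since `Outputs` already counts the lengths of input and
-- output in `X`.
runs-call : ∀ {p a k b j σ xs ys X} → Outputs p xs ys X → 1 ≤ X →
  eval σ k ≡ length xs → (∀ i → i < length xs → σ a i ≡ nth xs i) → eval σ j ≡ length ys →
  Runs (call p a k b j) σ X (λ ρ → ∀ i → i < length ys → ρ b i ≡ nth ys i)
runs-call {p} {a} {k} {b} {j} {σ} {xs} {ys} {X} (s , ρ , run , out , fast) 1≤X ek input ej =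
  runs _ _ (⇓call run′) total result
  where
  run′ : p , load (cells σ a (eval σ k)) ⇓[ s ] ρ
  run′ rewrite ek | nth-ext {σ a} xs input = run
  c = size k + size j
  total : suc (size k + size j + eval σ k + s + eval σ j) ≤ (4 + size k + size j) * X
  total rewrite ek | ej = begin
    suc (c + length xs + s + length ys)
      ≡⟨ cong suc (trans (cong (_+ length ys) (+-assoc c (length xs) s)) (+-assoc c (length xs + s) (length ys))) ⟩
    suc c + (length xs + s + length ys)
      ≤⟨ +-mono-≤ (m≤m*n (suc c) X {{>-nonZero 1≤X}}) fast ⟩
    suc c * X + X
      ≡⟨ +-comm (suc c * X) X ⟩
    (2 + c) * X
      ≤⟨ *-monoˡ-≤ X (m≤n+m (2 + c) 2) ⟩
    (4 + c) * X ∎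
    where open ≤-Reasoning
  result : ∀ i → i < length ys → copy ρ 1 (eval σ j) σ b b i ≡ nth ys i
  result i i< rewrite ej | ≡ᵇ-refl b | <ᵇ-true i< = cells-nth {ρ 1} {ys} out i i<

-- Finite sums

∑ : ∀ {m} → (Fin m → ℕ) → ℕ
∑ {zero}  f = 0
∑ {suc m} f = f zero + ∑ (f ∘ suc)

bit : Bool → ℕ
bit b = if b then 1 else 0

bit≤1 : ∀ b → bit b ≤ 1
bit≤1 true  = s≤s z≤n
bit≤1 false = z≤n

sum-allFin : ∀ {m} (f : Fin m → ℕ) → sum (map f (allFin m)) ≡ ∑ f
sum-allFin f = trans (cong sum (map-tabulate id f)) (go f)
  where
  go : ∀ {m} (f : Fin m → ℕ) → sum (tabulate f) ≡ ∑ f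
  go {zero}  f = refl
  go {suc m} f = cong (f zero +_) (go (f ∘ suc))

∑-cong : ∀ {m} {f g : Fin m → ℕ} → (∀ i → f i ≡ g i) → ∑ f ≡ ∑ g
∑-cong {zero}  h = refl
∑-cong {suc m} h = cong₂ _+_ (h zero) (∑-cong (h ∘ suc))

∑-mono : ∀ {m} {f g : Fin m → ℕ} → (∀ i → f i ≤ g i) → ∑ f ≤ ∑ g
∑-mono {zero}  h = z≤n
∑-mono {suc m} h = +-mono-≤ (h zero) (∑-mono (h ∘ suc))

∑-+ : ∀ {m} (f g : Fin m → ℕ) → ∑ (λ i → f i + g i) ≡ ∑ f + ∑ g
∑-+ {zero}  f g = refl
∑-+ {suc m} f g = trans (cong ((f zero + g zero) +_) (∑-+ (f ∘ suc) (g ∘ suc)))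
                        (shuffle (f zero) (g zero) (∑ (f ∘ suc)) (∑ (g ∘ suc)))
  where
  shuffle : ∀ a b c d → (a + b) + (c + d) ≡ (a + c) + (b + d)
  shuffle = solve-∀

∑-* : ∀ {m} (f : Fin m → ℕ) c → ∑ (λ i → f i * c) ≡ ∑ f * c
∑-* {zero}  f c = refl
∑-* {suc m} f c = trans (cong (f zero * c +_) (∑-* (f ∘ suc) c)) (sym (*-distribʳ-+ c (f zero) (∑ (f ∘ suc))))

∑-zero : ∀ m → ∑ {m} (λ _ → 0) ≡ 0
∑-zero zero    = refl
∑-zero (suc m) = ∑-zero m

∑-swap : ∀ {m n} (f : Fin m → Fin n → ℕ) → ∑ (λ i → ∑ (f i)) ≡ ∑ (λ j → ∑ (λ i → f i j))
∑-swap {zero}  {n} f = sym (∑-zero n)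
∑-swap {suc m} {n} f = trans (cong (∑ (f zero) +_) (∑-swap (f ∘ suc)))
                             (sym (∑-+ (f zero) (λ j → ∑ (λ i → f (suc i) j))))

≤-∑ : ∀ {m} (f : Fin m → ℕ) i → f i ≤ ∑ f
≤-∑ f zero    = m≤m+n (f zero) _
≤-∑ f (suc i) = ≤-trans (≤-∑ (f ∘ suc) i) (m≤n+m _ (f zero))

mask : ∀ {m} → Fin m → (Fin m → ℕ) → Fin m → ℕ
mask x f i = if does (x Finₚ.≟ i) then 0 else f i

mask-≢ : ∀ {m} {x i : Fin m} (f : Fin m → ℕ) → x ≢ i → mask x f i ≡ f i
mask-≢ {x = x} {i} f x≢i with x Finₚ.≟ i
... | yes x≡i = contradiction x≡i x≢i
... | no  _   = refl

∑-mask : ∀ {m} (f : Fin m → ℕ) x → ∑ f ≡ f x + ∑ (mask x f)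
∑-mask {suc m} f zero    = refl
∑-mask {suc m} f (suc x) = begin
  f zero + ∑ (f ∘ suc)
    ≡⟨ cong (f zero +_) (∑-mask (f ∘ suc) x) ⟩
  f zero + (f (suc x) + ∑ (mask x (f ∘ suc)))
    ≡⟨ shuffle (f zero) (f (suc x)) _ ⟩
  f (suc x) + (f zero + ∑ (mask x (f ∘ suc)))
    ≡⟨ cong (λ s → f (suc x) + (f zero + s)) (∑-cong agree) ⟩
  f (suc x) + (f zero + ∑ (mask (suc x) f ∘ suc)) ∎
  where
  open ≡-Reasoning
  shuffle : ∀ a b c → a + (b + c) ≡ b + (a + c)
  shuffle = solve-∀
  agree : ∀ i → mask x (f ∘ suc) i ≡ mask (suc x) f (suc i)
  agree i with x Finₚ.≟ i
  ... | yes refl = refl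
  ... | no  _    = refl

-- Masking the head takes its share out of the total; by uniqueness the tail does not notice the
-- mask.
unique-sum : ∀ {m} (f : Fin m → ℕ) {xs} → Unique xs → sum (map f xs) ≤ ∑ f
unique-sum f {[]}     []      = z≤n
unique-sum f {x ∷ xs} (x∉xs ∷ xs!) = begin
  f x + sum (map f xs)          ≡⟨ cong (λ s → f x + s) (agree xs x∉xs) ⟩
  f x + sum (map (mask x f) xs) ≤⟨ +-monoʳ-≤ (f x) (unique-sum (mask x f) xs!) ⟩
  f x + ∑ (mask x f)            ≡⟨ ∑-mask f x ⟨
  ∑ f ∎
  where
  open ≤-Reasoning
  agree : ∀ xs → All (x ≢_) xs → sum (map f xs) ≡ sum (map (mask x f) xs)
  agree []       []       = refl
  agree (y ∷ ys) (p ∷ ps) = cong₂ _+_ (sym (mask-≢ f p)) (agree ys ps)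

unique-length : ∀ {m} (f : Fin m → ℕ) {xs} → Unique xs → All (λ x → 1 ≤ f x) xs → length xs ≤ ∑ f
unique-length f xs! pos = ≤-trans (go _ pos) (unique-sum f xs!)
  where
  go : ∀ xs → All (λ x → 1 ≤ f x) xs → length xs ≤ sum (map f xs)
  go []       []       = z≤n
  go (x ∷ xs) (p ∷ ps) = +-mono-≤ p (go xs ps)

∣∣-∑ : ∀ {m} (p : Subset m) → ∣ p ∣ ≡ ∑ (λ i → bit (lookup p i))
∣∣-∑ []          = refl
∣∣-∑ (true  ∷ p) = cong suc (∣∣-∑ p)
∣∣-∑ (false ∷ p) = ∣∣-∑ p

-- Independent sets

-- A digraph with out-degrees at most τ has a vertex of in-degree at most τ.
-- Selecting it costs at most 2 τ + 1 vertices.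
module _ {m : ℕ} (τ : ℕ) (out : Fin m → Fin m → Bool) where

  inDegree : (Fin m → Bool) → Fin m → ℕ
  inDegree alive x = ∑ (λ j → bit (alive j ∧ out j x))

  low-in-degree : ∀ alive → (∀ i → alive i ≡ true → ∑ (λ j → bit (out i j)) ≤ τ) →
    1 ≤ ∑ (λ i → bit (alive i)) → ∃ λ x → alive x ≡ true × inDegree alive x ≤ τ
  low-in-degree alive deg nonempty
    with any? (λ x → (alive x ≟ᵇ true) ×-dec (inDegree alive x ≤? τ))
  ... | yes found = found
  ... | no  none  = contradiction counted (<⇒≱ strict)
    where
    A = ∑ (λ i → bit (alive i))
    large : ∀ x → bit (alive x) * suc τ ≤ inDegree alive x
    large x with alive x in eq
    ... | false = z≤n
    ... | true  = subst (_≤ inDegree alive x) (sym (*-identityˡ (suc τ))) (≰⇒> λ le → none (x , eq , le))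
    small : ∀ j → ∑ (λ x → bit (alive j ∧ out j x)) ≤ bit (alive j) * τ
    small j with alive j in eq
    ... | false = ≤-reflexive (∑-zero m)
    ... | true  = subst (∑ (λ x → bit (out j x)) ≤_) (sym (*-identityˡ τ)) (deg j eq)
    -- The arcs that leave alive vertices are counted twice: by heads there are at least
    -- `A * suc τ`, by tails at most `A * τ`.
    counted : A * suc τ ≤ A * τ
    counted = begin
      A * suc τ                                     ≡⟨ ∑-* (λ i → bit (alive i)) (suc τ) ⟨
      ∑ (λ x → bit (alive x) * suc τ)               ≤⟨ ∑-mono large ⟩
      ∑ (inDegree alive)                            ≡⟨ ∑-swap (λ x j → bit (alive j ∧ out j x)) ⟩
      ∑ (λ j → ∑ (λ x → bit (alive j ∧ out j x)))   ≤⟨ ∑-mono small ⟩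
      ∑ (λ j → bit (alive j) * τ)                   ≡⟨ ∑-* (λ i → bit (alive i)) τ ⟩
      A * τ ∎
      where open ≤-Reasoning
    strict : A * τ < A * suc τ
    strict = *-monoʳ-< A {{>-nonZero nonempty}} (n<1+n τ)

  prune : Fin m → (Fin m → Bool) → Fin m → Bool
  prune x alive j = alive j ∧ not (out x j) ∧ not (out j x) ∧ not (does (x Finₚ.≟ j))

  pruned : ∀ x alive {j} → prune x alive j ≡ true →
    alive j ≡ true × out x j ≡ false × out j x ≡ false × x ≢ j
  pruned x alive {j} p with alive j | out x j | out j x | x Finₚ.≟ j
  ... | true | false | false | no x≢j = refl , refl , refl , x≢j

  -- The summands of `τ + (τ + 1)` stand for the out-neighbours of `x`, its alive in-neighbours, and
  -- `x` itself.
  prune-count : ∀ x alive → ∑ (λ j → bit (out x j)) ≤ τ → inDegree alive x ≤ τ →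
    ∑ (λ j → bit (alive j)) ≤ ∑ (λ j → bit (prune x alive j)) + (τ + (τ + 1))
  prune-count x alive x-out x-in = begin
    ∑ (λ j → bit (alive j))
      ≤⟨ ∑-mono lost ⟩
    ∑ (λ j → bit (prune x alive j) + (bit (out x j) + (bit (alive j ∧ out j x) + same j)))
      ≡⟨ ∑-+ (λ j → bit (prune x alive j)) _ ⟩
    A′ + ∑ (λ j → bit (out x j) + (bit (alive j ∧ out j x) + same j))
      ≡⟨ cong (A′ +_) (trans (∑-+ (λ j → bit (out x j)) _)
           (cong (∑ (λ j → bit (out x j)) +_) (∑-+ (λ j → bit (alive j ∧ out j x)) _))) ⟩
    A′ + (∑ (λ j → bit (out x j)) + (inDegree alive x + ∑ same))
      ≤⟨ +-monoʳ-≤ A′ (+-mono-≤ x-out (+-mono-≤ x-in ∑-same)) ⟩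
    A′ + (τ + (τ + 1)) ∎
    where
    open ≤-Reasoning
    A′ = ∑ (λ j → bit (prune x alive j))
    same : Fin m → ℕ
    same j = bit (does (x Finₚ.≟ j))
    lost : ∀ j → bit (alive j) ≤ bit (prune x alive j) + (bit (out x j) + (bit (alive j ∧ out j x) + same j))
    lost j with alive j | out x j | out j x | does (x Finₚ.≟ j)
    ... | false | _     | _     | _     = z≤n
    ... | true  | true  | _     | _     = s≤s z≤n
    ... | true  | false | true  | _     = s≤s z≤n
    ... | true  | false | false | true  = s≤s z≤n
    ... | true  | false | false | false = s≤s z≤n
    vanish : ∀ i → mask x same i ≡ 0
    vanish i with does (x Finₚ.≟ i)
    ... | true  = refl
    ... | false = refl
    ∑-same : ∑ same ≤ 1
    ∑-same = begin
      ∑ same                   ≡⟨ ∑-mask same x ⟩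
      same x + ∑ (mask x same) ≡⟨ cong (same x +_) (trans (∑-cong vanish) (∑-zero m)) ⟩
      same x + 0               ≡⟨ +-identityʳ (same x) ⟩
      same x                   ≤⟨ bit≤1 (does (x Finₚ.≟ x)) ⟩
      1 ∎

  -- Only arcs between different members are excluded, loops are tolerated. This suffices later
  -- because the alternative path of an edge does not contain that edge.
  independent : ∀ W alive → (∀ i → alive i ≡ true → ∑ (λ j → bit (out i j)) ≤ τ) →
    W * suc (2 * τ) ≤ ∑ (λ i → bit (alive i)) →
    ∃ λ xs → length xs ≡ W × Unique xs × All (λ x → alive x ≡ true) xs ×
      (∀ {x y} → x List.∈ xs → y List.∈ xs → out x y ≡ true → x ≡ y)
  independent zero    alive deg enough = [] , refl , [] , [] , λ ()
  independent (suc W) alive deg enough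
    with low-in-degree alive deg (≤-trans (s≤s z≤n) enough)
  ... | x , x-alive , x-in
    with independent W (prune x alive) (λ i p → deg i (proj₁ (pruned x alive p)))
           (+-cancelʳ-≤ (τ + (τ + 1)) _ _ (≤-trans (≤-reflexive (shuffle W τ))
             (≤-trans enough (prune-count x alive (deg x x-alive) x-in))))
    where
    shuffle : ∀ W τ → W * suc (2 * τ) + (τ + (τ + 1)) ≡ suc W * suc (2 * τ)
    shuffle = solve-∀
  ... | xs , len , xs! , live , indep =
    x ∷ xs , cong suc len , All.map (λ p → proj₂ (proj₂ (proj₂ (pruned x alive p)))) live ∷ xs! ,
    x-alive ∷ All.map (λ p → proj₁ (pruned x alive p)) live , indep′
    where
    indep′ : ∀ {y z} → y List.∈ x ∷ xs → z List.∈ x ∷ xs → out y z ≡ true → y ≡ z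
    indep′ (here refl) (here refl) _ = refl
    indep′ (here refl) (there z∈)  p =
      case trans (sym p) (proj₁ (proj₂ (pruned x alive (All.lookup live z∈)))) of λ ()
    indep′ (there y∈)  (here refl) p =
      case trans (sym p) (proj₁ (proj₂ (proj₂ (pruned x alive (All.lookup live y∈))))) of λ ()
    indep′ (there y∈)  (there z∈)  p = indep y∈ z∈ p

-- Paths

module Paths (G : Network) where
  open Network G

  joins-sym : ∀ {e u v} → Joins e u v → Joins e v u
  joins-sym (inj₁ p) = inj₂ p
  joins-sym (inj₂ p) = inj₁ p

  joins? : ∀ e u v → Dec (Joins e u v)
  joins? e u v = ≡-dec Finₚ._≟_ Finₚ._≟_ (ends e) (u , v) ⊎-dec ≡-dec Finₚ._≟_ Finₚ._≟_ (ends e) (v , u)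

  joins-end : ∀ {e a x u y} → Joins e a x → Joins e u y → u ≡ a ⊎ u ≡ x
  joins-end (inj₁ p) (inj₁ q) = inj₁ (proj₁ (,-injective (trans (sym q) p)))
  joins-end (inj₁ p) (inj₂ q) = inj₂ (proj₂ (,-injective (trans (sym q) p)))
  joins-end (inj₂ p) (inj₁ q) = inj₂ (proj₁ (,-injective (trans (sym q) p)))
  joins-end (inj₂ p) (inj₂ q) = inj₁ (proj₂ (,-injective (trans (sym q) p)))

  infixr 5 _⧺_
  _⧺_ : ∀ {u v w} → Path u v → Path v w → Path u w
  stop       ⧺ Q = Q
  step e j P ⧺ Q = step e j (P ⧺ Q)

  edges-⧺ : ∀ {u v w} (P : Path u v) (Q : Path v w) → edges (P ⧺ Q) ≡ edges P ++ edges Q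
  edges-⧺ stop         Q = refl
  edges-⧺ (step e _ P) Q = cong (e ∷_) (edges-⧺ P Q)

  pathLength-⧺ : ∀ {u v w} (P : Path u v) (Q : Path v w) → pathLength (P ⧺ Q) ≡ pathLength P + pathLength Q
  pathLength-⧺ stop         Q = refl
  pathLength-⧺ (step e _ P) Q = trans (cong (ℓ e +_) (pathLength-⧺ P Q)) (sym (+-assoc (ℓ e) (pathLength P) _))

  within-⧺ : ∀ {u v w} {F} (P : Path u v) (Q : Path v w) → P Within F → Q Within F → (P ⧺ Q) Within F
  within-⧺ P Q p q rewrite edges-⧺ P Q = ++⁺ p q

  reverse : ∀ {u v} → Path u v → Path v u
  reverse stop         = stop
  reverse (step e j P) = reverse P ⧺ step e (joins-sym j) stop

  pathLength-reverse : ∀ {u v} (P : Path u v) → pathLength (reverse P) ≡ pathLength P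
  pathLength-reverse stop         = refl
  pathLength-reverse (step e j P) = begin
    pathLength (reverse P ⧺ step e (joins-sym j) stop)
      ≡⟨ pathLength-⧺ (reverse P) _ ⟩
    pathLength (reverse P) + (ℓ e + 0)
      ≡⟨ cong₂ _+_ (pathLength-reverse P) (+-identityʳ (ℓ e)) ⟩
    pathLength P + ℓ e
      ≡⟨ +-comm (pathLength P) (ℓ e) ⟩
    ℓ e + pathLength P ∎
    where open ≡-Reasoning

  within-reverse : ∀ {u v} {F} (P : Path u v) → P Within F → reverse P Within F
  within-reverse stop         []      = []
  within-reverse (step e j P) (p ∷ q) = within-⧺ (reverse P) _ (within-reverse P q) (p ∷ [])

  single : ∀ e → Path (src e) (tgt e)
  single e = step e (inj₁ refl) stop

  orient : ∀ {e u v F} → Joins e u v → (Q : Path (src e) (tgt e)) → Q Within F →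
    Σ (Path u v) λ Q′ → Q′ Within F × pathLength Q′ ≡ pathLength Q
  orient (inj₁ refl) Q q = Q , q , refl
  orient (inj₂ refl) Q q = reverse Q , within-reverse Q q , pathLength-reverse Q

  -- The length equation adds `ℓ e` on the left instead of subtracting it on the right, which keeps
  -- truncated subtraction out.
  replace : ∀ {u v F} (P : Path u v) → P Within F → ∀ {e} → e List.∈ edges P →
    (Q : Path (src e) (tgt e)) → Q Within F →
    Σ (Path u v) λ P′ → P′ Within F × pathLength P′ + ℓ e ≡ pathLength P + pathLength Q
  replace (step e j P) (p ∷ ps) (here refl) Q q with orient j Q q
  ... | Q′ , q′ , eq = Q′ ⧺ P , within-⧺ Q′ P q′ ps , (begin
    pathLength (Q′ ⧺ P) + ℓ e            ≡⟨ cong (_+ ℓ e) (trans (pathLength-⧺ Q′ P) (cong (_+ pathLength P) eq)) ⟩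
    (pathLength Q + pathLength P) + ℓ e  ≡⟨ shuffle (pathLength Q) (pathLength P) (ℓ e) ⟩
    (ℓ e + pathLength P) + pathLength Q  ∎)
    where
    open ≡-Reasoning
    shuffle : ∀ a b c → (a + b) + c ≡ (c + b) + a
    shuffle = solve-∀
  replace (step f j P) (p ∷ ps) {e} (there e∈) Q q with replace P ps e∈ Q q
  ... | P′ , ps′ , eq = step f j P′ , p ∷ ps′ ,
    trans (+-assoc (ℓ f) _ _) (trans (cong (ℓ f +_) eq) (sym (+-assoc (ℓ f) _ _)))

  start∈ : ∀ {u v} (P : Path u v) → u List.∈ vertices P
  start∈ stop         = here refl
  start∈ (step _ _ _) = here refl

  end∈ : ∀ {u v} (P : Path u v) → v List.∈ vertices P
  end∈ stop         = here refl
  end∈ (step _ _ P) = there (end∈ P)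

  endpoint∈ : ∀ {u v e x y} (P : Path u v) → e List.∈ edges P → Joins e x y → x List.∈ vertices P
  endpoint∈ (step f j P) (here refl) j′ with joins-end j j′
  ... | inj₁ refl = here refl
  ... | inj₂ refl = there (start∈ P)
  endpoint∈ (step f j P) (there e∈) j′ = there (endpoint∈ P e∈ j′)

  edges-unique : ∀ {u v} (P : Path u v) → Simple P → Unique (edges P)
  edges-unique stop         _          = []
  edges-unique (step e j P) (u∉ ∷ P!) =
    ¬Any⇒All¬ (edges P) (λ e∈ → All¬⇒¬Any u∉ (endpoint∈ P e∈ j)) ∷ edges-unique P P!

  simple-length : ∀ {u v} (P : Path u v) → Simple P → pathLength P ≤ ∑ ℓ
  simple-length P P! = unique-sum ℓ (edges-unique P P!)

  single-simple : ∀ e → Simple (single e)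
  single-simple e = ((λ eq → loopless e (src e) (inj₁ (cong (src e ,_) (sym eq)))) ∷ []) ∷ ([] ∷ [])

  simple-loop : ∀ {u} (P : Path u u) → Simple P → edges P ≡ []
  simple-loop stop         _        = refl
  simple-loop (step _ _ P) (u∉ ∷ _) = contradiction (end∈ P) (All¬⇒¬Any u∉)

  -- A path that starts with `e` has already reached its end and must stop there; one that starts
  -- otherwise would return to `src e` when it uses `e`.
  simple-single : ∀ {e} (P : Path (src e) (tgt e)) → Simple P → e List.∈ edges P → edges P ≡ e ∷ []
  simple-single {e} P = go P refl refl
    where
    -- The ends become variables so that the path can be matched on; the two equations keep the link
    -- to `e`.
    go : ∀ {u v} (P : Path u v) → src e ≡ u → tgt e ≡ v → Simple P → e List.∈ edges P → edges P ≡ e ∷ []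
    go (step _ (inj₁ eq) P) refl refl (_ ∷ P!) (here refl) with refl ← proj₂ (,-injective eq) =
      cong (e ∷_) (simple-loop P P!)
    go (step _ (inj₂ eq) P) refl refl _ (here refl) =
      contradiction (inj₁ (cong (src e ,_) (proj₂ (,-injective eq)))) (loopless e (src e))
    go (step f j P) refl refl (u∉ ∷ _) (there e∈) =
      contradiction (endpoint∈ P e∈ (inj₁ refl)) (All¬⇒¬Any u∉)

  open DecList (Finₚ._≟_ {n}) using () renaming (_∈?_ to _∈ᵛ?_)

  suffix : ∀ {u v x} (P : Path u v) → Simple P → x List.∈ vertices P →
    Σ (Path x v) λ Q → Simple Q × (∀ {e} → e List.∈ edges Q → e List.∈ edges P) × pathLength Q ≤ pathLength P
  suffix stop           P! (here refl)  = stop , P! , id , ≤-refl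
  suffix P@(step _ _ _) P! (here refl)  = P , P! , id , ≤-refl
  suffix (step e j P) (_ ∷ P!) (there x∈) with suffix P P! x∈
  ... | Q , Q! , sub , le = Q , Q! , there ∘ sub , ≤-trans le (m≤n+m (pathLength P) (ℓ e))

  -- Loop erasure from the back: if the new start already occurs on the simplified rest, only the
  -- suffix from that occurrence survives.
  simplify : ∀ {u v} (P : Path u v) →
    Σ (Path u v) λ Q → Simple Q × (∀ {e} → e List.∈ edges Q → e List.∈ edges P) × pathLength Q ≤ pathLength P
  simplify stop = stop , [] ∷ [] , id , ≤-refl
  simplify (step {u} e j P) with simplify P
  ... | Q , Q! , sub , le with u ∈ᵛ? vertices Q
  ...   | no u∉ = step e j Q , ¬Any⇒All¬ _ u∉ ∷ Q! ,
    (λ { (here eq) → here eq ; (there e∈) → there (sub e∈) }) , +-monoʳ-≤ (ℓ e) le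
  ...   | yes u∈ with suffix Q Q! u∈
  ...     | R , R! , sub′ , le′ = R , R! , there ∘ sub ∘ sub′ ,
    ≤-trans le′ (≤-trans le (m≤n+m (pathLength P) (ℓ e)))

  within-⊆ : ∀ {u v u′ v′ F} {P : Path u v} {Q : Path u′ v′} →
    (∀ {e} → e List.∈ edges Q → e List.∈ edges P) → P Within F → Q Within F
  within-⊆ sub p = All.tabulate (λ e∈ → All.lookup p (sub e∈))

  within-⊤ : ∀ {u v} (P : Path u v) → P Within ⊤
  within-⊤ P = All.tabulate (λ _ → ∈⊤)

-- Distances

  -- Lengths are at least 1, so each step lowers the budget `k`, and `fuel` makes the recursion
  -- structural. Distances exist constructively because of this decision procedure.
  reach : ∀ F u v k fuel → k ≤ fuel → Dec (Σ (Path u v) λ P → P Within F × pathLength P ≤ k)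
  reach F u v k fuel k≤ with u Finₚ.≟ v
  ... | yes refl = yes (stop , [] , z≤n)
  ... | no u≢v with fuel
  reach F u v .0 _ z≤n | no u≢v | zero = no λ where
    (stop , _ , _) → u≢v refl
    (step e j P , _ , le) → <⇒≱ (ℓ-positive e) (m+n≤o⇒m≤o (ℓ e) le)
  reach F u v k _ k≤ | no u≢v | suc fuel = map′ to from
    (any? λ e → any? λ x → joins? e u x ×-dec (e ∈? F) ×-dec hop e x)
    where
    Hop : Fin m → Fin n → Set
    Hop e x = ℓ e ≤ k × Σ (Path x v) λ P → P Within F × pathLength P ≤ k ∸ ℓ e
    hop : ∀ e x → Dec (Hop e x)
    hop e x with ℓ e ≤? k
    ... | no ℓe≰k = no (ℓe≰k ∘ proj₁)
    ... | yes ℓe≤k = map′ (ℓe≤k ,_) proj₂ (reach F x v (k ∸ ℓ e) fuel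
      (≤-trans (∸-monoʳ-≤ k (ℓ-positive e)) (∸-monoˡ-≤ 1 k≤)))
    to : (∃ λ e → ∃ λ x → Joins e u x × e ∈ˢ F × Hop e x) → Σ (Path u v) λ P → P Within F × pathLength P ≤ k
    to (e , x , j , e∈ , ≤k , P , p , le) = step e j P , e∈ ∷ p ,
      ≤-trans (+-monoʳ-≤ (ℓ e) le) (≤-reflexive (m+[n∸m]≡n ≤k))
    from : (Σ (Path u v) λ P → P Within F × pathLength P ≤ k) → ∃ λ e → ∃ λ x → Joins e u x × e ∈ˢ F × Hop e x
    from (stop , _ , _) = contradiction refl u≢v
    from (step {x = x} e j P , e∈ ∷ p , le) = e , x , j , e∈ , m+n≤o⇒m≤o (ℓ e) le , P , p ,
      ≤-trans (≤-reflexive (sym (m+n∸m≡n (ℓ e) (pathLength P)))) (∸-monoˡ-≤ (ℓ e) le)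

  dist-exists : ∀ {F u v} (P : Path u v) → P Within F → ∃ λ d → Dist F u v d × d ≤ pathLength P
  dist-exists {F} {u} {v} P p = go (pathLength P) P p ≤-refl
    where
    go : ∀ k (P : Path u v) → P Within F → pathLength P ≤ k → ∃ λ d → Dist F u v d × d ≤ k
    go zero P p le = 0 , ((P , p , n≤0⇒n≡0 le) , λ _ _ → z≤n) , z≤n
    go (suc k) P p le with reach F u v k k ≤-refl
    ... | yes (Q , q , le′) = let d , h , d≤ = go k Q q le′ in d , h , m≤n⇒m≤1+n d≤
    ... | no none = suc k , ((P , p , ≤-antisym le (≰⇒> λ le′ → none (P , p , le′))) ,
      λ Q q → ≰⇒> λ le′ → none (Q , q , le′)) , ≤-refl

  dist-unique : ∀ {F u v d d′} → Dist F u v d → Dist F u v d′ → d ≡ d′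
  dist-unique ((P , p , refl) , min) ((P′ , p′ , refl) , min′) = ≤-antisym (min P′ p′) (min′ P p)

  -- Otherwise substituting `Q` for `e` would give a path in `F` below the minimum.
  shortest-edge : ∀ {F u v d} (P : Path u v) → P Within F → (∀ (Q : Path u v) → Q Within F → d ≤ pathLength Q) →
    pathLength P ≡ d → ∀ {e} → e List.∈ edges P → (Q : Path (src e) (tgt e)) → Q Within F → ℓ e ≤ pathLength Q
  shortest-edge P p min refl {e} e∈ Q q with replace P p e∈ Q q
  ... | P′ , p′ , eq = +-cancelˡ-≤ (pathLength P) _ _
    (≤-trans (+-monoˡ-≤ (ℓ e) (min P′ p′)) (≤-reflexive eq))

∉⇒false : ∀ {m} {R : Subset m} {e} → e ∈ˢ ∁ R → lookup R e ≡ false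
∉⇒false {R = R} {e} e∈ with lookup R e in eq
... | false = refl
... | true  = contradiction (lookup⇒[]= e R eq) (x∈∁p⇒x∉p e∈)

false⇒∉ : ∀ {m} {R : Subset m} {e} → lookup R e ≡ false → e ∈ˢ ∁ R
false⇒∉ {e = e} eq = x∉p⇒x∈∁p λ e∈ → case trans (sym ([]=⇒lookup e∈)) eq of λ ()

-- Removing edges without changing the size of the graph

-- The edges in R become longer than every simple path of G.
surcharge : (G : Network) → Subset (Network.m G) → Network
surcharge G R = record
  { n = n ; m = m ; ends = ends ; loopless = loopless ; noParallel = noParallel
  ; ℓ = λ e → if lookup R e then suc (∑ ℓ) else ℓ e ; ℓ-positive = positive }
  where
  open Network G
  positive : ∀ e → 1 ≤ (if lookup R e then suc (∑ ℓ) else ℓ e)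
  positive e with lookup R e
  ... | true  = s≤s z≤n
  ... | false = ℓ-positive e

module Surcharge (G : Network) (R : Subset (Network.m G)) where
  open Network G
  open Paths G
  private
    module H = Network (surcharge G R)
    module HP = Paths (surcharge G R)

  lower : ∀ {u v} → H.Path u v → Path u v
  lower H.stop         = stop
  lower (H.step e j P) = step e j (lower P)

  raise : ∀ {u v} → Path u v → H.Path u v
  raise stop         = H.stop
  raise (step e j P) = H.step e j (raise P)

  edges-lower : ∀ {u v} (P : H.Path u v) → edges (lower P) ≡ H.edges P
  edges-lower H.stop         = refl
  edges-lower (H.step e j P) = cong (e ∷_) (edges-lower P)

  edges-raise : ∀ {u v} (P : Path u v) → H.edges (raise P) ≡ edges P
  edges-raise stop         = refl
  edges-raise (step e j P) = cong (e ∷_) (edges-raise P)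

  vertices-raise : ∀ {u v} (P : Path u v) → H.vertices (raise P) ≡ vertices P
  vertices-raise stop             = refl
  vertices-raise (step {u} e j P) = cong (u ∷_) (vertices-raise P)

  length-raise : ∀ {u v} (P : Path u v) → P Within ∁ R → H.pathLength (raise P) ≡ pathLength P
  length-raise stop         []       = refl
  length-raise (step e j P) (e∈ ∷ p) rewrite ∉⇒false e∈ = cong (ℓ e +_) (length-raise P p)

  lower-within : ∀ {u v} (P : H.Path u v) → H.pathLength P ≤ ∑ ℓ →
    lower P Within ∁ R × pathLength (lower P) ≡ H.pathLength P
  lower-within H.stop         le = [] , refl
  lower-within (H.step e j P) le with lookup R e in eq
  ... | true  = contradiction (m+n≤o⇒m≤o (suc (∑ ℓ)) le) 1+n≰n
  ... | false = let p , len = lower-within P (m+n≤o⇒n≤o (ℓ e) le)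
                in false⇒∉ eq ∷ p , cong (ℓ e +_) len

  length-lower : ∀ {u v} (P : H.Path u v) → lower P Within ∁ R → pathLength (lower P) ≡ H.pathLength P
  length-lower H.stop         []       = refl
  length-lower (H.step e j P) (e∈ ∷ p) rewrite ∉⇒false e∈ = cong (ℓ e +_) (length-lower P p)

  -- Applied to an empty `R`. Even then the lengths of the surcharged network agree with those of
  -- `G` only pointwise, so paths have to be translated.
  shortest-dist : (∀ e → e ∈ˢ ∁ R) → ∀ {u v o} → Path u v → ShortestCode (surcharge G R) u v o → Dist ⊤ u v (o ∸ 1)
  shortest-dist all P (inj₁ (none , _)) = contradiction (raise P) none
  shortest-dist all P (inj₂ (k , ((Q , _ , Q≡) , min) , refl)) =
    (lower Q , within-⊤ (lower Q) , trans (length-lower Q (everywhere (lower Q))) Q≡) ,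
    λ S _ → subst (k ≤_) (length-raise S (everywhere S)) (min (raise S) (HP.within-⊤ (raise S)))
    where
    everywhere : ∀ {u v} (P : Path u v) → P Within ∁ R
    everywhere P = All.tabulate (λ {e} _ → all e)

  two⇒shortest : ∀ {u v o₁ o₂} → TwoShortestCode (surcharge G R) u v o₁ o₂ → ShortestCode (surcharge G R) u v o₁
  two⇒shortest (inj₁ (none , o₁≡0 , _)) = inj₁ (none , o₁≡0)
  two⇒shortest (inj₂ (P , P! , min , o₁≡ , _)) = inj₂ (H.pathLength P ,
    ((P , HP.within-⊤ P , refl) ,
     λ Q _ → let Q′ , Q′! , _ , le = HP.simplify Q in ≤-trans (min Q′ Q′!) le) , o₁≡)

  -- The lengths up to ∑ ℓ (encoded by 1, …, suc (∑ ℓ)) are those attained by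
  -- paths that avoid R; the code 0 stands for an infinite length.
  Okay : (a b d o : ℕ) → Set
  Okay a b d o = 1 ≤ o × o ≤ suc (∑ ℓ) × (o ∸ 1) * b ≤ a * d

  module _ {a b d : ℕ} where

    shortest-sound : ∀ {u v o} → ShortestCode (surcharge G R) u v o → Okay a b d o →
      Σ (Path u v) λ P → P Within ∁ R × pathLength P * b ≤ a * d
    shortest-sound (inj₁ (_ , refl)) (() , _)
    shortest-sound (inj₂ (_ , ((P , _ , refl) , _) , refl)) (_ , s≤s le , fits) =
      let p , len = lower-within P le
      in lower P , p , subst (λ k → k * b ≤ a * d) (sym len) fits

    shortest-complete : ∀ {u v o} → ShortestCode (surcharge G R) u v o →
      (P : Path u v) → P Within ∁ R → pathLength P * b ≤ a * d → Okay a b d o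
    shortest-complete (inj₁ (none , _)) P _ _ = contradiction (raise P) none
    shortest-complete (inj₂ (k , (_ , min) , refl)) P p fits with simplify P
    ... | Q , Q! , sub , le =
      s≤s z≤n , s≤s (≤-trans k≤ (simple-length Q Q!)) ,
      ≤-trans (*-monoˡ-≤ b (≤-trans k≤ le)) fits
      where
      k≤ : k ≤ pathLength Q
      k≤ = subst (k ≤_) (length-raise Q (within-⊆ {P = P} {Q} sub p)) (min (raise Q) (HP.within-⊤ (raise Q)))

    open DecList (Finₚ._≟_ {m}) using () renaming (_∈?_ to _∈ᴱ?_)

    avoiding : ∀ {e} (P : H.Path (src e) (tgt e)) → ¬ e List.∈ H.edges P → H.pathLength P ≤ ∑ ℓ →
      H.pathLength P * b ≤ a * d →
      Σ (Path (src e) (tgt e)) λ Q → Q Within ∁ R × ¬ e List.∈ edges Q × pathLength Q * b ≤ a * d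
    avoiding {e} P e∉ le fits =
      let p , len = lower-within P le
      in lower P , p , subst (λ es → ¬ e List.∈ es) (sym (edges-lower P)) e∉ ,
         subst (λ k → k * b ≤ a * d) (sym len) fits

    -- The only simple path through e that joins its ends is e itself, so one
    -- of the two shortest paths is a shortest alternative path.
    second-sound : ∀ {e o₁ o₂} → TwoShortestCode (surcharge G R) (src e) (tgt e) o₁ o₂ → Okay a b d o₂ →
      Σ (Path (src e) (tgt e)) λ P → P Within ∁ R × ¬ e List.∈ edges P × pathLength P * b ≤ a * d
    second-sound (inj₁ (_ , _ , refl)) (() , _)
    second-sound (inj₂ (P , P! , min , refl , inj₁ (_ , refl))) (() , _)
    second-sound {e} (inj₂ (P , P! , min , refl , inj₂ (Q , Q! , Q≢P , _ , refl))) (_ , s≤s le , fits)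
      with e ∈ᴱ? H.edges Q
    ... | no  e∉ = avoiding Q e∉ le fits
    ... | yes e∈ = avoiding P
      (λ e∈P → Q≢P (trans (HP.simple-single Q Q! e∈) (sym (HP.simple-single P P! e∈P))))
      (≤-trans (min Q Q!) le) (≤-trans (*-monoˡ-≤ b (min Q Q!)) fits)

    -- Some simple path other than `P` is short enough: the simplified detour if `P` contains `e`,
    -- and `e` itself if `P` avoids it. The latter case is why `e` has to settle itself and to carry
    -- no surcharge.
    second-complete : ∀ {e o₁ o₂} → TwoShortestCode (surcharge G R) (src e) (tgt e) o₁ o₂ →
      lookup R e ≡ false → ℓ e * b ≤ a * d →
      (P : Path (src e) (tgt e)) → P Within ∁ R → ¬ e List.∈ edges P → pathLength P * b ≤ a * d → Okay a b d o₂
    second-complete (inj₁ (none , _)) _ _ P _ _ _ = contradiction (raise P) none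
    second-complete {e} (inj₂ (P , P! , min , refl , second)) e∉R settles A A∈ e∉A fits with simplify A
    ... | B , B! , sub , le = go second
      where
      B′ = raise B
      B∈ = within-⊆ {P = A} {B} sub A∈
      B′! : H.Simple B′
      B′! = subst Unique (sym (vertices-raise B)) B!
      e∉B′ : ¬ e List.∈ H.edges B′
      e∉B′ e∈ = e∉A (sub (subst (e List.∈_) (edges-raise B) e∈))
      B′-length = length-raise B B∈
      E′-length : H.pathLength (HP.single e) ≡ ℓ e
      E′-length rewrite e∉R = +-identityʳ (ℓ e)
      other : ∀ k → ((Q : H.Path (src e) (tgt e)) → H.Simple Q → H.edges Q ≢ H.edges P → k ≤ H.pathLength Q) →
        Okay a b d (suc k)
      other k min₂ with e ∈ᴱ? H.edges P
      ... | yes e∈ = s≤s z≤n , s≤s (≤-trans k≤ (simple-length B B!)) , ≤-trans (*-monoˡ-≤ b (≤-trans k≤ le)) fits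
        where
        k≤ : k ≤ pathLength B
        k≤ = subst (k ≤_) B′-length (min₂ B′ B′! (λ eq → e∉B′ (subst (e List.∈_) (sym eq) e∈)))
      ... | no e∉ = s≤s z≤n , s≤s (≤-trans k≤ (≤-∑ ℓ e)) , ≤-trans (*-monoˡ-≤ b k≤) settles
        where
        k≤ : k ≤ ℓ e
        k≤ = subst (k ≤_) E′-length (min₂ (HP.single e) (HP.single-simple e)
               (λ eq → e∉ (subst (e List.∈_) eq (here refl))))
      go : ∀ {o₂} → SecondCode (surcharge G R) P o₂ → Okay a b d o₂
      go (inj₂ (Q , Q! , Q≢P , min₂ , refl)) = other _ min₂
      go (inj₁ (only , _)) = contradiction
        (subst (e List.∈_) (trans (only (HP.single e) (HP.single-simple e)) (sym (only B′ B′!))) (here refl)) e∉B′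

-- Stretch in terms of natural numbers

toℚ-mkℚ : ∀ k → toℚ k ≡ mkℚ (ℤ.+ k) 0 (Coprime.sym (Coprime.1-coprimeTo k))
toℚ-mkℚ k = ℚ.↥p/↧p≡p (mkℚ (ℤ.+ k) 0 (Coprime.sym (Coprime.1-coprimeTo k)))

1≤α⇒positive : ∀ α → 1ℚ ℚ.≤ α → ↥ α ≡ ℤ.+ ℤ.∣ ↥ α ∣
1≤α⇒positive (mkℚ (ℤ.+ _)    _ _) _ = refl
1≤α⇒positive (mkℚ ℤ.-[1+ _ ] _ _) (ℚ.*≤* ())

1≤α⇒q≤p : ∀ α → 1ℚ ℚ.≤ α → ↧ₙ α ≤ ℤ.∣ ↥ α ∣
1≤α⇒q≤p (mkℚ (ℤ.+ a)    b-1 _) (ℚ.*≤* le) = subst₂ _≤_ (+-identityʳ (suc b-1)) (*-identityʳ a)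
  (ℤ.drop‿+≤+ (subst₂ ℤ._≤_ refl (sym (ℤ.pos-* a 1)) le))
1≤α⇒q≤p (mkℚ ℤ.-[1+ _ ] _   _) (ℚ.*≤* ())

module _ (α : ℚ) (1≤α : 1ℚ ℚ.≤ α) where

  private
    p = ℤ.∣ ↥ α ∣
    q = ↧ₙ α

    numerator : ↥ α ≡ ℤ.+ p
    numerator = 1≤α⇒positive α 1≤α

  private
    -- Stated for unnormalised rationals, where the product keeps the denominator of `α` and no
    -- common factor is cancelled.
    product : ∀ d → toℚᵘ (α ℚ.* toℚ d) ℚᵘ.≃ mkℚᵘ (ℤ.+ (p * d)) (ℚ.denominator-1 α)
    product d rewrite toℚ-mkℚ d = ℚᵘ.≃-trans (ℚ.toℚᵘ-homo-* α (mkℚ (ℤ.+ d) 0 _)) (scaled α numerator)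
      where
      scaled : ∀ β → ↥ β ≡ ℤ.+ ℤ.∣ ↥ β ∣ →
        toℚᵘ β ℚᵘ.* mkℚᵘ (ℤ.+ d) 0 ℚᵘ.≃ mkℚᵘ (ℤ.+ (ℤ.∣ ↥ β ∣ * d)) (ℚ.denominator-1 β)
      scaled β@(mkℚ _ _ _) eq = ℚᵘ.*≡* (cong₂ ℤ._*_
        (trans (cong (ℤ._* ℤ.+ d) eq) (sym (ℤ.pos-* ℤ.∣ ↥ β ∣ d)))
        (cong ℤ.+_ (sym (*-identityʳ (↧ₙ β)))))

    integer : ∀ k → toℚᵘ (toℚ k) ≡ mkℚᵘ (ℤ.+ k) 0
    integer k rewrite toℚ-mkℚ k = refl

  stretch⇒ : ∀ k d → toℚ k ℚ.≤ α ℚ.* toℚ d → k * q ≤ p * d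
  stretch⇒ k d le with ℚᵘ.≤-respʳ-≃ (product d) (subst (ℚᵘ._≤ _) (integer k) (ℚ.toℚᵘ-mono-≤ le))
  ... | ℚᵘ.*≤* le′ = subst (k * q ≤_) (*-identityʳ (p * d))
    (ℤ.drop‿+≤+ (subst₂ ℤ._≤_ (sym (ℤ.pos-* k q)) (sym (ℤ.pos-* (p * d) 1)) le′))

  stretch⇐ : ∀ k d → k * q ≤ p * d → toℚ k ℚ.≤ α ℚ.* toℚ d
  stretch⇐ k d le = ℚ.toℚᵘ-cancel-≤ (subst (ℚᵘ._≤ _) (sym (integer k))
    (ℚᵘ.≤-respʳ-≃ (ℚᵘ.≃-sym (product d)) (ℚᵘ.*≤*
      (subst₂ ℤ._≤_ (ℤ.pos-* k q) (ℤ.pos-* (p * d) 1) (ℤ.+≤+ (subst (k * q ≤_) (sym (*-identityʳ (p * d))) le))))))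

-- Spanners

module Spanners (I : Instance) where
  open Instance I public
  open Paths G public

  p q : ℕ
  p = ℤ.∣ ↥ α ∣
  q = ↧ₙ α

  removedWeight : Subset m → ℕ
  removedWeight R = ∑ (λ e → if lookup R e then w e else 0)

  weight-∁∁ : ∀ R → weight (∁ (∁ R)) ≡ removedWeight R
  weight-∁∁ R = trans (sum-allFin (λ e → if lookup (∁ (∁ R)) e then w e else 0)) (∑-cong λ e → cong (λ b → if b then w e else 0)
    (trans (lookup-map e not (∁ R)) (trans (cong not (lookup-map e not R)) (not-involutive (lookup R e)))))

  weight-∁ : ∀ F → weight (∁ F) ≡ removedWeight (∁ F)
  weight-∁ F = sum-allFin (λ e → if lookup (∁ F) e then w e else 0)

  removedWeight-mono : ∀ {R S} → (∀ e → lookup R e ≡ true → w e ≡ 0 ⊎ lookup S e ≡ true) →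
    removedWeight R ≤ removedWeight S
  removedWeight-mono {R} {S} h = ∑-mono go
    where
    go : ∀ e → (if lookup R e then w e else 0) ≤ (if lookup S e then w e else 0)
    go e with lookup R e in eq
    ... | false = z≤n
    ... | true with h e eq
    ...   | inj₁ w≡0 = ≤-trans (≤-reflexive w≡0) z≤n
    ...   | inj₂ S∋e rewrite S∋e = ≤-refl

  module Distances (d : Fin m → ℕ) (d-dist : ∀ e → Dist ⊤ (src e) (tgt e) (d e)) where

    Settles : Fin m → Set
    Settles e = ℓ e * q ≤ p * d e

    Good : Subset m → Fin m → Set
    Good X e = Σ (TerminalPath e) λ P → P Within X × pathLength P * q ≤ p * d e

    within⇒ : ∀ e k → WithinStretch (src e) (tgt e) k → k * q ≤ p * d e
    within⇒ e k (d′ , dist′ , le) =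
      stretch⇒ α 1≤α k (d e) (subst (λ x → toℚ k ℚ.≤ α ℚ.* toℚ x) (dist-unique dist′ (d-dist e)) le)

    within⇐ : ∀ e k → k * q ≤ p * d e → WithinStretch (src e) (tgt e) k
    within⇐ e k le = d e , d-dist e , stretch⇐ α 1≤α k (d e) le

    good-edge : ∀ {X e} → e ∈ˢ X → Settles e → Good X e
    good-edge {e = e} e∈ s = single e , e∈ ∷ [] , subst (λ k → k * q ≤ p * d e) (sym (+-identityʳ (ℓ e))) s

    -- Each edge of a shortest path of `G` has length `d e`, so it settles itself because `α` is at
    -- least 1, and its substitute in `X` is at most `α` times as long. Concatenating the
    -- substitutes keeps the stretch, and edges that do not settle themselves never occur.
    spanner⇐ : ∀ {X} → (∀ e → Settles e → Good X e) → IsSpanner X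
    spanner⇐ {X} good u v d′ ((P , P∈ , refl) , min) =
      let Q , Q∈ , le = build P (λ e∈ → shortest-edge P P∈ min refl e∈)
          k , k-dist , k≤ = dist-exists Q Q∈
      in k , k-dist , stretch⇐ α 1≤α k d′ (≤-trans (*-monoˡ-≤ q k≤) le)
      where
      build : ∀ {u v} (P : Path u v) →
        (∀ {e} → e List.∈ edges P → (Q : Path (src e) (tgt e)) → Q Within ⊤ → ℓ e ≤ pathLength Q) →
        Σ (Path u v) λ Q → Q Within X × pathLength Q * q ≤ p * pathLength P
      build stop         h = stop , [] , z≤n
      build (step e j P) h =
        let E , E∈ , E≤ = good e (≤-trans (*-monoˡ-≤ q ℓ≤d) (≤-trans (≤-reflexive (*-comm (d e) q)) (*-monoˡ-≤ (d e) (1≤α⇒q≤p α 1≤α))))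
            E′ , E′∈ , E′≡ = orient j E E∈
            Q , Q∈ , Q≤ = build P (h ∘ there)
        in E′ ⧺ Q , within-⧺ E′ Q E′∈ Q∈ , (begin
          pathLength (E′ ⧺ Q) * q
            ≡⟨ cong (_* q) (trans (pathLength-⧺ E′ Q) (cong (_+ pathLength Q) E′≡)) ⟩
          (pathLength E + pathLength Q) * q
            ≡⟨ *-distribʳ-+ q (pathLength E) (pathLength Q) ⟩
          pathLength E * q + pathLength Q * q
            ≤⟨ +-mono-≤ (≤-trans E≤ (*-monoʳ-≤ p d≤ℓ)) Q≤ ⟩
          p * ℓ e + p * pathLength P
            ≡⟨ *-distribˡ-+ p (ℓ e) (pathLength P) ⟨
          p * (ℓ e + pathLength P) ∎)
        where
        open ≤-Reasoning
        ℓ≤d : ℓ e ≤ d e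
        ℓ≤d = let (S , S∈ , S≡) , _ = d-dist e in subst (ℓ e ≤_) S≡ (h (here refl) S S∈)
        d≤ℓ : d e ≤ ℓ e
        d≤ℓ = subst (d e ≤_) (+-identityʳ (ℓ e)) (proj₂ (d-dist e) (single e) (within-⊤ (single e)))

    spanner⇒ : ∀ {X} → IsSpanner X → ∀ e → Good X e
    spanner⇒ sp e with sp (src e) (tgt e) (d e) (d-dist e)
    ... | k , ((P , P∈ , refl) , _) , le = P , P∈ , stretch⇒ α 1≤α k (d e) le

    -- An edge that does not settle itself is longer than some detour in the
    -- spanner, so it lies on no shortest path of the spanner.
    spanner-settling : ∀ {F} → IsSpanner F → ∀ e →
      Σ (TerminalPath e) λ P → P Within F × All Settles (edges P) × pathLength P * q ≤ p * d e
    spanner-settling sp e with sp (src e) (tgt e) (d e) (d-dist e)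
    ... | k , ((P , P∈ , refl) , min) , le = P , P∈ , All.tabulate settles , stretch⇒ α 1≤α k (d e) le
      where
      settles : ∀ {f} → f List.∈ edges P → Settles f
      settles {f} f∈ = let Q , Q∈ , Q≤ = spanner⇒ sp f
                       in ≤-trans (*-monoˡ-≤ q (shortest-edge P P∈ min refl f∈ Q Q∈)) Q≤

    Detour : Fin m → Set
    Detour e = Σ (TerminalPath e) λ P → All Settles (edges P) × ¬ e List.∈ edges P × pathLength P * q ≤ p * d e

    -- D: the edges that do not settle themselves; TN: these and the nontrivial edges.
    record Classes : Set where
      field
        D TN : Subset m
        D⇒   : ∀ {e} → lookup D e ≡ true → ¬ Settles e
        D⇐   : ∀ {e} → lookup D e ≡ false → Settles e
        D⊆TN : ∀ {e} → lookup D e ≡ true → lookup TN e ≡ true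
        N⇒   : ∀ {e} → lookup TN e ≡ true → lookup D e ≡ false → 1 ≤ w e × Detour e
        N⇐   : ∀ {e} → lookup TN e ≡ false → 1 ≤ w e → ¬ Detour e

    module Classified (C : Classes) where
      open Classes C

      settles⇒ : ∀ {e} → Settles e → lookup D e ≡ false
      settles⇒ {e} s with lookup D e in eq
      ... | false = refl
      ... | true  = contradiction s (D⇒ eq)

      IsN : Fin m → Set
      IsN e = lookup TN e ≡ true × lookup D e ≡ false

      -- The spanner joins the ends of `e` by a settling path without `e`. So `e` is not mandatory,
      -- and only weight 0 can keep it out of `TN`.
      kept-weightless : ∀ {F} → IsSpanner F → ∀ {e} → lookup TN e ≡ false → lookup F e ≡ false → w e ≡ 0
      kept-weightless {F} sp {e} e∉TN e∉F with w e in eq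
      ... | zero  = refl
      ... | suc _ = let P , P∈ , settles , le = spanner-settling sp e in contradiction
        (P , settles , (λ e∈ → case trans (sym ([]=⇒lookup (All.lookup P∈ e∈))) e∉F of λ ()) , le)
        (N⇐ e∉TN (≤-trans (s≤s z≤n) (≤-reflexive (sym eq))))

      uncritical-solution : (∀ e → Settles e → Good (∁ TN) e) → W̄ ≤ removedWeight TN → IsSolution (∁ TN)
      uncritical-solution good W≤ = spanner⇐ good , subst (W̄ ≤_) (sym (weight-∁∁ TN)) W≤

      -- Outside `TN` a spanner drops edges of weight 0 only, hence no spanner removes more weight
      -- than `TN` has.
      light-no-solution : ¬ W̄ ≤ removedWeight TN → ¬ ∃ IsSolution
      light-no-solution W≰ (F , sp , W≤) = W≰ (≤-trans W≤ (≤-trans (≤-reflexive (weight-∁ F))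
        (removedWeight-mono {∁ F} {TN} heavy)))
        where
        heavy : ∀ e → lookup (∁ F) e ≡ true → w e ≡ 0 ⊎ lookup TN e ≡ true
        heavy e e∈∁F with lookup TN e in eq
        ... | true  = inj₂ refl
        ... | false = inj₁ (kept-weightless {F} sp eq e∉F)
          where
          e∉F : lookup F e ≡ false
          e∉F with lookup F e | trans (sym (lookup-map e not F)) e∈∁F
          ... | false | _ = refl

      -- The recursion follows the marking loop of the program: `hit i x` describes the marks after
      -- `i` iterations.
      hit : ℕ → (ℕ → ℕ) → ℕ → Bool
      hit zero    x j = false
      hit (suc i) x j = (x i ≡ᵇ j) ∨ hit i x j

      hit⇐ : ∀ k x {i j} → i < k → x i ≡ j → hit k x j ≡ true
      hit⇐ (suc k) x {i} i<k refl with m≤n⇒m<n∨m≡n (s≤s⁻¹ i<k)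
      ... | inj₁ i<k′ rewrite hit⇐ k x i<k′ refl = ∨-zeroʳ (x k ≡ᵇ x i)
      ... | inj₂ refl rewrite ≡ᵇ-refl (x k) = refl

      hit⇒ : ∀ k x {j} → hit k x j ≡ true → ∃ λ i → i < k × x i ≡ j
      hit⇒ (suc k) x {j} h with x k ≡ᵇ j in eq
      ... | true  = k , ≤-refl , ≡ᵇ-true eq
      ... | false = let i , i<k , xi = hit⇒ k x h in i , m≤n⇒m≤1+n i<k , xi

      removed : (ℕ → ℕ) → Subset m
      removed x = Vec.tabulate (λ e → lookup D e ∨ hit W̄ x (toℕ e))

      lookup-removed : ∀ x e → lookup (removed x) e ≡ lookup D e ∨ hit W̄ x (toℕ e)
      lookup-removed x e = lookup∘tabulate _ e

      -- Paths are demanded for the edges of the tuple only: every other edge that settles itself is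
      -- still present and serves as its own path. This keeps the number of queries per trial at
      -- `W̄`.
      Valid : (ℕ → ℕ) → Set
      Valid x = W̄ ≤ removedWeight (removed x) ×
                (∀ i e → i < W̄ → x i ≡ toℕ e → Good (∁ (removed x)) e)

      valid⇒solution : ∀ {x} → Valid x → IsSolution (∁ (removed x))
      valid⇒solution {x} (W≤ , good) = spanner⇐ go , subst (W̄ ≤_) (sym (weight-∁∁ (removed x))) W≤
        where
        go : ∀ e → Settles e → Good (∁ (removed x)) e
        go e s with hit W̄ x (toℕ e) in eq
        ... | true  = let i , i<W , xi = hit⇒ W̄ x eq in good i e i<W xi
        ... | false = good-edge (false⇒∉ (trans (lookup-removed x e) (cong₂ _∨_ (settles⇒ s) eq))) s

      -- nt lists the nontrivial edges at positions pos; position 0 stands for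
      -- no edge at all.
      module Tuples (nt : ℕ → ℕ) (pos : Fin m → ℕ) (nt-0 : nt 0 ≡ m)
        (nt-pos : ∀ {e} → IsN e → nt (pos e) ≡ toℕ e) where

        -- Past the end of the list `nth` yields 0, the position of the blank, so short lists are
        -- padded to `W̄` entries.
        tuple : List (Fin m) → ℕ → ℕ
        tuple xs = nth (map pos xs)

        tuple-bound : ∀ {K} xs → All (λ e → pos e ≤ K) xs → ∀ i → tuple xs i ≤ K
        tuple-bound []       []       i       = z≤n
        tuple-bound (x ∷ xs) (p ∷ ps) zero    = p
        tuple-bound (x ∷ xs) (p ∷ ps) (suc i) = tuple-bound xs ps i

        tuple⇐ : ∀ {xs e} → All IsN xs → e List.∈ xs → ∃ λ i → i < length xs × nt (tuple xs i) ≡ toℕ e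
        tuple⇐ (p ∷ ps) (here refl) = 0 , s≤s z≤n , nt-pos p
        tuple⇐ (p ∷ ps) (there e∈)  = let i , i< , eq = tuple⇐ ps e∈ in suc i , s≤s i< , eq

        tuple⇒ : ∀ {xs e} → All IsN xs → ∀ i → nt (tuple xs i) ≡ toℕ e → e List.∈ xs
        tuple⇒ {e = e} [] i eq = contradiction (trans (sym eq) nt-0) (<⇒≢ (Finₚ.toℕ<n e))
        tuple⇒ (p ∷ ps) zero    eq = here (sym (toℕ-injective (trans (sym (nt-pos p)) eq)))
        tuple⇒ (p ∷ ps) (suc i) eq = there (tuple⇒ ps i eq)

        -- The weight condition ranges over all `S` that contain `xs` and `D`, so that it can be met
        -- without knowing how the tuple is decoded: by counting edges, or by comparison with a
        -- given solution.
        tuple-valid : ∀ xs → length xs ≤ W̄ → All IsN xs →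
          (∀ {e} → e List.∈ xs → Σ (TerminalPath e) λ P → All Settles (edges P) ×
             (∀ {f} → f List.∈ edges P → ¬ f List.∈ xs) × pathLength P * q ≤ p * d e) →
          (∀ S → (∀ {e} → e List.∈ xs → lookup S e ≡ true) → (∀ {e} → lookup D e ≡ true → lookup S e ≡ true) →
             W̄ ≤ removedWeight S) →
          Valid (nt ∘ tuple xs)
        tuple-valid xs len≤ ns detour heavy = heavy (removed x) xs⊆ D⊆ , good
          where
          x = nt ∘ tuple xs
          xs⊆ : ∀ {e} → e List.∈ xs → lookup (removed x) e ≡ true
          xs⊆ {e} e∈ = let i , i< , eq = tuple⇐ ns e∈ in
            trans (lookup-removed x e) (trans (cong (lookup D e ∨_) (hit⇐ W̄ x (≤-trans i< len≤) eq)) (∨-zeroʳ _))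
          D⊆ : ∀ {e} → lookup D e ≡ true → lookup (removed x) e ≡ true
          D⊆ {e} e∈ = trans (lookup-removed x e) (cong (_∨ hit W̄ x (toℕ e)) e∈)
          good : ∀ i e → i < W̄ → x i ≡ toℕ e → Good (∁ (removed x)) e
          good i e _ xi with detour (tuple⇒ ns i xi)
          ... | P , settles , avoids , le = P , All.tabulate inside , le
            where
            inside : ∀ {f} → f List.∈ edges P → f ∈ˢ ∁ (removed x)
            inside {f} f∈ with hit W̄ x (toℕ f) in eq
            ... | true  = let i , _ , xi = hit⇒ W̄ x eq in contradiction (tuple⇒ ns i xi) (avoids f∈)
            ... | false = false⇒∉ (trans (lookup-removed x f) (cong₂ _∨_ (settles⇒ (All.lookup settles f∈)) eq))

        heavy-list : ∀ {xs} → Unique xs → All IsN xs → length xs ≡ W̄ → ∀ S →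
          (∀ {e} → e List.∈ xs → lookup S e ≡ true) → W̄ ≤ removedWeight S
        heavy-list {xs} xs! ns len S sub = subst (_≤ removedWeight S) len
          (unique-length _ xs! (All.tabulate λ {e} e∈ →
            subst (λ b → 1 ≤ (if b then w e else 0)) (sym (sub e∈))
              (let t , f = All.lookup ns e∈ in proj₁ (N⇒ t f))))

        -- One spanner supplies all detours at once: its paths stay in `F` and thus avoid every
        -- dropped edge. So any selection of dropped edges that is heavy enough will do.
        removable-tuple : ∀ {F K} → IsSpanner F → ∀ xs → All (λ e → IsN e × lookup F e ≡ false) xs →
          (∀ {e} → IsN e → pos e ≤ K) → length xs ≤ W̄ →
          (∀ S → (∀ {e} → e List.∈ xs → lookup S e ≡ true) → (∀ {e} → lookup D e ≡ true → lookup S e ≡ true) →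
             W̄ ≤ removedWeight S) →
          ∃ λ c → (∀ i → c i ≤ K) × Valid (nt ∘ c)
        removable-tuple sp xs outside pos≤ short heavy =
          tuple xs , tuple-bound xs (All.map (pos≤ ∘ proj₁) outside) ,
          tuple-valid xs short (All.map proj₁ outside) (λ {e} _ → detour e) heavy
          where
          detour : ∀ e → Σ (TerminalPath e) λ P → All Settles (edges P) ×
            (∀ {f} → f List.∈ edges P → ¬ f List.∈ xs) × pathLength P * q ≤ p * d e
          detour e = let P , P∈ , settles , le = spanner-settling sp e in P , settles ,
            (λ f∈ f∈xs → case trans (sym ([]=⇒lookup (All.lookup P∈ f∈))) (proj₂ (All.lookup outside f∈xs)) of λ ()) , le

        Removed? : ∀ F e → Dec (IsN e × lookup F e ≡ false)
        Removed? F e = ((lookup TN e ≟ᵇ true) ×-dec (lookup D e ≟ᵇ false)) ×-dec (lookup F e ≟ᵇ false)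

        -- Nontrivial edges have positive weight, so W̄ of them suffice.
        solution⇒tuple : ∀ {F K} → IsSolution F → (∀ {e} → IsN e → pos e ≤ K) →
          ∃ λ c → (∀ i → c i ≤ K) × Valid (nt ∘ c)
        solution⇒tuple {F} {K} (sp , W≤) pos≤ = go (length ys ≤? W̄)
          where
          ys = filter (Removed? F) (allFin m)
          ys-removed = all-filter (Removed? F) (allFin m)
          -- Together with `D`, the list `ys` carries all the weight that `F` drops, since the rest
          -- has weight 0. Needed if `ys` is short; for a long `ys`, counting `W̄` of its edges is
          -- enough.
          heavy : ∀ S → (∀ {e} → e List.∈ ys → lookup S e ≡ true) → (∀ {e} → lookup D e ≡ true → lookup S e ≡ true) →
            W̄ ≤ removedWeight S
          heavy S ys⊆ D⊆ = ≤-trans W≤ (≤-trans (≤-reflexive (weight-∁ F)) (removedWeight-mono {∁ F} {S} contained))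
            where
            contained : ∀ e → lookup (∁ F) e ≡ true → w e ≡ 0 ⊎ lookup S e ≡ true
            contained e e∈ with lookup F e in F∌e | trans (sym (lookup-map e not F)) e∈
            ... | false | _ with lookup TN e in TN∋e
            ...   | false = inj₁ (kept-weightless {F} sp TN∋e F∌e)
            ...   | true with lookup D e in D∋e
            ...     | true  = inj₂ (D⊆ D∋e)
            ...     | false = inj₂ (ys⊆ (∈-filter⁺ (Removed? F) (∈-allFin e) ((TN∋e , D∋e) , F∌e)))
          go : Dec (length ys ≤ W̄) → ∃ λ c → (∀ i → c i ≤ K) × Valid (nt ∘ c)
          go (yes short) = removable-tuple sp ys ys-removed pos≤ short heavy
          go (no  long)  = removable-tuple sp (take W̄ ys) xs-removed pos≤ (≤-reflexive len)
            (λ S xs⊆ _ → heavy-list (Unique.take⁺ W̄ (Unique.filter⁺ (Removed? F) (Unique.allFin⁺ m)))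
                           (All.map proj₁ xs-removed) len S xs⊆)
            where
            len = trans (length-take W̄ ys) (m≤n⇒m⊓n≡m (<⇒≤ (≰⇒> long)))
            xs-removed = take⁺ W̄ ys-removed

-- The number of tuples that fail, in terms of the tightness

-- Finiteness lets the double negation pass the quantifier, so that one alternative path per edge
-- can be fixed simultaneously although none is computed.
¬¬-∀Fin : ∀ {m} {P : Fin m → Set} → (∀ i → ¬ ¬ P i) → ¬ ¬ (∀ i → P i)
¬¬-∀Fin {zero}  h k = k λ ()
¬¬-∀Fin {suc m} h k = h zero λ p₀ → ¬¬-∀Fin (h ∘ suc) λ p → k λ { zero → p₀ ; (suc i) → p i }

¬¬-All : ∀ {A : Set} {P : A → Set} xs → (∀ {x} → x List.∈ xs → ¬ ¬ P x) → ¬ ¬ All P xs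
¬¬-All []       h k = k []
¬¬-All (x ∷ xs) h k = h (here refl) λ p → ¬¬-All xs (h ∘ there) λ ps → k (p ∷ ps)

-- If no minimiser existed, every value could be undercut, against well-foundedness. This supplies
-- tightest alternative paths.
¬¬-minimum : ∀ {A : Set} (f : A → ℕ) → A → ¬ ¬ (∃ λ x → ∀ y → f x ≤ f y)
¬¬-minimum {A} f a k = <-rec (λ i → ∀ x → f x ≡ i → ⊥)
  (λ i rec x eq → k (x , λ y → ≮⇒≥ λ lt → rec (subst (f y <_) eq lt) y refl)) (f a) a refl

∈-⋃ : ∀ {m e} (es : List (Fin m)) → e List.∈ es → e ∈ˢ ⋃ (map ⁅_⁆ es)
∈-⋃ {e = e} (f ∷ es) (here refl) = p⊆p∪q (⋃ (map ⁅_⁆ es)) (x∈⁅x⁆ e)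
∈-⋃ (f ∷ es) (there e∈)  = q⊆p∪q ⁅ f ⁆ (⋃ (map ⁅_⁆ es)) (∈-⋃ es e∈)

∧-not⇒ : ∀ a b → a ∧ not b ≡ true → a ≡ true × b ≡ false
∧-not⇒ true false _ = refl , refl

∧⇒ : ∀ a b → a ∧ b ≡ true → a ≡ true × b ≡ true
∧⇒ true true _ = refl , refl

bit-∧-≤ : ∀ {A : Set} (a? : Dec A) b c → (A → b ≡ true → c ≡ true) → bit (does a? ∧ b) ≤ bit c
bit-∧-≤ (no _)  _     _ h = z≤n
bit-∧-≤ (yes _) false _ h = z≤n
bit-∧-≤ (yes a) true  c h rewrite h a refl = ≤-refl

module Tightness (I : Instance) (d : Fin (Instance.m I) → ℕ)
  (d-dist : ∀ e → Instance.Dist I ⊤ (Instance.src I e) (Instance.tgt I e) (d e))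
  (C : Spanners.Distances.Classes I d d-dist) where

  open Spanners I
  open Distances d d-dist
  open Classified C
  open Classes C
  open DecList (Finₚ._≟_ {m}) using () renaming (_∈?_ to _∈ᴱ?_)

  detour⇒settling : ∀ {e} → Detour e → Σ (TerminalPath e) λ P → Settling e P × Alternative e P
  detour⇒settling {e} (P , settles , e∉ , le) with simplify P
  ... | Q , Q! , sub , Q≤ = Q , (Q! , All.tabulate (λ {f} f∈ → within⇐ f (ℓ f) (All.lookup settles (sub f∈))) ,
    within⇐ e (pathLength Q) (≤-trans (*-monoˡ-≤ q Q≤) le)) , e∉ ∘ sub

  settling⇒detour : ∀ {e} P → Settling e P → Alternative e P → Detour e
  settling⇒detour {e} P (_ , settles , le) e∉ =
    P , All.map (λ {f} → within⇒ f (ℓ f)) settles , e∉ , within⇒ e (pathLength P) le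

  N⇒nontrivial : ∀ {e} → IsN e → Nontrivial e
  N⇒nontrivial {e} (t , f) = within⇐ e (ℓ e) (D⇐ f) , λ where
    (_ , inj₁ (_ , mandatory)) →
      let P , settling , alt = detour⇒settling (proj₂ (N⇒ t f)) in mandatory P settling alt
    (_ , inj₂ w≡0) → 1+n≰n (subst (1 ≤_) w≡0 (proj₁ (N⇒ t f)))

  trivial⇒kept : ∀ {e} → Trivial e → lookup TN e ≡ false
  trivial⇒kept {e} triv = ¬-not λ eq →
    proj₂ (N⇒nontrivial (eq , settles⇒ (within⇒ e (ℓ e) (proj₁ triv)))) triv

  -- A settling path of trivial edges would survive the removal of `TN`.
  bad⇒critical : ∀ {e} → Settles e → ¬ Good (∁ TN) e → Critical e
  bad⇒critical {e} s bad = within⇐ e (ℓ e) s , λ P (_ , _ , le) trivial →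
    bad (P , All.map (λ t → false⇒∉ (trivial⇒kept t)) trivial , within⇒ e (pathLength P) le)

  crossings : ∀ {e} → TerminalPath e → Subset m → ℕ
  crossings P N = ∣ edgeSet P ∩ N ∣

  ∈⇒crossing : ∀ {e f N} (P : TerminalPath e) → f List.∈ edges P → f ∈ˢ N → lookup (edgeSet P ∩ N) f ≡ true
  ∈⇒crossing P f∈ f∈N = []=⇒lookup (x∈p∩q⁺ (∈-⋃ (edges P) f∈ , f∈N))

  no-crossings⇒trivial : ∀ {e N} → (∀ f → Nontrivial f → f ∈ˢ N) → (P : TerminalPath e) → Settling e P →
    crossings P N ≡ 0 → ¬ ¬ All Trivial (edges P)
  no-crossings⇒trivial {N = N} nontrivial P (_ , settles , _) none = ¬¬-All (edges P) λ {f} f∈ ¬trivial →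
    let N∋f = nontrivial f (All.lookup settles f∈ , ¬trivial)
    in 1+n≰n (≤-trans (≤-trans (≤-reflexive (cong bit (sym (∈⇒crossing P f∈ N∋f))))
         (≤-∑ (λ i → bit (lookup (edgeSet P ∩ N) i)) f))
         (≤-reflexive (trans (sym (∣∣-∑ (edgeSet P ∩ N))) none)))

  -- A failing edge is critical, so `τ` = 0 would be attained by some critical pair whose tightest
  -- alternative path meets no nontrivial edge, against the definition of critical. The time bound
  -- for the search needs this.
  tightness-positive : ∀ {τ e} → IsTightness τ → Settles e → ¬ Good (∁ TN) e → 1 ≤ τ
  tightness-positive {suc τ} _ _ _ = s≤s z≤n
  tightness-positive {zero} (N , N⇔ , _ , inj₂ (none , _)) s bad = contradiction (bad⇒critical s bad) (none _)
  tightness-positive {zero} (N , N⇔ , _ , inj₁ (f , P , (_ , crit) , (settling , _) , none)) s bad =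
    contradiction (crit P settling) (no-crossings⇒trivial (λ f → Equivalence.from (N⇔ f)) P settling none)

  isN : Fin m → Bool
  isN e = lookup TN e ∧ not (lookup D e)

  isN⇒ : ∀ {e} → isN e ≡ true → IsN e
  isN⇒ {e} = ∧-not⇒ (lookup TN e) (lookup D e)

  conflicts : ∀ {e} → TerminalPath e → Fin m → Bool
  conflicts P f = does (f ∈ᴱ? edges P) ∧ isN f

  TightDetour : ℕ → Fin m → Set
  TightDetour τ e = Σ (TerminalPath e) λ P → All Settles (edges P) × ¬ e List.∈ edges P ×
    pathLength P * q ≤ p * d e × ∑ (λ f → bit (conflicts P f)) ≤ τ

  conflicts≤crossings : ∀ {e N} → (∀ f → Nontrivial f → f ∈ˢ N) → (P : TerminalPath e) →
    ∑ (λ f → bit (conflicts P f)) ≤ crossings P N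
  conflicts≤crossings {N = N} nontrivial P = ≤-trans (∑-mono le) (≤-reflexive (sym (∣∣-∑ (edgeSet P ∩ N))))
    where
    le : ∀ f → bit (conflicts P f) ≤ bit (lookup (edgeSet P ∩ N) f)
    le f = bit-∧-≤ (f ∈ᴱ? edges P) (isN f) (lookup (edgeSet P ∩ N) f)
      (λ f∈ eq → ∈⇒crossing P f∈ (nontrivial f (N⇒nontrivial (isN⇒ eq))))

  trivial⇒no-conflicts : ∀ {e} (P : TerminalPath e) → All Trivial (edges P) → ∑ (λ f → bit (conflicts P f)) ≡ 0
  trivial⇒no-conflicts P trivial = trans (∑-cong none) (∑-zero m)
    where
    none : ∀ f → bit (conflicts P f) ≡ 0
    none f = n≤0⇒n≡0 (bit-∧-≤ (f ∈ᴱ? edges P) (isN f) false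
      (λ f∈ eq → trans (sym (trivial⇒kept (All.lookup trivial f∈))) (proj₁ (isN⇒ eq))))

  -- Tightness bounds critical pairs only. A pair that is not critical has, up to double negation, a
  -- settling path of trivial edges; it avoids the nontrivial `e` and has no conflicts at all.
  tight-detour : ∀ {τ e} → IsTightness τ → IsN e → ¬ ¬ TightDetour τ e
  tight-detour {τ} {e} (N , N⇔ , bound , _) isn k = ¬¬-excluded-middle λ where
      (yes crit) → critical crit
      (no ¬crit) → ¬crit (within⇐ e (ℓ e) (D⇐ (proj₂ isn)) , uncritical)
    where
    nontrivial = λ f → Equivalence.from (N⇔ f)
    uncritical : ∀ P → Settling e P → ¬ All Trivial (edges P)
    uncritical P (_ , settles , le) trivial = k (P , All.map (λ {f} → within⇒ f (ℓ f)) settles ,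
      (λ e∈ → proj₂ (N⇒nontrivial isn) (All.lookup trivial e∈)) , within⇒ e (pathLength P) le ,
      ≤-trans (≤-reflexive (trivial⇒no-conflicts P trivial)) z≤n)
    Candidate = Σ (TerminalPath e) λ P → Settling e P × Alternative e P
    critical : Critical e → ⊥
    critical crit = ¬¬-minimum {Candidate} (λ (P , _) → crossings P N)
      (detour⇒settling (proj₂ (N⇒ (proj₁ isn) (proj₂ isn)))) λ ((P , settling , alt) , min) →
        let _ , settles , _ , le = settling⇒detour P settling alt
        in k (P , settles , alt , le , ≤-trans (conflicts≤crossings nontrivial P)
             (bound e P crit (settling , alt , λ Q s a → min (Q , s , a))))

  module _ (nt : ℕ → ℕ) (pos : Fin m → ℕ) (nt-0 : nt 0 ≡ m) (nt-pos : ∀ {e} → IsN e → nt (pos e) ≡ toℕ e) where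
    open Tuples nt pos nt-0 nt-pos

    early : ℕ → Fin m → Bool
    early K e = isN e ∧ (pos e ≤ᵇ K)

    -- Tightest alternative paths of an independent set of nontrivial edges
    -- survive the removal of the set.
    early-tuple : ∀ {τ K} → IsTightness τ → K ≤ ∑ (λ e → bit (early K e)) → W̄ * suc (2 * τ) ≤ K →
      ¬ ¬ (∃ λ c → (∀ i → c i ≤ K) × Valid (nt ∘ c))
    early-tuple {τ} {K} tight count enough k = ¬¬-∀Fin detours go
      where
      detours : ∀ e → ¬ ¬ (TightDetour τ e ⊎ isN e ≡ false)
      detours e k′ = case isN e ≟ᵇ true of λ where
        (no  isn) → k′ (inj₂ (¬-not isn))
        (yes isn) → tight-detour tight (isN⇒ isn) (k′ ∘ inj₁)
      early⇒ : ∀ {e} → early K e ≡ true → isN e ≡ true × pos e ≤ K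
      early⇒ {e} h = let isn , le = ∧⇒ (isN e) (pos e ≤ᵇ K) h in isn , ≤ᵇ-true⁻¹ le
      -- All edges are vertices of the digraph. Those that are not nontrivial get no outgoing arcs
      -- and are never selected, since `early` rules them out.
      Choice : Fin m → Set
      Choice e = TightDetour τ e ⊎ isN e ≡ false
      out : ∀ {e} → Choice e → Fin m → Bool
      out (inj₁ (P , _)) f = conflicts P f
      out (inj₂ _)       f = false
      out-degree : ∀ {e} (c : Choice e) → ∑ (λ f → bit (out c f)) ≤ τ
      out-degree (inj₁ (_ , _ , _ , _ , few)) = few
      out-degree (inj₂ _) = ≤-trans (≤-reflexive (∑-zero m)) z≤n
      avoiding : ∀ {e} xs → All (λ f → isN f ≡ true) xs → e List.∈ xs → (c : Choice e) →
        (∀ {f} → f List.∈ xs → out c f ≡ true → e ≡ f) →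
        Σ (TerminalPath e) λ P → All Settles (edges P) ×
          (∀ {f} → f List.∈ edges P → ¬ f List.∈ xs) × pathLength P * q ≤ p * d e
      avoiding xs ns e∈ (inj₂ e∉N) _ = case trans (sym (All.lookup ns e∈)) e∉N of λ ()
      avoiding {e} xs ns e∈ (inj₁ (P , settles , e∉ , le , _)) only = P , settles , avoids , le
        where
        avoids : ∀ {f} → f List.∈ edges P → ¬ f List.∈ xs
        avoids {f} f∈P f∈xs = e∉ (subst (List._∈ edges P) (sym e≡f) f∈P)
          where
          e≡f : e ≡ f
          e≡f = only f∈xs (cong₂ _∧_ (dec-true (f ∈ᴱ? edges P) f∈P) (All.lookup ns f∈xs))
      conclude : (detour : ∀ e → Choice e) →
        (∃ λ xs → length xs ≡ W̄ × Unique xs × All (λ x → early K x ≡ true) xs ×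
          (∀ {x y} → x List.∈ xs → y List.∈ xs → out (detour x) y ≡ true → x ≡ y)) → ⊥
      conclude detour (xs , len , xs! , live , indep) = k (tuple xs ,
        tuple-bound xs (All.map (proj₂ ∘ early⇒) live) ,
        tuple-valid xs (≤-reflexive len) ns
          (λ {e} e∈ → avoiding xs (All.map (proj₁ ∘ early⇒) live) e∈ (detour e) (indep e∈))
          (λ S xs⊆ _ → heavy-list xs! ns len S xs⊆))
        where
        ns : All IsN xs
        ns = All.map (isN⇒ ∘ proj₁ ∘ early⇒) live
      go : (∀ e → Choice e) → ⊥
      go detour = conclude detour
        (independent τ (λ e → out (detour e)) W̄ (early K) (λ e _ → out-degree (detour e)) (≤-trans enough count))

-- Reading lists

nth-++ˡ : ∀ xs ys {i} → i < length xs → nth (xs ++ ys) i ≡ nth xs i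
nth-++ˡ (x ∷ xs) ys {zero}  _        = refl
nth-++ˡ (x ∷ xs) ys {suc i} (s≤s i<) = nth-++ˡ xs ys i<

nth-++ʳ : ∀ xs ys {k} → length xs ≡ k → ∀ i → nth (xs ++ ys) (k + i) ≡ nth ys i
nth-++ʳ []       ys refl i = refl
nth-++ʳ (x ∷ xs) ys refl i = nth-++ʳ xs ys refl i

length-allFin : ∀ n → length (allFin n) ≡ n
length-allFin n = length-tabulate {n = n} id

length-map-allFin : ∀ {m} (f : Fin m → ℕ) → length (map f (allFin m)) ≡ m
length-map-allFin {m} f = trans (length-map f (allFin m)) (length-allFin m)

nth-map-allFin : ∀ {m} (f : Fin m → ℕ) e → nth (map f (allFin m)) (toℕ e) ≡ f e
nth-map-allFin f e = trans (cong (λ xs → nth xs (toℕ e)) (map-tabulate id f)) (go f e)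
  where
  go : ∀ {m} (f : Fin m → ℕ) e → nth (tabulate f) (toℕ e) ≡ f e
  go f zero    = refl
  go f (suc e) = go (f ∘ suc) e

module _ {A : Set} (f : A → List ℕ) (L : ℕ) (block : ∀ u → length (f u) ≡ L) where

  length-blocks : ∀ xs → length (concatMap f xs) ≡ length xs * L
  length-blocks []       = refl
  length-blocks (x ∷ xs) = trans (length-++ (f x)) (cong₂ _+_ (block x) (length-blocks xs))

  nth-blocks : ∀ {n} (g : Fin n → A) u {j} → j < L →
    nth (concatMap f (tabulate g)) (toℕ u * L + j) ≡ nth (f (g u)) j
  nth-blocks {suc n} g zero    {j} j<L = nth-++ˡ (f (g zero)) _ (subst (j <_) (sym (block (g zero))) j<L)
  nth-blocks {suc n} g (suc u) {j} j<L =
    trans (cong (nth (f (g zero) ++ concatMap f (tabulate (g ∘ suc)))) (+-assoc L (toℕ u * L) j))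
      (trans (nth-++ʳ (f (g zero)) _ (block (g zero)) (toℕ u * L + j)) (nth-blocks (g ∘ suc) u j<L))

module PairTable (G : Network) (d₁ d₂ : Fin (Network.n G) → Fin (Network.n G) → ℕ) where
  open Network G using (n)

  private
    row : Fin n → List ℕ
    row u = concatMap (λ v → d₁ u v ∷ d₂ u v ∷ []) (allFin n)

    length-row : ∀ u → length (row u) ≡ n + n
    length-row u = trans (length-blocks _ 2 (λ v → refl) (allFin n))
      (trans (cong (_* 2) (length-allFin n)) (trans (*-comm n 2) (cong (n +_) (+-identityʳ n))))

    entry< : ∀ (v : Fin n) {j} → j < 2 → toℕ v * 2 + j < n + n
    entry< v {j} j<2 = begin-strict
      toℕ v * 2 + j <⟨ +-monoʳ-< (toℕ v * 2) j<2 ⟩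
      toℕ v * 2 + 2 ≡⟨ +-comm (toℕ v * 2) 2 ⟩
      suc (toℕ v) * 2 ≤⟨ *-monoˡ-≤ 2 (toℕ<n v) ⟩
      n * 2 ≡⟨ trans (*-comm n 2) (cong (n +_) (+-identityʳ n)) ⟩
      n + n ∎
      where open ≤-Reasoning

  length-pairTable : length (pairTable G d₁ d₂) ≡ n * (n + n)
  length-pairTable = trans (length-blocks row (n + n) length-row (allFin n)) (cong (_* (n + n)) (length-allFin n))

  index : Fin n → Fin n → ℕ
  index u v = toℕ u * (n + n) + toℕ v + toℕ v

  private
    nth-entry : ∀ u v {j} → j < 2 → nth (pairTable G d₁ d₂) (index u v + j) ≡ nth (d₁ u v ∷ d₂ u v ∷ []) j
    nth-entry u v {j} j<2 = begin
      nth (pairTable G d₁ d₂) (index u v + j)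
        ≡⟨ cong (nth (pairTable G d₁ d₂)) (shuffle (toℕ u * (n + n)) (toℕ v) j) ⟩
      nth (pairTable G d₁ d₂) (toℕ u * (n + n) + (toℕ v * 2 + j))
        ≡⟨ nth-blocks row (n + n) length-row id u (entry< v j<2) ⟩
      nth (row u) (toℕ v * 2 + j)
        ≡⟨ nth-blocks (λ v → d₁ u v ∷ d₂ u v ∷ []) 2 (λ v → refl) id v j<2 ⟩
      nth (d₁ u v ∷ d₂ u v ∷ []) j ∎
      where
      open ≡-Reasoning
      shuffle : ∀ a v j → a + v + v + j ≡ a + (v * 2 + j)
      shuffle = solve-∀

  nth-first : ∀ u v → nth (pairTable G d₁ d₂) (index u v) ≡ d₁ u v
  nth-first u v = trans (cong (nth (pairTable G d₁ d₂)) (sym (+-identityʳ (index u v)))) (nth-entry u v (s≤s z≤n))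

  nth-second : ∀ u v → nth (pairTable G d₁ d₂) (index u v + 1) ≡ d₂ u v
  nth-second u v = nth-entry u v (s≤s (s≤s z≤n))

  index< : ∀ u v {j} → j < 2 → index u v + j < n * (n + n)
  index< u v {j} j<2 = begin-strict
    index u v + j                        ≡⟨ shuffle (toℕ u * (n + n)) (toℕ v) j ⟩
    toℕ u * (n + n) + (toℕ v * 2 + j)    <⟨ +-monoʳ-< (toℕ u * (n + n)) (entry< v j<2) ⟩
    toℕ u * (n + n) + (n + n)            ≡⟨ +-comm (toℕ u * (n + n)) (n + n) ⟩
    suc (toℕ u) * (n + n)                ≤⟨ *-monoˡ-≤ (n + n) (toℕ<n u) ⟩
    n * (n + n) ∎
    where
    open ≤-Reasoning
    shuffle : ∀ a v j → a + v + v + j ≡ a + (v * 2 + j)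
    shuffle = solve-∀

∑< : (ℕ → ℕ) → ℕ → ℕ
∑< g zero    = 0
∑< g (suc i) = ∑< g i + g i

∑<-suc : ∀ g i → ∑< g (suc i) ≡ g 0 + ∑< (g ∘ suc) i
∑<-suc g zero    = +-comm 0 (g 0)
∑<-suc g (suc i) = trans (cong (_+ g (suc i)) (∑<-suc g i)) (+-assoc (g 0) _ _)

∑<-∑ : ∀ g {m} (f : Fin m → ℕ) → (∀ e → g (toℕ e) ≡ f e) → ∑< g m ≡ ∑ f
∑<-∑ g {zero}  f h = refl
∑<-∑ g {suc m} f h = trans (∑<-suc g m) (cong₂ _+_ (h zero) (∑<-∑ (g ∘ suc) (f ∘ suc) (h ∘ suc)))

-- The program

-- LL: 1 + ∑ ℓ; G2, G4: inputs of the two subroutines (the lengths start at 2 + 2 m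
-- and 4 + 2 m); TAB, SP: their outputs; ROW: offsets of the rows of TAB; DIST: the
-- distances of the ends of the edges; DF, TF, SF: flags of the edges in D, of those
-- in D or nontrivial, and of those removed at present; CNT, NT: numbering of the
-- nontrivial edges; CS, B: digits of the current tuple and their base; ZERO: all 0.
LL G2 G4 ROW TAB DIST DF TF TOT CRIT OK SF CNT NT B CS CR SP GO ZERO : ℕ
LL = 3
G2 = 4
G4 = 5
ROW = 6
TAB = 7
DIST = 8
DF = 9
TF = 10
TOT = 11
CRIT = 12
OK = 13
SF = 14
CNT = 15
NT = 16
B = 17
CS = 18
CR = 19
SP = 20
GO = 21
ZERO = 22

cell : ℕ → Exp
cell a = a ⟦ lit 0 ⟧

p̂ q̂ Ŵ n̂ m̂ : Exp
p̂ = 0 ⟦ lit 0 ⟧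
q̂ = 0 ⟦ lit 1 ⟧
Ŵ = 0 ⟦ lit 2 ⟧
n̂ = 0 ⟦ lit 3 ⟧
m̂ = 0 ⟦ lit 4 ⟧

srcE tgtE lenE wtE entry : Exp → Exp
srcE x = 0 ⟦ lit 5 ⊕ x ⟧
tgtE x = 0 ⟦ (lit 5 ⊕ m̂) ⊕ x ⟧
lenE x = 0 ⟦ ((lit 5 ⊕ m̂) ⊕ m̂) ⊕ x ⟧
wtE  x = 0 ⟦ (((lit 5 ⊕ m̂) ⊕ m̂) ⊕ m̂) ⊕ x ⟧
entry x = ((ROW ⟦ srcE x ⟧) ⊕ tgtE x) ⊕ tgtE x

flagged : ℕ → Exp → Test
flagged f x = lit 1 · lit 1 ≤ lit 1 · (f ⟦ x ⟧)

okay : Exp → Exp → Tree → Tree → Tree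
okay o x s t =
  cond (lit 1 · lit 1 ≤ lit 1 · o)
    (cond (lit 1 · o ≤ lit 1 · cell LL)
      (cond ((o ⊖ lit 1) · q̂ ≤ p̂ · (DIST ⟦ x ⟧)) s t) t) t

sumLengths copyHead₂ copyHead₄ rows setup : Cmd
sumLengths = (LL ⟦ lit 0 ⟧≔ lit 1) ⨾ for m̂ (LL ⟦ lit 0 ⟧← ret (cell LL ⊕ lenE idx))
copyHead₂  = for (lit 2 ⊕ (m̂ ⊕ m̂)) (G2 ⟦ lit 0 ⊕ idx ⟧← ret (0 ⟦ lit 3 ⊕ idx ⟧))
copyHead₄  = for (lit 2 ⊕ (m̂ ⊕ m̂)) (G4 ⟦ lit 2 ⊕ idx ⟧← ret (0 ⟦ lit 3 ⊕ idx ⟧))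
-- Expressions have no products, so the multiples of `n + n` are accumulated once and looked up
-- afterwards.
rows       = for n̂ (ROW ⟦ lit 1 ⊕ idx ⟧← ret ((ROW ⟦ idx ⟧) ⊕ (n̂ ⊕ n̂)))
setup      = sumLengths ⨾ (copyHead₂ ⨾ (copyHead₄ ⨾ rows))

setLengths : ℕ → ℕ → ℕ → Cmd
setLengths f a k = for m̂
  (a ⟦ (lit k ⊕ (m̂ ⊕ m̂)) ⊕ idx ⟧← cond (flagged f idx) (ret (cell LL)) (ret (lenE idx)))

dists flagsD flagsTN copySF total critical heavy : Cmd
dists    = for m̂ (DIST ⟦ lit 0 ⊕ idx ⟧← ret ((TAB ⟦ entry idx ⟧) ⊖ lit 1))
flagsD   = for m̂ (DF ⟦ lit 0 ⊕ idx ⟧← cond (lenE idx · q̂ ≤ p̂ · (DIST ⟦ idx ⟧)) (ret (lit 0)) (ret (lit 1)))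
flagsTN  = for m̂ (TF ⟦ lit 0 ⊕ idx ⟧← cond (flagged DF idx) (ret (lit 1))
             (cond (lit 1 · wtE idx ≤ lit 1 · lit 0) (ret (lit 0))
               (okay (TAB ⟦ entry idx ⊕ lit 1 ⟧) idx (ret (lit 1)) (ret (lit 0)))))
copySF   = for m̂ (SF ⟦ lit 0 ⊕ idx ⟧← ret (TF ⟦ idx ⟧))
total    = (TOT ⟦ lit 0 ⟧≔ lit 0) ⨾
           for m̂ (TOT ⟦ lit 0 ⟧← cond (flagged SF idx) (ret (cell TOT ⊕ wtE idx)) (ret (cell TOT)))
critical = for m̂ (CRIT ⟦ lit 0 ⟧← cond (flagged DF idx) (ret (cell CRIT))
             (okay (TAB ⟦ entry idx ⟧) idx (ret (cell CRIT)) (ret (lit 1))))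
heavy    = OK ⟦ lit 0 ⟧← cond (lit 1 · Ŵ ≤ lit 1 · cell TOT) (ret (lit 1)) (ret (lit 0))

listN : Cmd
listN = for m̂ (CNT ⟦ lit 1 ⊕ idx ⟧← ret ((CNT ⟦ idx ⟧) ⊕ ((TF ⟦ idx ⟧) ⊖ (DF ⟦ idx ⟧)))) ⨾
  ((NT ⟦ lit 0 ⟧≔ m̂) ⨾
   for m̂ (NT ⟦ lit 1 ⊕ (CNT ⟦ idx ⟧) ⟧← ret idx))

resetSF mark advance : Cmd
resetSF = for m̂ (SF ⟦ lit 0 ⊕ idx ⟧← ret (DF ⟦ idx ⟧))
-- A blank entry marks cell `m`, which belongs to no edge.
mark    = for Ŵ (SF ⟦ NT ⟦ CS ⟦ idx ⟧ ⟧ ⟧← ret (lit 1))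

-- Add 1 to the number with the digits CS in base B; CR holds the carries.
advance = (CR ⟦ lit 0 ⟧≔ lit 1) ⨾
  (for Ŵ (CR ⟦ lit 1 ⊕ idx ⟧← cond (lit 1 · cell B ≤ lit 1 · ((CS ⟦ idx ⟧) ⊕ (CR ⟦ idx ⟧))) (ret (lit 1)) (ret (lit 0))) ⨾
  (for Ŵ (CS ⟦ lit 0 ⊕ idx ⟧← cond (flagged CR (lit 1 ⊕ idx)) (ret (lit 0)) (ret ((CS ⟦ idx ⟧) ⊕ (CR ⟦ idx ⟧)))) ⨾
  -- A carry out of the top digit leaves all digits 0 and raises the base, so the enumeration
  -- restarts. For `W̄` = 0 the initial carry does this after a single trial.
  ((B ⟦ lit 0 ⟧≔ (cell B ⊕ (CR ⟦ Ŵ ⟧))) ⨾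
   -- Base `b` draws on the positions below `b`; with position 0 for the blank, one more than the
   -- number of nontrivial edges is the largest useful base.
   (GO ⟦ lit 0 ⟧← cond (lit 1 · cell B ≤ lit 1 · ((CNT ⟦ m̂ ⟧) ⊕ lit 1)) (ret (lit 1)) (ret (lit 0))))))

output : Cmd
output = ifte (flagged OK (lit 0))
  ((1 ⟦ lit 0 ⟧≔ lit 1) ⨾ for m̂ (1 ⟦ lit 1 ⊕ idx ⟧← ret (lit 1 ⊖ (SF ⟦ idx ⟧))))
  -- Array 1 is initially 0, which already is the negative answer.
  skip

module Program (spsp apsp₂ : Cmd) where

  measure : ℕ → Cmd
  -- `ROW ⟦ n̂ ⟧` is the offset after the last row, that is, the size of the whole table.
  measure f = setLengths f G2 2 ⨾ call apsp₂ G2 ((lit 2 ⊕ (m̂ ⊕ m̂)) ⊕ m̂) TAB (ROW ⟦ n̂ ⟧)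

  -- The three tables serve different ends: the full graph gives the distances, the graph without
  -- `D` the alternative settling paths, and the graph without `TN` tells whether the trivial edges
  -- form a spanner.
  classify : Cmd
  classify = measure ZERO ⨾ (dists ⨾ (flagsD ⨾ (measure DF ⨾ (flagsTN ⨾ (measure TF ⨾
    (copySF ⨾ (total ⨾ (critical ⨾ heavy))))))))

  probe : Cmd
  probe = ifte (lit 1 · ((NT ⟦ CS ⟦ idx ⟧ ⟧) ⊕ lit 1) ≤ lit 1 · m̂)
    ((G4 ⟦ lit 0 ⟧≔ srcE (NT ⟦ CS ⟦ idx ⟧ ⟧)) ⨾
    ((G4 ⟦ lit 1 ⟧≔ tgtE (NT ⟦ CS ⟦ idx ⟧ ⟧)) ⨾
    (call spsp G4 ((lit 4 ⊕ (m̂ ⊕ m̂)) ⊕ m̂) SP (lit 1) ⨾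
     (OK ⟦ lit 0 ⟧← okay (cell SP) (NT ⟦ CS ⟦ idx ⟧ ⟧) (ret (cell OK)) (ret (lit 0))))))
    skip

  attempt : Cmd
  attempt = resetSF ⨾ (mark ⨾ (setLengths SF G4 4 ⨾ (total ⨾ (heavy ⨾ for Ŵ probe))))

  search : Cmd
  search = while (flagged GO (lit 0))
    (attempt ⨾ ifte (flagged OK (lit 0)) (GO ⟦ lit 0 ⟧≔ lit 0) advance)

  enumerate : Cmd
  enumerate = listN ⨾ ((B ⟦ lit 0 ⟧≔ lit 1) ⨾ ((GO ⟦ lit 0 ⟧≔ lit 1) ⨾ search))

  solve : Cmd
  solve = setup ⨾ (classify ⨾ (ifte (flagged CRIT (lit 0)) enumerate skip ⨾ output))

bit-test : ∀ b → (1 ≤ᵇ bit b + 0) ≡ b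
bit-test true  = refl
bit-test false = refl

-- Layout of the encoded instance

module Input (I : Instance) where
  open Instance I

  private
    Ss Ts Ls Vs : List ℕ
    Ss = map (λ e → toℕ (src e)) (allFin m)
    Ts = map (λ e → toℕ (tgt e)) (allFin m)
    Ls = map ℓ (allFin m)
    Vs = map w (allFin m)

    nested : (Ss ++ Ts ++ Ls) ++ Vs ≡ Ss ++ Ts ++ Ls ++ Vs
    nested = trans (++-assoc Ss (Ts ++ Ls) Vs) (cong (Ss ++_) (++-assoc Ts Ls Vs))

  inp : ℕ → ℕ
  inp = nth (encode I)

  private
    body : ∀ i → inp (5 + i) ≡ nth (Ss ++ Ts ++ Ls ++ Vs) i
    body i = cong (λ xs → nth xs i) nested

    skipS : ∀ ys i → nth (Ss ++ ys) (m + i) ≡ nth ys i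
    skipS ys = nth-++ʳ Ss ys (length-map-allFin (λ e → toℕ (src e)))
    skipT : ∀ ys i → nth (Ts ++ ys) (m + i) ≡ nth ys i
    skipT ys = nth-++ʳ Ts ys (length-map-allFin (λ e → toℕ (tgt e)))
    skipL : ∀ ys i → nth (Ls ++ ys) (m + i) ≡ nth ys i
    skipL ys = nth-++ʳ Ls ys (length-map-allFin ℓ)

    here-at : (f : Fin m → ℕ) → ∀ ys e → nth (map f (allFin m) ++ ys) (toℕ e) ≡ f e
    here-at f ys e = trans (nth-++ˡ (map f (allFin m)) ys (subst (toℕ e <_) (sym (length-map-allFin f)) (toℕ<n e)))
                           (nth-map-allFin f e)

  inp-src : ∀ e → inp (5 + toℕ e) ≡ toℕ (src e)
  inp-src e = trans (body (toℕ e)) (here-at (λ e → toℕ (src e)) _ e)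

  inp-tgt : ∀ e → inp (5 + m + toℕ e) ≡ toℕ (tgt e)
  inp-tgt e = trans (body (m + toℕ e)) (trans (skipS _ _) (here-at (λ e → toℕ (tgt e)) _ e))

  inp-len : ∀ e → inp (5 + m + m + toℕ e) ≡ ℓ e
  inp-len e = trans (body (m + m + toℕ e)) (trans (cong (nth (Ss ++ Ts ++ Ls ++ Vs)) (+-assoc m m (toℕ e)))
    (trans (skipS _ _) (trans (skipT _ _) (here-at ℓ _ e))))

  inp-wt : ∀ e → inp (5 + m + m + m + toℕ e) ≡ w e
  inp-wt e = trans (body (m + m + m + toℕ e))
    (trans (cong (nth (Ss ++ Ts ++ Ls ++ Vs)) (trans (+-assoc (m + m) m (toℕ e)) (+-assoc m m (m + toℕ e))))
    (trans (skipS _ _) (trans (skipT _ _) (trans (skipL _ _)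
      (trans (nth-map-allFin w e) refl)))))

  head : List ℕ
  head = n ∷ m ∷ Ss ++ Ts

  length-head : length head ≡ 2 + (m + m)
  length-head = cong (2 +_) (trans (length-++ Ss)
    (cong₂ _+_ (length-map-allFin (λ e → toℕ (src e))) (length-map-allFin (λ e → toℕ (tgt e)))))

  inp-head : ∀ {i} → i < 2 + (m + m) → inp (3 + i) ≡ nth head i
  inp-head {i} i< = trans (cong (λ xs → nth xs i) split) (nth-++ˡ head (Ls ++ Vs) (subst (i <_) (sym length-head) i<))
    where
    split : n ∷ m ∷ (Ss ++ Ts ++ Ls) ++ Vs ≡ head ++ (Ls ++ Vs)
    split = cong (λ xs → n ∷ m ∷ xs) (trans nested (sym (++-assoc Ss Ts (Ls ++ Vs))))

  network-split : ∀ R → encodeNetwork (surcharge G R) ≡ head ++ map (Network.ℓ (surcharge G R)) (allFin m)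
  network-split R = cong (λ xs → n ∷ m ∷ xs) (sym (++-assoc Ss Ts _))

  length-network : ∀ R → length (encodeNetwork (surcharge G R)) ≡ 2 + (m + m) + m
  length-network R = trans (cong length (network-split R)) (trans (length-++ head)
    (cong₂ _+_ length-head (length-map-allFin (Network.ℓ (surcharge G R)))))

  network-cells : ∀ R (g : ℕ → ℕ) → (∀ i → i < 2 + (m + m) → g i ≡ inp (3 + i)) →
    (∀ e → g (2 + (m + m) + toℕ e) ≡ Network.ℓ (surcharge G R) e) →
    ∀ i → i < 2 + (m + m) + m → g i ≡ nth (encodeNetwork (surcharge G R)) i
  network-cells R g heads lens i i< = trans (go (i <? k)) (cong (λ xs → nth xs i) (sym (network-split R)))
    where
    k = 2 + (m + m)
    ls = map (Network.ℓ (surcharge G R)) (allFin m)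
    go : Dec (i < k) → g i ≡ nth (head ++ ls) i
    go (yes i<k) = trans (heads i i<k) (trans (inp-head i<k)
      (sym (nth-++ˡ head ls (subst (i <_) (sym length-head) i<k))))
    go (no i≮k) = begin
      g i                        ≡⟨ cong g i≡ ⟩
      g (k + toℕ e)              ≡⟨ lens e ⟩
      Network.ℓ (surcharge G R) e ≡⟨ nth-map-allFin (Network.ℓ (surcharge G R)) e ⟨
      nth ls (toℕ e)             ≡⟨ nth-++ʳ head ls length-head (toℕ e) ⟨
      nth (head ++ ls) (k + toℕ e) ≡⟨ cong (nth (head ++ ls)) i≡ ⟨
      nth (head ++ ls) i ∎
      where
      open ≡-Reasoning
      k≤i : k ≤ i
      k≤i = ≮⇒≥ i≮k
      small : i ∸ k < m
      small = +-cancelˡ-< k _ _ (subst (_< k + m) (sym (m+[n∸m]≡n k≤i)) i<)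
      e : Fin m
      e = fromℕ< small
      i≡ : i ≡ k + toℕ e
      i≡ = trans (sym (m+[n∸m]≡n k≤i)) (cong (k +_) (sym (toℕ-fromℕ< small)))

  length-encode : length (encode I) ≡ 5 + 4 * m
  length-encode = cong (5 +_) (trans (cong length nested) (trans (length-++ Ss) (trans (cong₂ _+_ sizeS
    (trans (length-++ Ts) (cong₂ _+_ sizeT (trans (length-++ Ls) (cong₂ _+_ (length-map-allFin ℓ) (length-map-allFin w))))))
    (cong (λ z → m + (m + (m + z))) (sym (+-identityʳ m))))))
    where
    sizeS = length-map-allFin (λ e → toℕ (src e))
    sizeT = length-map-allFin (λ e → toℕ (tgt e))

-- Straight-line phases

module Phases (I : Instance) where
  open Spanners I
  open Input I

  HasInput : Memory → Set
  HasInput σ = ∀ j → σ 0 j ≡ inp j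

  module _ {σ : Memory} (input : HasInput σ) {x : Exp} {i : ℕ} (x≡ : eval σ x ≡ i) where

    eval-len : eval σ (lenE x) ≡ inp (5 + m + m + i)
    eval-len = trans (input _) (cong₂ (λ a b → inp (5 + a + a + b)) (input 4) x≡)

    eval-wt : eval σ (wtE x) ≡ inp (5 + m + m + m + i)
    eval-wt = trans (input _) (cong₂ (λ a b → inp (5 + a + a + a + b)) (input 4) x≡)

    eval-src : eval σ (srcE x) ≡ inp (5 + i)
    eval-src = trans (input _) (cong (λ b → inp (5 + b)) x≡)

    eval-tgt : eval σ (tgtE x) ≡ inp (5 + m + i)
    eval-tgt = trans (input _) (cong₂ (λ a b → inp (5 + a + b)) (input 4) x≡)

  1≤suc : ∀ {k} → 1 ≤ suc k
  1≤suc = s≤s z≤n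

  runs-sumLengths : ∀ {σ} → HasInput σ → Runs sumLengths σ (suc (m * 1)) (λ ρ → ρ LL 0 ≡ suc (∑ ℓ))
  runs-sumLengths {σ} input = runs-seq (runs-assign (ret (lit 1)) {λ ρ → ρ ≡ write σ LL 0 1} 1≤suc refl) λ
    { _ refl → runs-weaken ≤-refl (λ ρ h → trans h (cong suc (∑<-∑ len ℓ inp-len)))
      (runs-fold LL m (λ i → suc (∑< len i)) refl (λ _ _ → input 4) refl
        (λ e g g0 → cong₂ _+_ g0 (eval-len {overlay LL g (at (write σ LL 0 1) (toℕ e))} input {idx} refl))) }
    where
    len : ℕ → ℕ
    len i = inp (5 + m + m + i)

  runs-copyHead₂ : ∀ {σ} → HasInput σ →
    Runs copyHead₂ σ (suc ((2 + (m + m)) * 1)) (λ ρ → ∀ i → i < 2 + (m + m) → ρ G2 i ≡ inp (3 + i))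
  runs-copyHead₂ {σ} input = runs-weaken ≤-refl (λ ρ (h , _) i i< → trans (h i i<) (input (3 + i)))
    (runs-fill G2 (2 + (m + m)) 0 refl (λ _ _ → cong (λ k → 2 + (k + k)) (input 4)) (λ _ _ → refl) (λ _ → refl))

  runs-copyHead₄ : ∀ {σ} → HasInput σ →
    Runs copyHead₄ σ (suc ((2 + (m + m)) * 1)) (λ ρ → ∀ i → i < 2 + (m + m) → ρ G4 (2 + i) ≡ inp (3 + i))
  runs-copyHead₄ {σ} input = runs-weaken ≤-refl (λ ρ (h , _) i i< → trans (h i i<) (input (3 + i)))
    (runs-fill G4 (2 + (m + m)) 2 refl (λ _ _ → cong (λ k → 2 + (k + k)) (input 4)) (λ _ _ → refl) (λ _ → refl))

  runs-rows : ∀ {σ} → HasInput σ → σ ROW 0 ≡ 0 →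
    Runs rows σ (suc (n * 1)) (λ ρ → ∀ i → i ≤ n → ρ ROW i ≡ i * (n + n))
  runs-rows {σ} input zero-row = runs-scan ROW n (_* (n + n)) refl (λ _ _ → input 3) zero-row
    (λ e g ge → trans (cong₂ _+_ ge (cong (λ k → k + k) (input 3))) (+-comm (toℕ e * (n + n)) (n + n)))

  runs-setLengths : ∀ f a k {σ R} → (a ≡ᵇ 0) ≡ false → (a ≡ᵇ ctr) ≡ false → (a ≡ᵇ LL) ≡ false →
    (a ≡ᵇ f) ≡ false → (ctr ≡ᵇ f) ≡ false → HasInput σ → σ LL 0 ≡ suc (∑ ℓ) →
    (∀ e → σ f (toℕ e) ≡ bit (lookup R e)) →
    Runs (setLengths f a k) σ (suc (m * 1)) (λ ρ →
      (∀ e → ρ a (k + (m + m) + toℕ e) ≡ Network.ℓ (surcharge G R) e) ×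
      (∀ j → j < k + (m + m) → ρ a j ≡ σ a j))
  runs-setLengths f a k {σ} {R} a≢0 a≢ctr a≢LL a≢f ctr≢f input big flags =
    runs-weaken ≤-refl (λ ρ (h , h′) → (λ e → trans (h (toℕ e) (toℕ<n e)) (len e)) , h′)
      (runs-fill a m (k + (m + m)) a≢ctr bound offset reads)
    where
    V = cond (flagged f idx) (ret (cell LL)) (ret (lenE idx))
    bound : ∀ g y → eval (overlay a g (at σ y)) m̂ ≡ m
    bound g y rewrite a≢0 = input 4
    offset : ∀ g y → eval (overlay a g (at σ y)) (lit k ⊕ (m̂ ⊕ m̂)) ≡ k + (m + m)
    offset g y rewrite a≢0 = cong (λ z → k + (z + z)) (input 4)
    reads : ∀ e → value (overlay a (patch (k + (m + m)) (λ i → value (at σ i) V) (σ a) e) (at σ e)) V ≡ value (at σ e) V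
    reads e rewrite a≢0 | a≢ctr | a≢LL | a≢f = refl
    len : ∀ e → value (at σ (toℕ e)) V ≡ Network.ℓ (surcharge G R) e
    len e rewrite ctr≢f | flags e | bit-test (lookup R e) = cong₂ (if lookup R e then_else_) big
      (trans (eval-len {at σ (toℕ e)} input {idx} refl) (inp-len e))

-- Boolean conditions and accumulators

∧⇐ : ∀ {a b} → a ≡ true → b ≡ true → a ∧ b ≡ true
∧⇐ refl refl = refl

not-≤ᵇ⇒ : ∀ i j → not (i ≤ᵇ j) ≡ true → ¬ i ≤ j
not-≤ᵇ⇒ i j eq le rewrite ≤ᵇ-true le = case eq of λ ()

not-≤ᵇ⇐ : ∀ i j → not (i ≤ᵇ j) ≡ false → i ≤ j
not-≤ᵇ⇐ i j eq with i ≤ᵇ j in le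
... | true = ≤ᵇ-true⁻¹ le

∨-split : ∀ a b → a ∨ b ≡ true → a ≡ false → b ≡ true
∨-split false b h _ = h

∨-∧-miss : ∀ a b c → a ∨ (b ∧ c) ≡ false → b ≡ true → c ≡ true → ⊥
∨-∧-miss false true true () _ _

okayᵇ : (M a b d o : ℕ) → Bool
okayᵇ M a b d o = (1 ≤ᵇ o) ∧ ((o ≤ᵇ M) ∧ ((o ∸ 1) * b ≤ᵇ a * d))

okayᵇ⇒ : ∀ M a b d o → okayᵇ M a b d o ≡ true → 1 ≤ o × o ≤ M × (o ∸ 1) * b ≤ a * d
okayᵇ⇒ M a b d o h =
  let h₁ , h₂ = ∧⇒ (1 ≤ᵇ o) _ h
      h₃ , h₄ = ∧⇒ (o ≤ᵇ M) _ h₂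
  in ≤ᵇ-true⁻¹ h₁ , ≤ᵇ-true⁻¹ h₃ , ≤ᵇ-true⁻¹ h₄

okayᵇ⇐ : ∀ M a b d o → 1 ≤ o × o ≤ M × (o ∸ 1) * b ≤ a * d → okayᵇ M a b d o ≡ true
okayᵇ⇐ M a b d o (h₁ , h₂ , h₃) = ∧⇐ (≤ᵇ-true h₁) (∧⇐ (≤ᵇ-true h₂) (≤ᵇ-true h₃))

nested-if : ∀ {A : Set} a b c {s t : A} →
  (if a then (if b then (if c then s else t) else t) else t) ≡ (if a ∧ (b ∧ c) then s else t)
nested-if true  true  _ = refl
nested-if true  false _ = refl
nested-if false _     _ = refl

if-+ : ∀ b x y → (if b then x + y else x) ≡ x + (if b then y else 0)
if-+ true  x y = refl
if-+ false x y = sym (+-identityʳ x)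

if-∨ : ∀ {A : Set} a b {x y : A} → (if a then x else (if b then x else y)) ≡ (if a ∨ b then x else y)
if-∨ true  b = refl
if-∨ false b = refl

if-not-bit : ∀ b → (if b then 0 else 1) ≡ bit (not b)
if-not-bit true  = refl
if-not-bit false = refl

alarm : (ℕ → Bool) → ℕ → ℕ
alarm c zero    = 0
alarm c (suc i) = if c i then alarm c i else 1

alarm-cases : ∀ c k → (alarm c k ≡ 0 × ∀ i → i < k → c i ≡ true) ⊎ (alarm c k ≡ 1 × ∃ λ i → i < k × c i ≡ false)
alarm-cases c zero    = inj₁ (refl , λ i ())
alarm-cases c (suc k) with c k in eq
... | false = inj₂ (refl , k , ≤-refl , eq)
... | true with alarm-cases c k
...   | inj₂ (r , i , i<k , ci) = inj₂ (r , i , m≤n⇒m≤1+n i<k , ci)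
...   | inj₁ (r , all) = inj₁ (r , λ i i<1+k → case m≤n⇒m<n∨m≡n (s≤s⁻¹ i<1+k) of λ where
        (inj₁ i<k)  → all i i<k
        (inj₂ refl) → eq)

∑<-mono : ∀ g {i j} → i ≤ j → ∑< g i ≤ ∑< g j
∑<-mono g {j = zero}  z≤n = z≤n
∑<-mono g {i} {suc j} i≤1+j with m≤n⇒m<n∨m≡n i≤1+j
... | inj₁ i≤j  = ≤-trans (∑<-mono g (s≤s⁻¹ i≤j)) (m≤m+n _ (g j))
... | inj₂ refl = ≤-refl

∑<-cong : ∀ {f g} k → (∀ i → i < k → f i ≡ g i) → ∑< f k ≡ ∑< g k
∑<-cong zero    h = refl
∑<-cong (suc k) h = cong₂ _+_ (∑<-cong k (λ i i<k → h i (m≤n⇒m≤1+n i<k))) (h k ≤-refl)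

-- Listing a subset of Fin m: position 1 + k holds the element with k
-- predecessors. Elements outside the subset are written one position too
-- far and overwritten by the next element of the subset.
module Listing {m : ℕ} (member : Fin m → Bool) where

  weightAt : ℕ → ℕ
  weightAt = nth (map (λ e → bit (member e)) (allFin m))

  weightAt-toℕ : ∀ e → weightAt (toℕ e) ≡ bit (member e)
  weightAt-toℕ = nth-map-allFin (λ e → bit (member e))

  cnt : ℕ → ℕ
  cnt = ∑< weightAt

  fill : ℕ → ℕ → ℕ
  fill zero    zero    = m
  fill zero    (suc j) = 0
  fill (suc i) j       = if suc (cnt i) ≡ᵇ j then i else fill i j

  nt : ℕ → ℕ
  nt = fill m

  pos : Fin m → ℕ
  pos e = suc (cnt (toℕ e))

  nt-0 : nt 0 ≡ m
  nt-0 = go m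
    where
    go : ∀ i → fill i 0 ≡ m
    go zero    = refl
    go (suc i) = go i

  cnt-suc : ∀ {e} → member e ≡ true → cnt (suc (toℕ e)) ≡ suc (cnt (toℕ e))
  cnt-suc {e} h = trans (cong (cnt (toℕ e) +_) (trans (weightAt-toℕ e) (cong bit h))) (+-comm _ 1)

  -- After iteration `toℕ e` the count exceeds `cnt (toℕ e)`, so no later write reaches this
  -- position.
  nt-pos : ∀ {e} → member e ≡ true → nt (pos e) ≡ toℕ e
  nt-pos {e} h = go m (toℕ<n e)
    where
    go : ∀ i → toℕ e < i → fill i (pos e) ≡ toℕ e
    go (suc i) e≤i with m≤n⇒m<n∨m≡n (s≤s⁻¹ e≤i)
    ... | inj₂ refl rewrite ≡ᵇ-refl (cnt (toℕ e)) = refl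
    ... | inj₁ e<i rewrite ≡ᵇ-false {cnt i} {cnt (toℕ e)}
            (λ eq → 1+n≰n (≤-trans (≤-reflexive (sym (cnt-suc h))) (≤-trans (∑<-mono weightAt e<i) (≤-reflexive eq)))) =
      go i e<i

  pos≤ : ∀ {e} → member e ≡ true → pos e ≤ cnt m
  pos≤ {e} h = ≤-trans (≤-reflexive (sym (cnt-suc h))) (∑<-mono weightAt (toℕ<n e))

  -- Positions are consecutive, so no number up to `K` is left out. The induction bounds the early
  -- members of each prefix from below by `cnt i ⊓ K`.
  count : ∀ {K} → K ≤ cnt m → K ≤ ∑ (λ e → bit (member e ∧ (pos e ≤ᵇ K)))
  count {K} K≤ = ≤-trans (≤-reflexive (sym (m≥n⇒m⊓n≡n K≤))) (≤-trans (go m) (≤-reflexive (∑<-∑ early _ early≡)))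
    where
    early : ℕ → ℕ
    early i = if suc (cnt i) ≤ᵇ K then weightAt i else 0
    early≡ : ∀ e → early (toℕ e) ≡ bit (member e ∧ (pos e ≤ᵇ K))
    early≡ e rewrite weightAt-toℕ e with member e | pos e ≤ᵇ K
    ... | true  | true  = refl
    ... | true  | false = refl
    ... | false | true  = refl
    ... | false | false = refl
    go : ∀ i → cnt i ⊓ K ≤ ∑< early i
    go zero    = z≤n
    go (suc i) with suc (cnt i) ≤? K
    ... | yes lt rewrite ≤ᵇ-true lt = ≤-trans (m⊓n≤m (cnt (suc i)) K)
      (+-monoˡ-≤ (weightAt i) (≤-trans (≤-reflexive (sym (m≤n⇒m⊓n≡m (<⇒≤ lt)))) (go i)))
    ... | no  ge rewrite ≤ᵇ-false ge = ≤-trans (m⊓n≤n (cnt (suc i)) K)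
      (≤-trans (≤-reflexive (sym (m≥n⇒m⊓n≡n (≮⇒≥ ge)))) (≤-trans (go i) (m≤m+n _ 0)))

-- Numbers in base b, least significant digit first

val : ℕ → ℕ → (ℕ → ℕ) → ℕ
val b k c = ∑< (λ i → c i * b ^ i) k

val< : ∀ b k {c} → (∀ i → i < k → c i < b) → val b k c < b ^ k
val< b zero    h = s≤s z≤n
val< b (suc k) {c} h = begin-strict
  val b k c + c k * b ^ k <⟨ +-monoˡ-< (c k * b ^ k) (val< b k (λ i i<k → h i (m≤n⇒m≤1+n i<k))) ⟩
  b ^ k + c k * b ^ k     ≤⟨ *-monoˡ-≤ (b ^ k) (h k ≤-refl) ⟩
  b * b ^ k ∎
  where open ≤-Reasoning

-- The top digit is determined first: a smaller one cannot be made up for, because the lower digits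
-- are worth less than `b ^ k`.
val-injective : ∀ b k {c c′} → (∀ i → i < k → c i < b) → (∀ i → i < k → c′ i < b) →
  val b k c ≡ val b k c′ → ∀ i → i < k → c i ≡ c′ i
val-injective b (suc k) {c} {c′} h h′ eq = go
  where
  low : ∀ {c} → (∀ i → i < suc k → c i < b) → val b k c < b ^ k
  low h = val< b k (λ i i<k → h i (m≤n⇒m≤1+n i<k))
  separated : ∀ {c c′} → (∀ i → i < suc k → c i < b) → c k < c′ k → val b (suc k) c < val b (suc k) c′
  separated {c} {c′} h lt = begin-strict
    val b k c + c k * b ^ k   <⟨ +-monoˡ-< (c k * b ^ k) (low {c} h) ⟩
    b ^ k + c k * b ^ k       ≤⟨ *-monoˡ-≤ (b ^ k) lt ⟩
    c′ k * b ^ k              ≤⟨ m≤n+m _ (val b k c′) ⟩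
    val b k c′ + c′ k * b ^ k ∎
    where open ≤-Reasoning
  top : c k ≡ c′ k
  top with <-cmp (c k) (c′ k)
  ... | tri< lt _ _ = contradiction eq (<⇒≢ (separated {c} {c′} h lt))
  ... | tri≈ _ e _  = e
  ... | tri> _ _ gt = contradiction (sym eq) (<⇒≢ (separated {c′} {c} h′ gt))
  rest : val b k c ≡ val b k c′
  rest = +-cancelʳ-≡ (c k * b ^ k) _ _ (trans eq (cong (λ z → val b k c′ + z * b ^ k) (sym top)))
  go : ∀ i → i < suc k → c i ≡ c′ i
  go i i≤k with m≤n⇒m<n∨m≡n (s≤s⁻¹ i≤k)
  ... | inj₂ refl = top
  ... | inj₁ i<k  = val-injective b k {c} {c′} (λ i i<k → h i (m≤n⇒m≤1+n i<k)) (λ i i<k → h′ i (m≤n⇒m≤1+n i<k)) rest i i<k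

val-zero : ∀ b k {c} → 1 ≤ b → val b k c ≡ 0 → ∀ i → i < k → c i ≡ 0
val-zero b (suc k) {c} 1≤b eq i i≤k with m≤n⇒m<n∨m≡n (s≤s⁻¹ i≤k)
... | inj₁ i<k  = val-zero b k {c} 1≤b (m+n≡0⇒m≡0 (val b k c) eq) i i<k
... | inj₂ refl = m*n≡0⇒m≡0 (c k) (b ^ k) {{>-nonZero (m^n>0 b {{>-nonZero 1≤b}} k)}} (m+n≡0⇒n≡0 (val b k c) eq)

zero-val : ∀ b k {c} → (∀ i → i < k → c i ≡ 0) → val b k c ≡ 0
zero-val b k {c} h = trans (∑<-cong {λ i → c i * b ^ i} {λ _ → 0} k (λ i i<k → cong (_* b ^ i) (h i i<k))) (go k)
  where
  go : ∀ k → ∑< (λ _ → 0) k ≡ 0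
  go zero    = refl
  go (suc k) = trans (+-identityʳ _) (go k)

module Increment (b : ℕ) (c : ℕ → ℕ) where

  carry : ℕ → ℕ
  carry zero    = 1
  carry (suc i) = if b ≤ᵇ c i + carry i then 1 else 0

  digit : ℕ → ℕ
  digit i = if b ≤ᵇ c i + carry i then 0 else c i + carry i

  carry≤1 : ∀ i → carry i ≤ 1
  carry≤1 zero    = ≤-refl
  carry≤1 (suc i) with b ≤ᵇ c i + carry i
  ... | true  = ≤-refl
  ... | false = z≤n

  digit< : 1 ≤ b → ∀ i → digit i < b
  digit< 1≤b i with b ≤? c i + carry i
  ... | yes le rewrite ≤ᵇ-true le = 1≤b
  ... | no  gt rewrite ≤ᵇ-false gt = ≰⇒> gt

  increment : ∀ k → (∀ i → i < k → c i < b) → val b k digit + carry k * b ^ k ≡ suc (val b k c)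
  increment zero    h = refl
  increment (suc k) h = begin
    val b k digit + digit k * b ^ k + carry (suc k) * b ^ suc k
      ≡⟨ +-assoc (val b k digit) _ _ ⟩
    val b k digit + (digit k * b ^ k + carry (suc k) * b ^ suc k)
      ≡⟨ cong (val b k digit +_) split ⟩
    val b k digit + (c k + carry k) * b ^ k
      ≡⟨ shuffle (val b k digit) (c k) (carry k) (b ^ k) ⟩
    (val b k digit + carry k * b ^ k) + c k * b ^ k
      ≡⟨ cong (_+ c k * b ^ k) (increment k (λ i i<k → h i (m≤n⇒m≤1+n i<k))) ⟩
    suc (val b k c) + c k * b ^ k ∎
    where
    open ≡-Reasoning
    shuffle : ∀ v x y z → v + (x + y) * z ≡ (v + y * z) + x * z
    shuffle = solve-∀
    split : digit k * b ^ k + carry (suc k) * b ^ suc k ≡ (c k + carry k) * b ^ k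
    split with b ≤? c k + carry k
    ... | no  gt rewrite ≤ᵇ-false gt = +-identityʳ _
    -- Here `c k + carry k` is exactly `b`, because `c k` is below `b` and a carry is at most 1.
    ... | yes le rewrite ≤ᵇ-true le = trans (+-identityʳ (b * b ^ k)) (cong (_* b ^ k) (≤-antisym le
      (≤-trans (+-monoʳ-≤ (c k) (carry≤1 k)) (≤-trans (≤-reflexive (+-comm (c k) 1)) (h k ≤-refl)))))

bit-∸ : ∀ a b → bit a ∸ bit b ≡ bit (a ∧ not b)
bit-∸ true  true  = refl
bit-∸ true  false = refl
bit-∸ false true  = refl
bit-∸ false false = refl

if-bit-∨ : ∀ a b → (if a then 1 else bit b) ≡ bit (b ∨ a)
if-bit-∨ true  true  = refl
if-bit-∨ true  false = refl
if-bit-∨ false true  = refl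
if-bit-∨ false false = refl

-- Composing with this pins the intermediate memory to `Runs.end r`. The number of rounds of the
-- search depends on that memory and has to be known before the budget is fixed.
exactly : ∀ {p σ X Q} (r : Runs p σ X Q) → Runs p σ X (_≡ Runs.end r)
exactly (runs s ρ r s≤ _) = runs s ρ r s≤ refl

-- Correctness and cost of the program

module Algorithm (I : Instance) (spsp apsp₂ : Cmd) (SPSP APSP₂ : ℕ → ℕ → ℕ)
  (solves-spsp : SolvesSPSP spsp SPSP) (solves : SolvesAPSP₂ apsp₂ APSP₂) where

  open Spanners I
  open Input I
  open Phases I
  open Program spsp apsp₂

  first second : Subset m → Fin n → Fin n → ℕ
  first  R = proj₁ (solves (surcharge G R))
  second R = proj₁ (proj₂ (solves (surcharge G R)))

  codes : ∀ R u v → TwoShortestCode (surcharge G R) u v (first R u v) (second R u v)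
  codes R = proj₁ (proj₂ (proj₂ (solves (surcharge G R))))

  outputs : ∀ R → Outputs apsp₂ (encodeNetwork (surcharge G R)) (pairTable (surcharge G R) (first R) (second R)) (APSP₂ n m)
  outputs R = proj₂ (proj₂ (proj₂ (solves (surcharge G R))))

  d : Fin m → ℕ
  d e = first ∅ (src e) (tgt e) ∸ 1

  abstract
    d-dist : ∀ e → Dist ⊤ (src e) (tgt e) (d e)
    d-dist e = Surcharge.shortest-dist G ∅ (λ f → false⇒∉ (lookup-replicate f false)) (single e)
      (Surcharge.two⇒shortest G ∅ (codes ∅ (src e) (tgt e)))

  open Distances d d-dist

  M : ℕ
  M = suc (∑ ℓ)

  ok : ℕ → ℕ → Bool
  ok dist o = okayᵇ M p q dist o

  -- Given by the very comparisons that the program makes, so that they match the flags in memory;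
  -- what they mean for the graph is proved separately and collected in `classes`.
  isD isT : Fin m → Bool
  D TN : Subset m
  isD e = not (ℓ e * q ≤ᵇ p * d e)
  D = Vec.tabulate isD
  isT e = lookup D e ∨ (not (w e ≤ᵇ 0) ∧ ok (d e) (second D (src e) (tgt e)))
  TN = Vec.tabulate isT

  abstract
    lookup-D : ∀ e → lookup D e ≡ isD e
    lookup-D e = lookup∘tabulate isD e

    lookup-TN : ∀ e → lookup TN e ≡ isT e
    lookup-TN e = lookup∘tabulate isT e

    D⇐ : ∀ {e} → lookup D e ≡ false → Settles e
    D⇐ {e} h = not-≤ᵇ⇐ (ℓ e * q) (p * d e) (trans (sym (lookup-D e)) h)

    D⇒ : ∀ {e} → lookup D e ≡ true → ¬ Settles e
    D⇒ {e} h = not-≤ᵇ⇒ (ℓ e * q) (p * d e) (trans (sym (lookup-D e)) h)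

    D⊆TN : ∀ {e} → lookup D e ≡ true → lookup TN e ≡ true
    D⊆TN {e} h = trans (lookup-TN e) (cong (_∨ (not (w e ≤ᵇ 0) ∧ ok (d e) (second D (src e) (tgt e)))) h)

    N⇒ : ∀ {e} → lookup TN e ≡ true → lookup D e ≡ false → 1 ≤ w e × Detour e
    N⇒ {e} t f =
      let heavy , okay₂ = ∧⇒ (not (w e ≤ᵇ 0)) (ok (d e) (second D (src e) (tgt e))) (∨-split (lookup D e) (not (w e ≤ᵇ 0) ∧ ok (d e) (second D (src e) (tgt e))) (trans (sym (lookup-TN e)) t) f)
          P , P∈ , e∉ , le = Surcharge.second-sound G D {p} {q} {d e} (codes D (src e) (tgt e)) (okayᵇ⇒ M p q (d e) (second D (src e) (tgt e)) okay₂)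
      in ≰⇒> (not-≤ᵇ⇒ (w e) 0 heavy) , P , All.map (D⇐ ∘ ∉⇒false) P∈ , e∉ , le

    N⇐ : ∀ {e} → lookup TN e ≡ false → 1 ≤ w e → ¬ Detour e
    N⇐ {e} t 1≤w (P , settles , e∉ , le) =
      let e∉D = ∨-falseˡ (trans (sym (lookup-TN e)) t)
      in ∨-∧-miss (lookup D e) (not (w e ≤ᵇ 0)) (ok (d e) (second D (src e) (tgt e))) (trans (sym (lookup-TN e)) t)
           (cong not (≤ᵇ-false (<⇒≱ 1≤w)))
           (okayᵇ⇐ M p q (d e) (second D (src e) (tgt e)) (Surcharge.second-complete G D {p} {q} {d e} (codes D (src e) (tgt e)) e∉D
             (D⇐ e∉D) P (All.map (λ {f} s → false⇒∉ (trans (lookup-D f) (cong not (≤ᵇ-true s)))) settles) e∉ le))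

  classes : Classes
  classes = record { D = D ; TN = TN ; D⇒ = D⇒ ; D⇐ = D⇐ ; D⊆TN = D⊆TN ; N⇒ = N⇒ ; N⇐ = N⇐ }

  record Ready (σ : Memory) : Set where
    field
      input : HasInput σ
      big   : σ LL 0 ≡ M
      row   : ∀ i → i ≤ n → σ ROW i ≡ i * (n + n)
  open Ready

  ready-frame : ∀ {p σ ρ} → writes p 0 ≡ false → writes p LL ≡ false → writes p ROW ≡ false →
    Frame p σ ρ → Ready σ → Ready ρ
  ready-frame h₀ h₁ h₂ fr rd = record
    { input = λ j → trans (fr 0 h₀ j) (input rd j)
    ; big   = trans (fr LL h₁ 0) (big rd)
    ; row   = λ i i≤n → trans (fr ROW h₂ i) (row rd i i≤n)
    }

  ready-at : ∀ {σ} y → Ready σ → Ready (at σ y)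
  ready-at y rd = record { input = input rd ; big = big rd ; row = row rd }

  index : Fin n → Fin n → ℕ
  index u v = toℕ u * (n + n) + toℕ v + toℕ v

  eval-entry : ∀ {σ} → Ready σ → ∀ x e → eval σ x ≡ toℕ e → eval σ (entry x) ≡ index (src e) (tgt e)
  eval-entry {σ} rd x e x≡ = cong₂ _+_ (cong₂ _+_
    (trans (cong (σ ROW) (trans (eval-src (input rd) {x} x≡) (inp-src e))) (row rd _ (<⇒≤ (toℕ<n (src e))))) tgt≡) tgt≡
    where
    tgt≡ : eval σ (tgtE x) ≡ toℕ (tgt e)
    tgt≡ = trans (eval-tgt (input rd) {x} x≡) (inp-tgt e)

  value-okay : ∀ {σ} → HasInput σ → σ LL 0 ≡ M → ∀ o x s t →
    value σ (okay o x s t) ≡ (if ok (σ DIST (eval σ x)) (eval σ o) then value σ s else value σ t)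
  value-okay {σ} input big o x s t
    rewrite +-identityʳ (eval σ o) | +-identityʳ (σ LL 0) | big | input 0 | input 1 =
    nested-if (1 ≤ᵇ eval σ o) (eval σ o ≤ᵇ M) ((eval σ o ∸ 1) * q ≤ᵇ p * σ DIST (eval σ x))

  A X : ℕ
  A = APSP₂ n m
  X = suc A

  -- Reading the network and writing the table are part of the running time, so `A` pays for every
  -- loop over the edges or the nodes.
  apsp-size : 2 + (m + m) + m + n * (n + n) ≤ A
  apsp-size = let s , _ , _ , _ , le = outputs ∅ in
    ≤-trans (+-mono-≤ (≤-trans (≤-reflexive (sym (length-network ∅))) (m≤m+n _ s))
                      (≤-reflexive (sym (PairTable.length-pairTable (surcharge G ∅) (first ∅) (second ∅))))) le

  m≤A : m ≤ A
  m≤A = ≤-trans (m≤n+m m (2 + (m + m))) (≤-trans (m≤m+n _ (n * (n + n))) apsp-size)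

  edges≤X : suc (m * 1) ≤ X
  edges≤X = s≤s (≤-trans (≤-reflexive (*-identityʳ m)) m≤A)

  nodes≤X : suc (n * 1) ≤ X
  nodes≤X = s≤s (≤-trans (≤-reflexive (*-identityʳ n)) (≤-trans (square n) (≤-trans (m≤n+m _ (2 + (m + m) + m)) apsp-size)))
    where
    square : ∀ k → k ≤ k * (k + k)
    square zero    = z≤n
    square (suc k) = m≤m*n (suc k) (suc k + suc k)

  head≤X : suc ((2 + (m + m)) * 1) ≤ X
  head≤X = s≤s (≤-trans (≤-reflexive (*-identityʳ (2 + (m + m)))) (≤-trans (m≤m+n _ m) (≤-trans (m≤m+n _ (n * (n + n))) apsp-size)))

  Heads₂ Heads₄ : Memory → Set
  Heads₂ σ = ∀ i → i < 2 + (m + m) → σ G2 i ≡ inp (3 + i)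
  Heads₄ σ = ∀ i → i < 2 + (m + m) → σ G4 (2 + i) ≡ inp (3 + i)

  runs-setup : ∀ {σ} → HasInput σ → σ ROW 0 ≡ 0 →
    Runs setup σ X (λ ρ → Ready ρ × Heads₂ ρ × Heads₄ ρ)
  runs-setup {σ} inp₀ row₀ =
    runs-seq (framed (runs-slower edges≤X (runs-sumLengths inp₀))) λ ρ₁ (f₁ , big₁) →
    let inp₁ = λ j → trans (f₁ 0 refl j) (inp₀ j) in
    runs-seq (framed (runs-slower head≤X (runs-copyHead₂ inp₁))) λ ρ₂ (f₂ , heads₂) →
    let inp₂ = λ j → trans (f₂ 0 refl j) (inp₁ j) in
    runs-seq (framed (runs-slower head≤X (runs-copyHead₄ inp₂))) λ ρ₃ (f₃ , heads₄) →
    let inp₃ = λ j → trans (f₃ 0 refl j) (inp₂ j) in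
    runs-weaken ≤-refl (λ ρ₄ (f₄ , row₄) → record
      { input = λ j → trans (f₄ 0 refl j) (inp₃ j)
      ; big   = trans (f₄ LL refl 0) (trans (f₃ LL refl 0) (trans (f₂ LL refl 0) big₁))
      ; row   = row₄ } ,
      (λ i i< → trans (f₄ G2 refl i) (trans (f₃ G2 refl i) (heads₂ i i<))) ,
      (λ i i< → trans (f₄ G4 refl (2 + i)) (heads₄ i i<)))
      (framed (runs-slower nodes≤X (runs-rows inp₃ (trans (f₃ ROW refl 0) (trans (f₂ ROW refl 0) (trans (f₁ ROW refl 0) row₀))))))

  Flags : ℕ → Subset m → Memory → Set
  Flags f R σ = ∀ e → σ f (toℕ e) ≡ bit (lookup R e)

  Table : Subset m → Memory → Set
  Table R σ = ∀ u v → σ TAB (index u v) ≡ first R u v × σ TAB (index u v + 1) ≡ second R u v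

  runs-measure : ∀ f {σ} R → (G2 ≡ᵇ f) ≡ false → (ctr ≡ᵇ f) ≡ false → Ready σ → Heads₂ σ → Flags f R σ →
    Runs (measure f) σ X (λ ρ → Table R ρ × Heads₂ ρ)
  runs-measure f {σ} R G2≢f ctr≢f rd heads flags =
    runs-seq (framed (runs-slower edges≤X
      (runs-setLengths f G2 2 {σ} {R} refl refl refl G2≢f ctr≢f (input rd) (big rd) flags)))
    λ ρ (fr , lens , old) →
      let rd′ = ready-frame {setLengths f G2 2} refl refl refl fr rd
          heads′ : Heads₂ ρ
          heads′ = λ i i< → trans (old i i<) (heads i i<)
      in runs-weaken (n≤1+n A) (λ υ (fr′ , table) →
           (λ u v → table′ u v (table (index u v) (in-table u v)) (table (index u v + 1) (in-table′ u v))) ,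
           (λ i i< → trans (fr′ G2 refl i) (heads′ i i<)))
         (framed (runs-call (outputs R) (≤-trans (s≤s z≤n) apsp-size)
           (trans (cong (λ k → 2 + (k + k) + k) (input rd′ 4)) (sym (length-network R)))
           (λ i i< → network-cells R (ρ G2) heads′ lens i (subst (i <_) (length-network R) i<))
           (trans (cong (ρ ROW) (input rd′ 3)) (trans (row rd′ n ≤-refl) (sym len)))))
    where
    open PairTable (surcharge G R) (first R) (second R) using (length-pairTable; nth-first; nth-second; index<)
    len = length-pairTable
    in-table : ∀ u v → index u v < length (pairTable (surcharge G R) (first R) (second R))
    in-table u v = subst₂ _<_ (+-identityʳ (index u v)) (sym len) (index< u v (s≤s z≤n))
    in-table′ : ∀ u v → index u v + 1 < length (pairTable (surcharge G R) (first R) (second R))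
    in-table′ u v = subst (index u v + 1 <_) (sym len) (index< u v (s≤s (s≤s z≤n)))
    table′ : ∀ u v {x y} → x ≡ _ → y ≡ _ → x ≡ first R u v × y ≡ second R u v
    table′ u v h h′ = trans h (nth-first u v) , trans h′ (nth-second u v)

  Dists : Memory → Set
  Dists σ = ∀ e → σ DIST (toℕ e) ≡ d e

  runs-dists : ∀ {σ} → Ready σ → Table ∅ σ → Runs dists σ (suc (m * 1)) Dists
  runs-dists {σ} rd table = runs-weaken ≤-refl
    (λ ρ (h , _) e → trans (h (toℕ e) (toℕ<n e))
      (cong (_∸ 1) (trans (cong (σ TAB) (eval-entry (ready-at (toℕ e) rd) idx e refl)) (proj₁ (table (src e) (tgt e))))))
    (runs-fill DIST m 0 refl (λ _ _ → input rd 4) (λ _ _ → refl) (λ _ → refl))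

  runs-flagsD : ∀ {σ} → Ready σ → Dists σ → Runs flagsD σ (suc (m * 1)) (Flags DF D)
  runs-flagsD {σ} rd dist = runs-weaken ≤-refl
    (λ ρ (h , _) e → trans (h (toℕ e) (toℕ<n e)) (flag e))
    (runs-fill DF m 0 refl (λ _ _ → input rd 4) (λ _ _ → refl) (λ _ → refl))
    where
    flag : ∀ e → value (at σ (toℕ e)) (cond (lenE idx · q̂ ≤ p̂ · (DIST ⟦ idx ⟧)) (ret (lit 0)) (ret (lit 1))) ≡ bit (lookup D e)
    flag e rewrite eval-len {at σ (toℕ e)} (input rd) {idx} refl | inp-len e | input rd 0 | input rd 1 | dist e =
      trans (if-not-bit (ℓ e * q ≤ᵇ p * d e)) (cong bit (sym (lookup-D e)))

  runs-flagsTN : ∀ {σ} → Ready σ → Dists σ → Flags DF D σ → Table D σ → Runs flagsTN σ (suc (m * 1)) (Flags TF TN)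
  runs-flagsTN {σ} rd dist flags table = runs-weaken ≤-refl
    (λ ρ (h , _) e → trans (h (toℕ e) (toℕ<n e)) (flag e))
    (runs-fill TF m 0 refl (λ _ _ → input rd 4) (λ _ _ → refl) (λ _ → refl))
    where
    o₂ = TAB ⟦ entry idx ⊕ lit 1 ⟧
    tree : ∀ a b c → (if a then 1 else (if b then 0 else (if c then 1 else 0))) ≡ bit (a ∨ (not b ∧ c))
    tree true  _     _ = refl
    tree false true  _ = refl
    tree false false _ = refl
    o₂≡ : ∀ e → eval (at σ (toℕ e)) o₂ ≡ second D (src e) (tgt e)
    o₂≡ e = trans (cong (λ i → σ TAB (i + 1)) (eval-entry (ready-at (toℕ e) rd) idx e refl)) (proj₂ (table (src e) (tgt e)))
    wt≡ : ∀ e → eval (at σ (toℕ e)) (wtE idx) ≡ w e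
    wt≡ e = trans (eval-wt {at σ (toℕ e)} (input rd) {idx} refl) (inp-wt e)
    flag : ∀ e → value (at σ (toℕ e)) (cond (flagged DF idx) (ret (lit 1))
             (cond (lit 1 · wtE idx ≤ lit 1 · lit 0) (ret (lit 0)) (okay o₂ idx (ret (lit 1)) (ret (lit 0)))))
           ≡ bit (lookup TN e)
    flag e = trans (cong₂ (λ b v → if b then 1 else v)
        (trans (cong (λ z → 1 ≤ᵇ z + 0) (flags e)) (bit-test (lookup D e)))
        (cong₂ (λ b v → if b then 0 else v)
          (cong (_≤ᵇ 0) (trans (+-identityʳ _) (wt≡ e)))
          (trans (value-okay {at σ (toℕ e)} (input rd) (big rd) o₂ idx (ret (lit 1)) (ret (lit 0)))
            (cong₂ (λ a b → if ok a b then 1 else 0) (dist e) (o₂≡ e)))))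
      (trans (tree (lookup D e) (w e ≤ᵇ 0) (ok (d e) (second D (src e) (tgt e)))) (cong bit (sym (lookup-TN e))))

  runs-total : ∀ {σ R} → Ready σ → Flags SF R σ → Runs total σ (suc (m * 1)) (λ ρ → ρ TOT 0 ≡ removedWeight R)
  runs-total {σ} {R} rd flags = runs-seq (runs-assign (ret (lit 0)) {λ ρ → ρ ≡ write σ TOT 0 0} (s≤s z≤n) refl)
    λ { _ refl → runs-weaken ≤-refl (λ ρ h → trans h (∑<-∑ wt _ wt≡))
    (runs-fold TOT m (∑< wt) refl (λ _ _ → input rd 4) refl next) }
    where
    wt : ℕ → ℕ
    wt i = if 1 ≤ᵇ σ SF i + 0 then inp (5 + m + m + m + i) else 0
    wt≡ : ∀ e → wt (toℕ e) ≡ (if lookup R e then w e else 0)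
    wt≡ e = cong₂ (λ b v → if b then v else 0)
      (trans (cong (λ z → 1 ≤ᵇ z + 0) (flags e)) (bit-test (lookup R e))) (inp-wt e)
    next : ∀ (e : Fin m) g → g 0 ≡ ∑< wt (toℕ e) →
      value (overlay TOT g (at (write σ TOT 0 0) (toℕ e))) (cond (flagged SF idx) (ret (cell TOT ⊕ wtE idx)) (ret (cell TOT)))
      ≡ ∑< wt (suc (toℕ e))
    next e g g0 = trans (cong₂ (λ z v → if 1 ≤ᵇ σ SF (toℕ e) + 0 then z + v else z) g0
        (eval-wt {overlay TOT g (at (write σ TOT 0 0) (toℕ e))} (input rd) {idx} refl))
      (if-+ (1 ≤ᵇ σ SF (toℕ e) + 0) _ _)

  Verdict : Memory → Set
  Verdict ρ = (ρ CRIT 0 ≡ 0 × ∀ e → Settles e → Good (∁ TN) e) ⊎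
              (ρ CRIT 0 ≡ 1 × ∃ λ e → Settles e × ¬ Good (∁ TN) e)

  runs-critical : ∀ {σ} → Ready σ → Dists σ → Flags DF D σ → Table TN σ → σ CRIT 0 ≡ 0 →
    Runs critical σ (suc (m * 1)) Verdict
  runs-critical {σ} rd dist flags table crit₀ = runs-weaken ≤-refl verdict
    (runs-fold CRIT m (alarm fine) refl (λ _ _ → input rd 4) crit₀ next)
    where
    o₁ = TAB ⟦ entry idx ⟧
    fine : ℕ → Bool
    fine i = (1 ≤ᵇ σ DF i + 0) ∨ ok (σ DIST i) (σ TAB (eval (at σ i) (entry idx)))
    next : ∀ (e : Fin m) g → g 0 ≡ alarm fine (toℕ e) →
      value (overlay CRIT g (at σ (toℕ e))) (cond (flagged DF idx) (ret (cell CRIT)) (okay o₁ idx (ret (cell CRIT)) (ret (lit 1))))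
      ≡ alarm fine (suc (toℕ e))
    next e g g0 = trans (cong (λ v → if 1 ≤ᵇ σ DF (toℕ e) + 0 then g 0 else v)
        (value-okay {overlay CRIT g (at σ (toℕ e))} (input rd) (big rd) o₁ idx (ret (cell CRIT)) (ret (lit 1))))
      (trans (if-∨ (1 ≤ᵇ σ DF (toℕ e) + 0) _) (cong (λ v → if fine (toℕ e) then v else 1) g0))
    fine≡ : ∀ e → fine (toℕ e) ≡ lookup D e ∨ ok (d e) (first TN (src e) (tgt e))
    fine≡ e = cong₂ _∨_ (trans (cong (λ z → 1 ≤ᵇ z + 0) (flags e)) (bit-test (lookup D e)))
      (cong₂ ok (dist e) (trans (cong (σ TAB) (eval-entry (ready-at (toℕ e) rd) idx e refl)) (proj₁ (table (src e) (tgt e)))))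
    shortest : ∀ e → ShortestCode (surcharge G TN) (src e) (tgt e) (first TN (src e) (tgt e))
    shortest e = Surcharge.two⇒shortest G TN (codes TN (src e) (tgt e))
    verdict : ∀ ρ → ρ CRIT 0 ≡ alarm fine m → Verdict ρ
    verdict ρ eq = case alarm-cases fine m of λ where
      (inj₁ (zero≡ , all)) → inj₁ (trans eq zero≡ , λ e s →
        Surcharge.shortest-sound G TN {p} {q} {d e} (shortest e)
          (okayᵇ⇒ M p q (d e) (first TN (src e) (tgt e))
            (∨-split (lookup D e) _ (trans (sym (fine≡ e)) (all (toℕ e) (toℕ<n e)))
              (trans (lookup-D e) (cong not (≤ᵇ-true s))))))
      (inj₂ (one≡ , i , i<m , bad)) → inj₂ (trans eq one≡ ,
        let e = fromℕ< i<m
            missed = trans (sym (fine≡ e)) (trans (cong fine (toℕ-fromℕ< i<m)) bad)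
        in e , D⇐ (∨-falseˡ missed) , λ (P , P∈ , le) →
          case trans (sym (∨-falseʳ {lookup D e} missed))
            (okayᵇ⇐ M p q (d e) (first TN (src e) (tgt e))
              (Surcharge.shortest-complete G TN {p} {q} {d e} (shortest e) P P∈ le)) of λ ())

  record Sorted (σ : Memory) : Set where
    field
      ready   : Ready σ
      dist    : Dists σ
      flags-D : Flags DF D σ
      flags-T : Flags TF TN σ
  open Sorted

  sorted-frame : ∀ {p σ ρ} → writes p 0 ≡ false → writes p LL ≡ false → writes p ROW ≡ false →
    writes p DIST ≡ false → writes p DF ≡ false → writes p TF ≡ false → Frame p σ ρ → Sorted σ → Sorted ρ
  sorted-frame {p} h₀ h₁ h₂ h₃ h₄ h₅ fr st = record
    { ready   = ready-frame {p} h₀ h₁ h₂ fr (ready st)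
    ; dist    = λ e → trans (fr DIST h₃ (toℕ e)) (dist st e)
    ; flags-D = λ e → trans (fr DF h₄ (toℕ e)) (flags-D st e)
    ; flags-T = λ e → trans (fr TF h₅ (toℕ e)) (flags-T st e)
    }

  runs-copySF : ∀ {σ} → Sorted σ → Runs copySF σ (suc (m * 1)) (Flags SF TN)
  runs-copySF {σ} st = runs-weaken ≤-refl (λ ρ (h , _) e → trans (h (toℕ e) (toℕ<n e)) (flags-T st e))
    (runs-fill SF m 0 refl (λ _ _ → input (ready st) 4) (λ _ _ → refl) (λ _ → refl))

  runs-heavy : ∀ {σ R Y} → 1 ≤ Y → HasInput σ → σ TOT 0 ≡ removedWeight R →
    Runs heavy σ Y (λ ρ → ρ OK 0 ≡ bit (W̄ ≤ᵇ removedWeight R))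
  runs-heavy {σ} {R} 1≤Y inp₀ tot = runs-assign
    (cond (lit 1 · Ŵ ≤ lit 1 · cell TOT) (ret (lit 1)) (ret (lit 0))) 1≤Y
    (cong bit (cong₂ _≤ᵇ_ (trans (+-identityʳ (σ 0 2)) (inp₀ 2)) (trans (+-identityʳ (σ TOT 0)) tot)))

  Classified-TN : Memory → Set
  Classified-TN ρ = Sorted ρ × Flags SF TN ρ × ρ OK 0 ≡ bit (W̄ ≤ᵇ removedWeight TN) × Verdict ρ

  runs-classify : ∀ {σ} → Ready σ → Heads₂ σ → (∀ j → σ ZERO j ≡ 0) → σ CRIT 0 ≡ 0 →
    Runs classify σ X Classified-TN
  runs-classify {σ} rd₀ heads₀ zeros crit₀ =
    runs-seq (framed (runs-measure ZERO ∅ refl refl rd₀ heads₀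
      (λ e → trans (zeros (toℕ e)) (cong bit (sym (lookup-replicate e false)))))) λ ρ₁ (f₁ , table₁ , heads₁) →
    let rd₁ = ready-frame {measure ZERO} refl refl refl f₁ rd₀ in
    runs-seq (framed (runs-slower edges≤X (runs-dists rd₁ table₁))) λ ρ₂ (f₂ , dist₂) →
    let rd₂ = ready-frame {dists} refl refl refl f₂ rd₁ in
    runs-seq (framed (runs-slower edges≤X (runs-flagsD rd₂ dist₂))) λ ρ₃ (f₃ , D₃) →
    let rd₃ = ready-frame {flagsD} refl refl refl f₃ rd₂
        dist₃ = λ e → trans (f₃ DIST refl (toℕ e)) (dist₂ e)
        heads₃ = λ i i< → trans (f₃ G2 refl i) (trans (f₂ G2 refl i) (heads₁ i i<)) in
    runs-seq (framed (runs-measure DF D refl refl rd₃ heads₃ D₃)) λ ρ₄ (f₄ , table₄ , heads₄) →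
    let rd₄ = ready-frame {measure DF} refl refl refl f₄ rd₃
        dist₄ = λ e → trans (f₄ DIST refl (toℕ e)) (dist₃ e)
        D₄ = λ e → trans (f₄ DF refl (toℕ e)) (D₃ e) in
    runs-seq (framed (runs-slower edges≤X (runs-flagsTN rd₄ dist₄ D₄ table₄))) λ ρ₅ (f₅ , T₅) →
    let st₅ = record { ready = ready-frame {flagsTN} refl refl refl f₅ rd₄
                     ; dist = λ e → trans (f₅ DIST refl (toℕ e)) (dist₄ e)
                     ; flags-D = λ e → trans (f₅ DF refl (toℕ e)) (D₄ e)
                     ; flags-T = T₅ }
        heads₅ = λ i i< → trans (f₅ G2 refl i) (heads₄ i i<) in
    runs-seq (framed (runs-measure TF TN refl refl (ready st₅) heads₅ T₅)) λ ρ₆ (f₆ , table₆ , _) →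
    let st₆ = sorted-frame {measure TF} refl refl refl refl refl refl f₆ st₅ in
    runs-seq (framed (runs-slower edges≤X (runs-copySF st₆))) λ ρ₇ (f₇ , S₇) →
    let st₇ = sorted-frame {copySF} refl refl refl refl refl refl f₇ st₆ in
    runs-seq (framed (runs-slower edges≤X (runs-total {R = TN} (ready st₇) S₇))) λ ρ₈ (f₈ , tot₈) →
    let st₈ = sorted-frame {total} refl refl refl refl refl refl f₈ st₇
        table₈ = λ u v → let t₁ , t₂ = table₆ u v in
          trans (f₈ TAB refl _) (trans (f₇ TAB refl _) t₁) , trans (f₈ TAB refl _) (trans (f₇ TAB refl _) t₂)
        crit₈ = trans (f₈ CRIT refl 0) (trans (f₇ CRIT refl 0) (trans (f₆ CRIT refl 0) (trans (f₅ CRIT refl 0)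
          (trans (f₄ CRIT refl 0) (trans (f₃ CRIT refl 0) (trans (f₂ CRIT refl 0) (trans (f₁ CRIT refl 0) crit₀))))))) in
    runs-seq (framed (runs-slower edges≤X (runs-critical (ready st₈) (dist st₈) (flags-D st₈) table₈ crit₈))) λ ρ₉ (f₉ , verdict) →
    let st₉ = sorted-frame {critical} refl refl refl refl refl refl f₉ st₈ in
    runs-weaken ≤-refl (λ ρ (fr , okay′) →
        sorted-frame {heavy} refl refl refl refl refl refl fr st₉ ,
        (λ e → trans (fr SF refl (toℕ e)) (trans (f₉ SF refl (toℕ e)) (trans (f₈ SF refl (toℕ e)) (S₇ e)))) ,
        okay′ ,
        move {ρ₉} {ρ} (fr CRIT refl 0) verdict)
      (framed (runs-heavy {R = TN} (s≤s z≤n) (input (ready st₉)) (trans (f₉ TOT refl 0) tot₈)))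
    where
    move : ∀ {ρ υ : Memory} → υ CRIT 0 ≡ ρ CRIT 0 → Verdict ρ → Verdict υ
    move eq (inj₁ (z , h)) = inj₁ (trans eq z , h)
    move eq (inj₂ (o , h)) = inj₂ (trans eq o , h)

  open Classified classes
  open Tightness I d d-dist classes using (isN)
  open Listing isN

  Y : ℕ
  Y = SPSP n m

  -- The edge provides a pair of nodes to query, without which `SolvesSPSP` says nothing about `Y`.
  -- The search only starts when some edge fails, so one is at hand.
  spsp-size : Fin m → suc m ≤ Y
  spsp-size e =
    let o , _ , s , ρ , run , _ , le = solves-spsp (surcharge G ∅) (src e) (tgt e)
    in ≤-trans (≤-trans (≤-trans (s≤s (m≤n+m m (2 + (m + m)))) (≤-trans (n≤1+n _)
         (≤-reflexive (cong (2 +_) (sym (length-network ∅)))))) (≤-trans (m≤m+n _ s) (m≤m+n _ 1))) le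

  record Listed (σ : Memory) : Set where
    field
      sorted  : Sorted σ
      counted : ∀ i → i ≤ m → σ CNT i ≡ cnt i
      listed  : ∀ j → σ NT j ≡ nt j
  open Listed

  listed-frame : ∀ {p σ ρ} → writes p 0 ≡ false → writes p LL ≡ false → writes p ROW ≡ false →
    writes p DIST ≡ false → writes p DF ≡ false → writes p TF ≡ false → writes p CNT ≡ false → writes p NT ≡ false →
    Frame p σ ρ → Listed σ → Listed ρ
  listed-frame {p} h₀ h₁ h₂ h₃ h₄ h₅ h₆ h₇ fr ls = record
    { sorted  = sorted-frame {p} h₀ h₁ h₂ h₃ h₄ h₅ fr (sorted ls)
    ; counted = λ i i≤m → trans (fr CNT h₆ i) (counted ls i i≤m)
    ; listed  = λ j → trans (fr NT h₇ j) (listed ls j)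
    }

  runs-listN : ∀ {σ} → Sorted σ → σ CNT 0 ≡ 0 → (∀ j → σ NT j ≡ 0) → Runs listN σ (suc (m * 1)) Listed
  runs-listN {σ} st cnt₀ nt₀ =
    runs-seq (framed (runs-scan CNT m cnt refl (λ _ _ → input (ready st) 4) cnt₀ count-step)) λ ρ₁ (f₁ , counted₁) →
    let st₁ = sorted-frame {counting} refl refl refl refl refl refl f₁ st
        σ₂ = write ρ₁ NT 0 (ρ₁ 0 4) in
    runs-seq (runs-assign (ret m̂) {λ ρ → ρ ≡ σ₂} (s≤s z≤n) refl) λ { _ refl →
    runs-weaken ≤-refl (λ ρ (fr , h) → record
        { sorted  = sorted-frame {numbering} refl refl refl refl refl refl fr (sorted-frame {NT ⟦ lit 0 ⟧≔ m̂} refl refl refl refl refl refl (frame {NT ⟦ lit 0 ⟧≔ m̂} ⇓assign) st₁)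
        ; counted = λ i i≤m → trans (fr CNT refl i) (counted₁ i i≤m)
        ; listed  = h })
      (framed (runs-loop NT m fill refl
        (λ { zero → input (ready st₁) 4 ; (suc j) → trans (f₁ NT refl (suc j)) (nt₀ (suc j)) })
        (λ _ _ → input (ready st₁) 4)
        (λ e j → cong (λ z → if suc z ≡ᵇ j then toℕ e else fill (toℕ e) j) (counted₁ (toℕ e) (<⇒≤ (toℕ<n e)))))) }
    where
    counting = for m̂ (CNT ⟦ lit 1 ⊕ idx ⟧← ret ((CNT ⟦ idx ⟧) ⊕ ((TF ⟦ idx ⟧) ⊖ (DF ⟦ idx ⟧))))
    numbering = for m̂ (NT ⟦ lit 1 ⊕ (CNT ⟦ idx ⟧) ⟧← ret idx)
    count-step : ∀ (e : Fin m) g → g (toℕ e) ≡ cnt (toℕ e) →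
      g (toℕ e) + (σ TF (toℕ e) ∸ σ DF (toℕ e)) ≡ cnt (toℕ e) + weightAt (toℕ e)
    count-step e g ge = cong₂ _+_ ge (trans (cong₂ _∸_ (flags-T st e) (flags-D st e))
      (trans (bit-∸ (lookup TN e) (lookup D e)) (sym (weightAt-toℕ e))))

  -- Checking a single tuple

  module Probing (x : ℕ → ℕ) (σ : Memory) (rd : Ready σ) (dist : Dists σ)
    (digits : ∀ i → σ NT (σ CS i) ≡ x i) (heads : Heads₄ σ)
    (lens : ∀ e → σ G4 (4 + (m + m) + toℕ e) ≡ Network.ℓ (surcharge G (removed x)) e)
    (1≤Y : 1 ≤ Y) where

    R : Subset m
    R = removed x

    -- A cleared flag refutes the whole tuple and not just the entries seen so far, so later entries
    -- cannot invalidate it.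
    Ok : ℕ → ℕ → Set
    Ok i k = (k ≡ 1 × W̄ ≤ removedWeight R × (∀ i′ e → i′ < i → x i′ ≡ toℕ e → Good (∁ R) e)) ⊎
             (k ≡ 0 × ¬ Valid x)

    -- `G4` is preserved from cell 2 on only: cells 0 and 1 receive the ends of each queried edge.
    Inv : ℕ → Memory → Set
    Inv i τ = (∀ c → (ctr ≡ᵇ c) ≡ false → writes probe c ≡ false → ∀ j → τ c j ≡ σ c j) ×
              (∀ j → τ G4 (2 + j) ≡ σ G4 (2 + j)) × Ok i (τ OK 0)

    ok-skip : ∀ {i k} → ¬ x i < m → Ok i k → Ok (suc i) k
    ok-skip no-edge (inj₂ bad) = inj₂ bad
    ok-skip {i} no-edge (inj₁ (one , heavy , good)) = inj₁ (one , heavy , good′)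
      where
      good′ : ∀ i′ e → i′ < suc i → x i′ ≡ toℕ e → Good (∁ R) e
      good′ i′ e lt eq = case m≤n⇒m<n∨m≡n (s≤s⁻¹ lt) of λ where
        (inj₁ i′<i) → good i′ e i′<i eq
        (inj₂ refl) → contradiction (subst (_< m) (sym eq) (toℕ<n e)) no-edge

    ok-step : ∀ {i k k′} e o → x i ≡ toℕ e → i < W̄ → ShortestCode (surcharge G R) (src e) (tgt e) o → Ok i k →
      k′ ≡ (if ok (d e) o then k else 0) → Ok (suc i) k′
    ok-step {i} {k} e o xi i<W code h eq = case (ok (d e) o ≟ᵇ true) of λ where
        (yes fine) → [ (λ (one , heavy , good) → inj₁ (trans eq (trans (cong (λ b → if b then k else 0) fine) one) , heavy ,
                          good′ good (Surcharge.shortest-sound G R {p} {q} {d e} code (okayᵇ⇒ M p q (d e) o fine)))) ,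
                       (λ (off , bad) → inj₂ (trans eq (trans (cong (λ b → if b then k else 0) fine) off) , bad)) ]′ h
        (no ¬fine) → inj₂ (trans eq (cong (λ b → if b then k else 0) (¬-not ¬fine)) , λ (_ , good) →
          let P , P∈ , le = good i e i<W xi
          in ¬fine (okayᵇ⇐ M p q (d e) o (Surcharge.shortest-complete G R {p} {q} {d e} code P P∈ le)))
      where
      good′ : (∀ i′ f → i′ < i → x i′ ≡ toℕ f → Good (∁ R) f) → Good (∁ R) e →
        ∀ i′ f → i′ < suc i → x i′ ≡ toℕ f → Good (∁ R) f
      good′ good new i′ f lt eq′ = case m≤n⇒m<n∨m≡n (s≤s⁻¹ lt) of λ where
        (inj₁ i′<i) → good i′ f i′<i eq′
        (inj₂ refl) → subst (Good (∁ R)) (toℕ-injective (trans (sym xi) eq′)) new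

    runs-probe : ∀ (i : Fin W̄) τ → τ ctr 0 ≡ toℕ i → Inv (toℕ i) τ →
      Runs probe τ Y (λ ρ → (∀ j → ρ G4 (2 + j) ≡ τ G4 (2 + j)) × Ok (suc (toℕ i)) (ρ OK 0))
    runs-probe i τ at-i (kept , heads′ , okay′) = case x (toℕ i) <? m of λ where
        (no none) → runs-else {b = is-edge} 1≤Y
          (trans (cong₂ _≤ᵇ_ (trans (+-identityʳ _) (trans (cong (_+ 1) number) (+-comm (x (toℕ i)) 1))) (trans (+-identityʳ _) (inp₁ 4)))
                 (≤ᵇ-false none))
          (runs-skip 1≤Y ((λ _ → refl) , ok-skip {toℕ i} none okay′))
        (yes some) → runs-then {b = is-edge} 1≤Y
          (trans (cong₂ _≤ᵇ_ (trans (+-identityʳ _) (trans (cong (_+ 1) number) (+-comm (x (toℕ i)) 1))) (trans (+-identityʳ _) (inp₁ 4)))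
                 (≤ᵇ-true some))
          (query (fromℕ< some) (sym (toℕ-fromℕ< some)))
      where
      is-edge = lit 1 · ((NT ⟦ CS ⟦ idx ⟧ ⟧) ⊕ lit 1) ≤ lit 1 · m̂
      inp₁ : HasInput τ
      inp₁ j = trans (kept 0 refl refl j) (input rd j)
      number : τ NT (τ CS (τ ctr 0)) ≡ x (toℕ i)
      number = trans (cong (τ NT) (trans (cong (τ CS) at-i) (kept CS refl refl (toℕ i))))
        (trans (kept NT refl refl _) (digits (toℕ i)))
      query : ∀ e → x (toℕ i) ≡ toℕ e →
        Runs ((G4 ⟦ lit 0 ⟧≔ srcE (NT ⟦ CS ⟦ idx ⟧ ⟧)) ⨾
             ((G4 ⟦ lit 1 ⟧≔ tgtE (NT ⟦ CS ⟦ idx ⟧ ⟧)) ⨾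
             (call spsp G4 ((lit 4 ⊕ (m̂ ⊕ m̂)) ⊕ m̂) SP (lit 1) ⨾
              (OK ⟦ lit 0 ⟧← okay (cell SP) (NT ⟦ CS ⟦ idx ⟧ ⟧) (ret (cell OK)) (ret (lit 0))))))
          τ Y (λ ρ → (∀ j → ρ G4 (2 + j) ≡ τ G4 (2 + j)) × Ok (suc (toℕ i)) (ρ OK 0))
      query e xi =
        runs-seq (runs-assign (ret (srcE (NT ⟦ CS ⟦ idx ⟧ ⟧))) {λ ρ → ρ ≡ τ₁} 1≤Y refl) λ { _ refl →
        runs-seq (runs-assign (ret (tgtE (NT ⟦ CS ⟦ idx ⟧ ⟧))) {λ ρ → ρ ≡ τ₂} 1≤Y refl) λ { _ refl →
        runs-seq (framed (runs-call {ys = o ∷ []} out 1≤Y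
          (trans (cong (λ k → 4 + (k + k) + k) (inp₁ 4)) (cong (2 +_) (sym (length-network R)))) cells-in refl)) λ ρ₃ (f₃ , res) →
        let inp₃ = λ j → trans (f₃ 0 refl j) (inp₁ j)
            number₃ = trans (cong (λ a → ρ₃ NT (ρ₃ CS a)) (f₃ ctr refl 0))
              (trans (cong (ρ₃ NT) (f₃ CS refl (τ ctr 0))) (trans (f₃ NT refl _) (trans number xi)))
        in runs-assign (okay (cell SP) (NT ⟦ CS ⟦ idx ⟧ ⟧) (ret (cell OK)) (ret (lit 0))) 1≤Y
          ((λ j → f₃ G4 refl (2 + j)) ,
           ok-step {toℕ i} {τ OK 0} e o xi (toℕ<n i) code okay′
             (trans (value-okay {ρ₃} inp₃ (trans (f₃ LL refl 0) (trans (kept LL refl refl 0) (big rd))) (cell SP) (NT ⟦ CS ⟦ idx ⟧ ⟧) (ret (cell OK)) (ret (lit 0)))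
               (cong₂ (λ b z → if b then z else 0)
                 (cong₂ ok (trans (cong (ρ₃ DIST) number₃) (trans (f₃ DIST refl _) (trans (kept DIST refl refl _) (dist e)))) (res 0 (s≤s z≤n)))
                 (f₃ OK refl 0)))) } }
        where
        edge-eval : eval τ (NT ⟦ CS ⟦ idx ⟧ ⟧) ≡ toℕ e
        edge-eval = trans number xi
        τ₁ = write τ G4 0 (eval τ (srcE (NT ⟦ CS ⟦ idx ⟧ ⟧)))
        τ₂ = write τ₁ G4 1 (eval τ₁ (tgtE (NT ⟦ CS ⟦ idx ⟧ ⟧)))
        sol = solves-spsp (surcharge G R) (src e) (tgt e)
        o = proj₁ sol
        code = proj₁ (proj₂ sol)
        out = proj₂ (proj₂ sol)
        cells-in : ∀ j → j < length (toℕ (src e) ∷ toℕ (tgt e) ∷ encodeNetwork (surcharge G R)) →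
          τ₂ G4 j ≡ nth (toℕ (src e) ∷ toℕ (tgt e) ∷ encodeNetwork (surcharge G R)) j
        cells-in zero          _ = trans (eval-src {τ} inp₁ {NT ⟦ CS ⟦ idx ⟧ ⟧} edge-eval) (inp-src e)
        cells-in (suc zero)    _ = trans (eval-tgt {τ} inp₁ {NT ⟦ CS ⟦ idx ⟧ ⟧} edge-eval) (inp-tgt e)
        cells-in (suc (suc j)) (s≤s (s≤s j<)) = network-cells R (λ j → τ G4 (2 + j))
          (λ j j<′ → trans (heads′ j) (heads j j<′))
          (λ f → trans (heads′ _) (lens f)) j (subst (j <_) (length-network R) j<)

    runs-probes : Ok 0 (σ OK 0) → Runs (for Ŵ probe) σ (suc (W̄ * Y))
      (λ ρ → (∀ j → ρ G4 (2 + j) ≡ σ G4 (2 + j)) × Ok W̄ (ρ OK 0))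
    runs-probes start = runs-weaken ≤-refl (λ ρ (_ , h) → h)
      (runs-for Inv W̄ Y set (λ i τ (kept , _) → trans (kept 0 refl refl 2) (input rd 2)) body 1≤Y
        ((λ _ _ _ _ → refl) , (λ _ → refl) , start))
      where
      set : ∀ i τ y → Inv i τ → Inv i (write τ ctr 0 y)
      set i τ y (kept , heads′ , okay′) = kept′ , heads′ , okay′
        where
        kept′ : ∀ c → (ctr ≡ᵇ c) ≡ false → writes probe c ≡ false → ∀ j → write τ ctr 0 y c j ≡ σ c j
        kept′ c h h′ j rewrite h = kept c h h′ j
      body : ∀ (i : Fin W̄) τ → τ ctr 0 ≡ toℕ i → Inv (toℕ i) τ →
        Runs probe τ Y (λ ρ → ρ ctr 0 ≡ toℕ i × Inv (suc (toℕ i)) ρ)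
      body i τ at-i inv@(kept , heads′ , _) = runs-weaken ≤-refl
        (λ ρ (fr , heads″ , okay″) → trans (fr ctr refl 0) at-i ,
          (λ c h h′ j → trans (fr c h′ j) (kept c h h′ j)) , (λ j → trans (heads″ j) (heads′ j)) , okay″)
        (framed (runs-probe i τ at-i inv))

  Z : ℕ
  Z = suc m + W̄ * Y

  1≤Z : 1 ≤ Z
  1≤Z = s≤s z≤n

  edges≤Z : suc (m * 1) ≤ Z
  edges≤Z = ≤-trans (≤-reflexive (cong suc (*-identityʳ m))) (m≤m+n (suc m) _)

  tuple≤Z : 1 ≤ Y → suc (W̄ * 1) ≤ Z
  tuple≤Z 1≤Y = +-mono-≤ (s≤s (z≤n {m})) (*-monoʳ-≤ W̄ 1≤Y)

  Checked : (ℕ → ℕ) → Memory → Set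
  Checked x ρ = (ρ OK 0 ≡ 1 × Valid x) ⊎ (ρ OK 0 ≡ 0 × ¬ Valid x)

  runs-resetSF : ∀ {σ} → Sorted σ → Runs resetSF σ (suc (m * 1)) (Flags SF D)
  runs-resetSF {σ} st = runs-weaken ≤-refl (λ ρ (h , _) e → trans (h (toℕ e) (toℕ<n e)) (flags-D st e))
    (runs-fill SF m 0 refl (λ _ _ → input (ready st) 4) (λ _ _ → refl) (λ _ → refl))

  runs-mark : ∀ {σ} x → HasInput σ → (∀ i → σ NT (σ CS i) ≡ x i) → Flags SF D σ →
    Runs mark σ (suc (W̄ * 1)) (Flags SF (removed x))
  runs-mark {σ} x inp₀ digits flags = runs-weaken ≤-refl
    (λ ρ h e → trans (h (toℕ e)) (trans (cong (λ v → if hit W̄ x (toℕ e) then 1 else v) (flags e))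
      (trans (if-bit-∨ (hit W̄ x (toℕ e)) (lookup D e)) (cong bit (sym (lookup-removed x e))))))
    (runs-loop SF W̄ (λ i j → if hit i x j then 1 else σ SF j) refl (λ _ → refl) (λ _ _ → inp₀ 2)
      (λ e j → trans (cong (λ z → if z ≡ᵇ j then 1 else (if hit (toℕ e) x j then 1 else σ SF j)) (digits (toℕ e)))
        (if-∨ (x (toℕ e) ≡ᵇ j) (hit (toℕ e) x j))))

  runs-attempt : ∀ {σ} → 1 ≤ Y → Listed σ → Heads₄ σ → let x = λ i → nt (σ CS i) in
    Runs attempt σ Z (λ ρ → Heads₄ ρ × Flags SF (removed x) ρ × Checked x ρ)
  runs-attempt {σ} 1≤Y ls₀ heads₀ =
    runs-seq (framed (runs-slower edges≤Z (runs-resetSF (sorted ls₀)))) λ ρ₁ (f₁ , D₁) →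
    let ls₁ = listed-frame {resetSF} refl refl refl refl refl refl refl refl f₁ ls₀
        digits₁ = λ i → trans (listed ls₁ _) (cong nt (f₁ CS refl i)) in
    runs-seq (framed (runs-slower (tuple≤Z 1≤Y) (runs-mark x (input (ready (sorted ls₁))) digits₁ D₁))) λ ρ₂ (f₂ , S₂) →
    let ls₂ = listed-frame {mark} refl refl refl refl refl refl refl refl f₂ ls₁ in
    runs-seq (framed (runs-slower edges≤Z (runs-setLengths SF G4 4 {ρ₂} {R} refl refl refl refl refl
      (input (ready (sorted ls₂))) (big (ready (sorted ls₂))) S₂))) λ ρ₃ (f₃ , lens₃ , old₃) →
    let ls₃ = listed-frame {setLengths SF G4 4} refl refl refl refl refl refl refl refl f₃ ls₂
        S₃ = λ e → trans (f₃ SF refl (toℕ e)) (S₂ e)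
        heads₃ = λ i i< → trans (old₃ (2 + i) (+-monoʳ-< 2 i<))
          (trans (f₂ G4 refl (2 + i)) (trans (f₁ G4 refl (2 + i)) (heads₀ i i<))) in
    runs-seq (framed (runs-slower edges≤Z (runs-total {R = R} (ready (sorted ls₃)) S₃))) λ ρ₄ (f₄ , tot₄) →
    let ls₄ = listed-frame {total} refl refl refl refl refl refl refl refl f₄ ls₃ in
    runs-seq (framed (runs-heavy {R = R} 1≤Z (input (ready (sorted ls₄))) tot₄)) λ ρ₅ (f₅ , heavy₅) →
    let ls₅ = listed-frame {heavy} refl refl refl refl refl refl refl refl f₅ ls₄
        digits₅ = λ i → trans (listed ls₅ _) (cong nt (trans (f₅ CS refl i) (trans (f₄ CS refl i)
          (trans (f₃ CS refl i) (trans (f₂ CS refl i) (f₁ CS refl i))))))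
        heads₅ = λ i i< → trans (f₅ G4 refl _) (trans (f₄ G4 refl _) (heads₃ i i<))
        lens₅ = λ e → trans (f₅ G4 refl _) (trans (f₄ G4 refl _) (lens₃ e))
        S₅ = λ e → trans (f₅ SF refl (toℕ e)) (trans (f₄ SF refl (toℕ e)) (S₃ e))
        module Pr = Probing x ρ₅ (ready (sorted ls₅)) (dist (sorted ls₅)) digits₅ heads₅ lens₅ 1≤Y in
    runs-weaken (s≤s (m≤n+m (W̄ * Y) m))
      (λ ρ (fr , heads₆ , okay₆) → (λ i i< → trans (heads₆ i) (heads₅ i i<)) ,
        (λ e → trans (fr SF refl (toℕ e)) (S₅ e)) , checked okay₆)
      (framed (Pr.runs-probes (start heavy₅)))
    where
    x : ℕ → ℕ
    x i = nt (σ CS i)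
    R = removed x
    start : ∀ {k} → k ≡ bit (W̄ ≤ᵇ removedWeight R) →
      (k ≡ 1 × W̄ ≤ removedWeight R × (∀ i e → i < 0 → x i ≡ toℕ e → Good (∁ R) e)) ⊎ (k ≡ 0 × ¬ Valid x)
    start eq = case (W̄ ≤ᵇ removedWeight R) ≟ᵇ true of λ where
      (yes h) → inj₁ (trans eq (cong bit h) , ≤ᵇ-true⁻¹ h , λ _ _ ())
      (no ¬h) → inj₂ (trans eq (cong bit (¬-not ¬h)) , λ (le , _) → ≤ᵇ-false⁻¹ (¬-not ¬h) le)
    checked : ∀ {k} →
      (k ≡ 1 × W̄ ≤ removedWeight R × (∀ i e → i < W̄ → x i ≡ toℕ e → Good (∁ R) e)) ⊎ (k ≡ 0 × ¬ Valid x) →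
      (k ≡ 1 × Valid x) ⊎ (k ≡ 0 × ¬ Valid x)
    checked (inj₁ (one , heavy′ , good)) = inj₁ (one , heavy′ , good)
    checked (inj₂ bad) = inj₂ bad

  -- Enumeration of all tuples

  -- The parameter `a` is the largest digit allowed, so `a` = 0 admits the tuple of blanks only; `v`
  -- is the rank of the current tuple within base `suc a`.
  record At (a v : ℕ) (σ : Memory) : Set where
    field
      list   : Listed σ
      heads  : Heads₄ σ
      base   : σ B 0 ≡ suc a
      digits : ∀ i → i < W̄ → σ CS i < suc a
      number : val (suc a) W̄ (σ CS) ≡ v
  open At

  k : ℕ
  k = cnt m

  Advanced : ℕ → ℕ → Memory → Set
  Advanced a v ρ = (ρ GO 0 ≡ bit (suc a ≤ᵇ suc k) × At a (suc v) ρ) ⊎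
                   (ρ GO 0 ≡ bit (suc (suc a) ≤ᵇ suc k) × suc v ≡ suc a ^ W̄ × At (suc a) 0 ρ)

  private
    if-flag : ∀ t (z : ℕ) → (if 1 ≤ᵇ (if t then 1 else 0) + 0 then 0 else z) ≡ (if t then 0 else z)
    if-flag true  z = refl
    if-flag false z = refl

    Incremented : (ℕ → ℕ) → ℕ → Memory → Set
    Incremented c b ρ = (∀ i → i < W̄ → ρ CS i ≡ Increment.digit b c i) × ρ B 0 ≡ b + Increment.carry b c W̄

  runs-advance′ : ∀ {σ a v} → 1 ≤ Y → At a v σ →
    Runs advance σ Z (λ ρ → Incremented (σ CS) (suc a) ρ × ρ GO 0 ≡ bit (suc a + Increment.carry (suc a) (σ CS) W̄ ≤ᵇ suc k))
  runs-advance′ {σ} {a} {v} 1≤Y st =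
    runs-seq (runs-assign (ret (lit 1)) {λ ρ → ρ ≡ σ₁} 1≤Z refl) λ { _ refl →
    runs-seq (framed (runs-slower (tuple≤Z 1≤Y) (runs-scan CR {σ = σ₁} W̄ carry refl (λ _ _ → inp₀ 2) refl carry-step))) λ ρ₂ (f₂ , carried) →
    runs-seq (framed (runs-slower (tuple≤Z 1≤Y) (runs-fill CS {σ = ρ₂} W̄ 0 refl
      (λ _ _ → trans (f₂ 0 refl 2) (inp₀ 2)) (λ _ _ → refl) (reads ρ₂)))) λ ρ₃ (f₃ , (filled , _)) →
    let inp₃ = λ j → trans (f₃ 0 refl j) (trans (f₂ 0 refl j) (inp₀ j))
        bumped : ρ₃ B 0 + ρ₃ CR (ρ₃ 0 2) ≡ b + carry W̄
        bumped = cong₂ _+_ (trans (f₃ B refl 0) (trans (f₂ B refl 0) (base st)))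
          (trans (cong (ρ₃ CR) (inp₃ 2)) (trans (f₃ CR refl W̄) (carried W̄ ≤-refl)))
        CS₃ = λ i i<W → trans (filled i i<W) (trans (cong₂ (λ x y → if 1 ≤ᵇ x + 0 then 0 else y) (carried (suc i) i<W)
                (cong₂ _+_ (f₂ CS refl i) (carried i (<⇒≤ i<W)))) (if-flag (b ≤ᵇ c i + carry i) (c i + carry i)))
    in
    runs-seq (runs-assign (ret (cell B ⊕ (CR ⟦ Ŵ ⟧))) {λ ρ → ρ ≡ write ρ₃ B 0 (ρ₃ B 0 + ρ₃ CR (ρ₃ 0 2))} 1≤Z refl) λ { _ refl →
    runs-assign (cond (lit 1 · cell B ≤ lit 1 · ((CNT ⟦ m̂ ⟧) ⊕ lit 1)) (ret (lit 1)) (ret (lit 0))) 1≤Z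
      ((CS₃ , bumped) ,
       cong bit (cong₂ _≤ᵇ_ (trans (+-identityʳ _) bumped)
         (trans (+-identityʳ _) (trans (+-comm _ 1) (cong suc
           (trans (cong (ρ₃ CNT) (inp₃ 4)) (trans (f₃ CNT refl m) (trans (f₂ CNT refl m) (counted (list st) m ≤-refl)))))))))
    } }
    where
    b = suc a
    c = σ CS
    σ₁ = write σ CR 0 1
    inp₀ = input (ready (sorted (list st)))
    open Increment b c
    carry-step : ∀ (e : Fin W̄) g → g (toℕ e) ≡ carry (toℕ e) →
      value (overlay CR g (at σ₁ (toℕ e))) (cond (lit 1 · cell B ≤ lit 1 · ((CS ⟦ idx ⟧) ⊕ (CR ⟦ idx ⟧))) (ret (lit 1)) (ret (lit 0)))
      ≡ carry (suc (toℕ e))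
    carry-step e g ge = cong (λ t → if t then 1 else 0) (cong₂ _≤ᵇ_ (trans (+-identityʳ _) (base st))
      (trans (+-identityʳ _) (cong (c (toℕ e) +_) ge)))
    V = cond (flagged CR (lit 1 ⊕ idx)) (ret (lit 0)) (ret ((CS ⟦ idx ⟧) ⊕ (CR ⟦ idx ⟧)))
    reads : ∀ ρ e → value (overlay CS (patch 0 (λ i → value (at ρ i) V) (ρ CS) e) (at ρ e)) V ≡ value (at ρ e) V
    reads ρ e = cong (λ z → if 1 ≤ᵇ ρ CR (1 + e) + 0 then 0 else z + ρ CR e)
      (patch-above 0 (λ i → value (at ρ i) V) (ρ CS) e {e} ≤-refl)

  runs-advance : ∀ {σ a v} → 1 ≤ Y → At a v σ → Runs advance σ Z (Advanced a v)
  runs-advance {σ} {a} {v} 1≤Y st = runs-weaken ≤-refl done (framed (runs-advance′ 1≤Y st))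
    where
    b = suc a
    c = σ CS
    open Increment b c
    done : ∀ ρ → Frame advance σ ρ × Incremented c b ρ × ρ GO 0 ≡ bit (b + carry W̄ ≤ᵇ suc k) → Advanced a v ρ
    done ρ (fr , (CS≡ , B≡) , GO≡) = case carry W̄ ≟ 0 of λ where
        (yes none) → inj₁ (trans GO≡ (cong (λ z → bit (z ≤ᵇ suc k)) (trans (cong (b +_) none) (+-identityʳ b))) , record
          { list = list′ ; heads = heads′ ; base = trans B≡ (trans (cong (b +_) none) (+-identityʳ b))
          ; digits = λ i i<W → subst (_< b) (sym (CS≡ i i<W)) (digit< (s≤s z≤n) i)
          ; number = trans (val≡ b) (trans (sym (+-identityʳ _)) (trans (cong (λ z → val b W̄ digit + z * b ^ W̄) (sym none)) sum≡)) })
        (no some) →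
          let one : carry W̄ ≡ 1
              one = ≤-antisym (carry≤1 W̄) (n≢0⇒n>0 some)
              sum′ : val b W̄ digit + b ^ W̄ ≡ suc v
              sum′ = trans (cong (val b W̄ digit +_) (trans (sym (+-identityʳ (b ^ W̄))) (cong (_* b ^ W̄) (sym one)))) sum≡
              -- A carry out of the top digit contributes `b ^ W̄`, and `suc v` is no larger than
              -- that, so nothing remains for the digits.
              small : suc v ≤ b ^ W̄
              small = subst (_< b ^ W̄) (number st) (val< b W̄ (digits st))
              zero-digits : val b W̄ digit ≡ 0
              zero-digits = n≤0⇒n≡0 (+-cancelʳ-≤ (b ^ W̄) _ _ (≤-trans (≤-reflexive sum′) small))
              all-zero = val-zero b W̄ {digit} (s≤s z≤n) zero-digits
          in inj₂ (trans GO≡ (cong (λ z → bit (z ≤ᵇ suc k)) (trans (cong (b +_) one) (+-comm b 1))) ,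
            trans (sym sum′) (cong (_+ b ^ W̄) zero-digits) , record
            { list = list′ ; heads = heads′ ; base = trans B≡ (trans (cong (b +_) one) (+-comm b 1))
            ; digits = λ i i<W → subst (_< suc b) (sym (trans (CS≡ i i<W) (all-zero i i<W))) (s≤s z≤n)
            ; number = trans (val≡ (suc b)) (zero-val (suc b) W̄ {digit} all-zero) })
      where
      list′ = listed-frame {advance} refl refl refl refl refl refl refl refl fr (list st)
      heads′ : Heads₄ ρ
      heads′ i i< = trans (fr G4 refl (2 + i)) (heads st i i<)
      val≡ : ∀ b′ → val b′ W̄ (ρ CS) ≡ val b′ W̄ digit
      val≡ b′ = ∑<-cong {λ i → ρ CS i * b′ ^ i} {λ i → digit i * b′ ^ i} W̄ (λ i i<W → cong (_* b′ ^ i) (CS≡ i i<W))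
      sum≡ : val b W̄ digit + carry W̄ * b ^ W̄ ≡ suc v
      sum≡ = trans (increment W̄ (digits st)) (cong suc (number st))

  Fails : ℕ → Set
  Fails a = ∀ (c : ℕ → ℕ) → (∀ i → c i ≤ a) → ¬ Valid (λ i → nt (c i))

  FailsBelow : ℕ → ℕ → Set
  FailsBelow a v = ∀ (c : ℕ → ℕ) → (∀ i → c i ≤ a) → val (suc a) W̄ c < v → ¬ Valid (λ i → nt (c i))

  hit-cong : ∀ l {x y} j → (∀ i → i < l → x i ≡ y i) → hit l x j ≡ hit l y j
  hit-cong zero    j h = refl
  hit-cong (suc l) j h = cong₂ _∨_ (cong (_≡ᵇ j) (h l ≤-refl)) (hit-cong l j (λ i i<l → h i (m≤n⇒m≤1+n i<l)))

  -- Validity looks at the first `W̄` entries only. Tuples of equal rank agree there, which is how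
  -- one failed trial excludes all functions of that rank.
  valid-cong : ∀ {x y} → (∀ i → i < W̄ → x i ≡ y i) → Valid x → Valid y
  valid-cong {x} {y} h (heavy′ , good) = subst (λ R → W̄ ≤ removedWeight R) R≡ heavy′ ,
    λ i e i<W yi → subst (λ R → Good (∁ R) e) R≡ (good i e i<W (trans (h i i<W) yi))
    where
    R≡ : removed x ≡ removed y
    R≡ = tabulate-cong (λ e → cong (lookup D e ∨_) (hit-cong W̄ (toℕ e) h))

  fails-next : ∀ {a v c} → (∀ i → i < W̄ → c i < suc a) → val (suc a) W̄ c ≡ v → ¬ Valid (λ i → nt (c i)) →
    FailsBelow a v → FailsBelow a (suc v)
  fails-next {a} {v} {c} c< c≡ bad below c′ c′≤ lt valid = case m≤n⇒m<n∨m≡n (s≤s⁻¹ lt) of λ where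
    (inj₁ lt′) → below c′ c′≤ lt′ valid
    (inj₂ eq)  → bad (valid-cong (λ i i<W → cong nt
      (val-injective (suc a) W̄ {c′} {c} (λ i _ → s≤s (c′≤ i)) c< (trans eq (sym c≡)) i i<W)) valid)

  fails-all : ∀ {a} → FailsBelow a (suc a ^ W̄) → Fails a
  fails-all {a} below c c≤ = below c c≤ (val< (suc a) W̄ {c} (λ i _ → s≤s (c≤ i)))

  isN⇐ : ∀ {e} → IsN e → isN e ≡ true
  isN⇐ (t , f) = cong₂ _∧_ t (cong not f)

  open Tuples nt pos nt-0 (λ isn → nt-pos (isN⇐ isn))

  Result : Memory → Set
  Result ρ = (∃ λ R → ρ OK 0 ≡ 1 × Flags SF R ρ × IsSolution (∁ R)) ⊎ (ρ OK 0 ≡ 0 × ¬ ∃ IsSolution)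

  -- The number of trials made before base `suc a` is entered; `attempts a + v` is thus the rank of
  -- a trial in the whole enumeration.
  attempts : ℕ → ℕ
  attempts = ∑< (λ i → suc i ^ W̄)

  -- Each smaller base contributes no more trials than the current one. Restarting therefore costs
  -- one extra factor `suc a`.
  attempts≤ : ∀ a → attempts (suc a) ≤ suc a ^ suc W̄
  attempts≤ a = go (suc a) ≤-refl
    where
    go : ∀ i → i ≤ suc a → attempts i ≤ i * suc a ^ W̄
    go zero    _   = z≤n
    go (suc i) i≤a = ≤-trans (+-mono-≤ (go i (<⇒≤ i≤a)) (^-monoˡ-≤ W̄ i≤a)) (≤-reflexive (+-comm (i * suc a ^ W̄) _))

  round : Cmd
  round = attempt ⨾ ifte (flagged OK (lit 0)) (GO ⟦ lit 0 ⟧≔ lit 0) advance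

  Round : ℕ → ℕ → (ℕ → ℕ) → Memory → Set
  Round a v x ρ = (ρ GO 0 ≡ 0 × ρ OK 0 ≡ 1 × Flags SF (removed x) ρ × Valid x × HasInput ρ) ⊎
                  (ρ OK 0 ≡ 0 × ¬ Valid x × Advanced a v ρ)

  runs-round : ∀ {a v σ} → 1 ≤ Y → At a v σ → Runs round σ Z (Round a v (λ i → nt (σ CS i)))
  runs-round {a} {v} {σ} 1≤Y st = runs-seq (framed (runs-attempt 1≤Y (list st) (heads st))) next
    where
    x : ℕ → ℕ
    x i = nt (σ CS i)
    next : ∀ ρ → Frame attempt σ ρ × Heads₄ ρ × Flags SF (removed x) ρ × Checked x ρ →
      Runs (ifte (flagged OK (lit 0)) (GO ⟦ lit 0 ⟧≔ lit 0) advance) ρ Z (Round a v x)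
    next ρ (fr , heads₁ , flags , inj₁ (one , valid)) =
      runs-then {b = flagged OK (lit 0)} 1≤Z (cong (λ z → 1 ≤ᵇ z + 0) one)
        (runs-assign (ret (lit 0)) 1≤Z (inj₁ (refl , one , flags , valid ,
          λ j → trans (fr 0 refl j) (input (ready (sorted (list st))) j))))
    next ρ (fr , heads₁ , flags , inj₂ (off , bad)) =
      runs-else {b = flagged OK (lit 0)} 1≤Z (cong (λ z → 1 ≤ᵇ z + 0) off)
        (runs-weaken ≤-refl (λ υ (fr′ , adv) → inj₂ (trans (fr′ OK refl 0) off , bad , adv))
          (framed (runs-advance 1≤Y (record
            { list = listed-frame {attempt} refl refl refl refl refl refl refl refl fr (list st)
            ; heads = heads₁
            ; base = trans (fr B refl 0) (base st)
            ; digits = λ i i<W → subst (_< suc a) (sym (fr CS refl i)) (digits st i i<W)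
            ; number = trans (∑<-cong {λ i → ρ CS i * suc a ^ i} {λ i → σ CS i * suc a ^ i} W̄
                (λ i _ → cong (_* suc a ^ i) (fr CS refl i))) (number st) }))))

  -- `last` is the largest digit allowed in the final round. The failure of all smaller values
  -- bounds `last` by the tightness, and `few` bounds the rounds by `last`.
  record Search (a v : ℕ) (σ : Memory) : Set where
    field
      rounds last steps : ℕ
      end    : Memory
      run    : search , σ ⇓[ steps ] end
      fast   : steps ≤ rounds * (testSize (flagged GO (lit 0)) + cost round * Z) + testSize (flagged GO (lit 0))
      few    : attempts a + v + rounds ≤ attempts (suc last)
      failed : ∀ a′ → a′ < last → Fails a′
      last≤  : last ≤ k
      intact : HasInput end
      result : Result end

  module _ (1≤Y : 1 ≤ Y) where

    private
      c = testSize (flagged GO (lit 0))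

      below-total : ∀ {a v σ} → At a v σ → a ≤ k → attempts a + v < attempts (suc k)
      below-total {a} {v} {σ} st a≤k = ≤-trans
        (+-monoʳ-< (attempts a) (subst (_< suc a ^ W̄) (number st) (val< (suc a) W̄ {σ CS} (digits st))))
        (∑<-mono (λ i → suc i ^ W̄) (s≤s a≤k))

    continue : ∀ {a v a′ v′ σ Q} (r : Runs round σ Z Q) → σ GO 0 ≡ 1 →
      attempts a′ + v′ ≡ suc (attempts a + v) → Search a′ v′ (Runs.end r) → Search a v σ
    continue {a} {v} {a′} {v′} {σ} (runs s ρ run fast _) on count rest = record
      { rounds = suc (R.rounds)
      ; last   = R.last
      ; steps  = c + s + R.steps
      ; end    = R.end
      ; run    = ⇓loop (cong (λ z → 1 ≤ᵇ z + 0) on) run R.run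
      ; fast   = ≤-trans (+-mono-≤ (+-monoʳ-≤ c fast) R.fast)
                   (≤-reflexive (sym (+-assoc (c + cost round * Z) (R.rounds * (c + cost round * Z)) c)))
      ; few    = ≤-trans (≤-reflexive (trans (+-suc (attempts a + v) R.rounds) (cong (_+ R.rounds) (sym count)))) R.few
      ; failed = R.failed
      ; last≤  = R.last≤
      ; intact = R.intact
      ; result = R.result
      }
      where module R = Search rest

    finish : ∀ {a v σ Q} (r : Runs round σ Z Q) → σ GO 0 ≡ 1 → At a v σ → a ≤ k → (∀ a′ → a′ < a → Fails a′) →
      Runs.end r GO 0 ≡ 0 → HasInput (Runs.end r) → Result (Runs.end r) → Search a v σ
    finish {a} {v} {σ} (runs s ρ run fast _) on st a≤k failed off inp₀ res = record
      { rounds = 1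
      ; last   = a
      ; steps  = c + s + c
      ; end    = ρ
      ; run    = ⇓loop (cong (λ z → 1 ≤ᵇ z + 0) on) run (⇓done (cong (λ z → 1 ≤ᵇ z + 0) off))
      ; fast   = +-monoˡ-≤ c (≤-trans (+-monoʳ-≤ c fast) (≤-reflexive (sym (+-identityʳ _))))
      ; few    = ≤-trans (≤-reflexive (+-comm (attempts a + v) 1))
                   (+-monoʳ-< (attempts a) (subst (_< suc a ^ W̄) (number st) (val< (suc a) W̄ {σ CS} (digits st))))
      ; failed = failed
      ; last≤  = a≤k
      ; intact = inp₀
      ; result = res
      }

    -- All nontrivial edges have positions up to `k`, so a solution would yield a valid tuple with
    -- digits up to `a`.
    exhausted : ∀ {a} → k ≤ a → Fails a → ¬ ∃ IsSolution
    exhausted k≤a fails (F , sol) =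
      let c , c≤ , valid = solution⇒tuple {F} {k} sol (λ isn → pos≤ (isN⇐ isn))
      in fails c (λ i → ≤-trans (c≤ i) k≤a) valid

    -- `fuel` is exactly the number of tuples left up to base `suc k`. It cannot be 0 here, as the
    -- current tuple still has to be tried.
    loop : ∀ fuel {a v σ} → At a v σ → σ GO 0 ≡ 1 → a ≤ k → (∀ a′ → a′ < a → Fails a′) → FailsBelow a v →
      attempts a + v + fuel ≡ attempts (suc k) → Search a v σ
    loop zero    st on a≤k failed below eq = contradiction (trans (sym (+-identityʳ _)) eq) (<⇒≢ (below-total st a≤k))
    loop (suc fuel) {a} {v} {σ} st on a≤k failed below eq = go (runs-round 1≤Y st)
      where
      x : ℕ → ℕ
      x i = nt (σ CS i)
      go : Runs round σ Z (Round a v x) → Search a v σ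
      go r@(runs _ ρ _ _ (inj₁ (off , one , flags , valid , inp₀))) =
        finish r on st a≤k failed off inp₀ (inj₁ (removed x , one , flags , valid⇒solution valid))
      go r@(runs _ ρ _ _ (inj₂ (_ , bad , inj₁ (GO≡ , st′)))) =
        continue r on (+-suc (attempts a) v)
          (loop fuel st′ (trans GO≡ (cong bit (≤ᵇ-true (s≤s a≤k)))) a≤k failed
            (fails-next {c = σ CS} (digits st) (number st) bad below)
            (trans (cong (_+ fuel) (+-suc (attempts a) v)) (trans (sym (+-suc (attempts a + v) fuel)) eq)))
      go r@(runs _ ρ _ _ (inj₂ (not-ok , bad , inj₂ (GO≡ , full , st′)))) = case suc a ≤? k of λ where
          (yes a<k) → continue r on carried
            (loop fuel st′ (trans GO≡ (cong bit (≤ᵇ-true (s≤s a<k)))) a<k failed′ (λ _ _ ())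
              (trans (cong (_+ fuel) carried) (trans (sym (+-suc (attempts a + v) fuel)) eq)))
          (no a≮k) → finish r on st a≤k failed (trans GO≡ (cong bit (≤ᵇ-false (a≮k ∘ s≤s⁻¹))))
            (input (ready (sorted (list st′)))) (inj₂ (not-ok , exhausted (≮⇒≥ a≮k) fails))
        where
        fails : Fails a
        fails = fails-all (subst (FailsBelow a) full (fails-next {c = σ CS} (digits st) (number st) bad below))
        failed′ : ∀ a′ → a′ < suc a → Fails a′
        failed′ a′ lt = case m≤n⇒m<n∨m≡n (s≤s⁻¹ lt) of λ where
          (inj₁ a′<a) → failed a′ a′<a
          (inj₂ refl) → fails
        carried : attempts (suc a) + 0 ≡ suc (attempts a + v)
        carried = trans (+-identityʳ _) (trans (cong (attempts a +_) (sym full)) (+-suc (attempts a) v))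

    record Enumeration (σ : Memory) : Set where
      field
        rounds last : ℕ
        few         : rounds ≤ suc last ^ suc W̄
        failed      : ∀ a → a < last → Fails a
        last≤       : last ≤ k
        enumeration : Runs enumerate σ (suc rounds * Z) (λ ρ → HasInput ρ × Result ρ)

    enumerates : ∀ {σ} → Sorted σ → Heads₄ σ → (∀ j → σ CNT j ≡ 0) → (∀ j → σ NT j ≡ 0) → (∀ j → σ CS j ≡ 0) → Enumeration σ
    enumerates {σ} st heads₀ cnt₀ nt₀ cs₀ = record
      { rounds = S.rounds
      ; last   = S.last
      ; few    = ≤-trans S.few (attempts≤ S.last)
      ; failed = S.failed
      ; last≤  = S.last≤
      ; enumeration =
          runs-seq (runs-slower (≤-trans edges≤Z Z≤) (exactly r₁)) λ { _ refl →
          runs-seq (runs-assign (ret (lit 1)) {λ ρ → ρ ≡ σ₂} (≤-trans 1≤Z Z≤) refl) λ { _ refl →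
          runs-seq (runs-assign (ret (lit 1)) {λ ρ → ρ ≡ σ₃} (≤-trans 1≤Z Z≤) refl) λ { _ refl →
          runs S.steps S.end S.run fast (S.intact , S.result) } } }
      }
      where
      r₁ : Runs listN σ (suc (m * 1)) (λ ρ → Frame listN σ ρ × Listed ρ)
      r₁ = framed (runs-listN st (cnt₀ 0) nt₀)
      σ₁ = Runs.end r₁
      fr = proj₁ (Runs.post r₁)
      ls = proj₂ (Runs.post r₁)
      σ₂ = write σ₁ B 0 1
      σ₃ = write σ₂ GO 0 1
      cs₃ : ∀ i → i < W̄ → σ₃ CS i ≡ 0
      cs₃ i _ = trans (fr CS refl i) (cs₀ i)
      start : At 0 0 σ₃
      start = record
        { list = record
          { sorted  = sorted-frame {p = bump} refl refl refl refl refl refl (λ { c h j → unchanged c h j }) (sorted ls)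
          ; counted = counted ls
          ; listed  = listed ls }
        ; heads  = λ i i< → trans (fr G4 refl (2 + i)) (heads₀ i i<)
        ; base   = refl
        ; digits = λ i i<W → ≤-reflexive (cong suc (cs₃ i i<W))
        ; number = zero-val 1 W̄ {σ₃ CS} cs₃ }
        where
        bump = (B ⟦ lit 0 ⟧≔ lit 1) ⨾ (GO ⟦ lit 0 ⟧≔ lit 1)
        unchanged : Frame bump σ₁ σ₃
        unchanged = frame {bump} (⇓seq ⇓assign ⇓assign)
      module S = Search (loop (attempts (suc k)) start refl z≤n (λ _ ()) (λ _ _ ()) refl)
      Z≤ : Z ≤ suc S.rounds * Z
      Z≤ = m≤m+n Z _
      fast : S.steps ≤ cost search * (suc S.rounds * Z)
      fast = begin
        S.steps                                    ≤⟨ S.fast ⟩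
        S.rounds * (c + cost round * Z) + c        ≤⟨ +-mono-≤ (*-monoʳ-≤ S.rounds (+-monoˡ-≤ (cost round * Z) (m≤m*n c Z)))
                                                               (≤-trans (m≤m*n c Z) (m≤m+n (c * Z) (cost round * Z))) ⟩
        S.rounds * (c * Z + cost round * Z) + (c * Z + cost round * Z)
          ≡⟨ shuffle S.rounds c (cost round) Z ⟩
        (c + cost round) * (suc S.rounds * Z) ∎
        where
        open ≤-Reasoning
        shuffle : ∀ x c r Z → x * (c * Z + r * Z) + (c * Z + r * Z) ≡ (c + r) * (suc x * Z)
        shuffle = solve-∀

  Answer : Memory → Set
  Answer ρ = (∃ λ R → ρ 1 0 ≡ 1 × (∀ e → ρ 1 (suc (toℕ e)) ≡ bit (lookup (∁ R) e)) × IsSolution (∁ R)) ⊎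
             (ρ 1 0 ≡ 0 × ¬ ∃ IsSolution)

  runs-output : ∀ {σ} → HasInput σ → Result σ → σ 1 0 ≡ 0 → Runs output σ X Answer
  runs-output {σ} inp₀ (inj₂ (off , none)) out₀ = runs-else {b = flagged OK (lit 0)} (s≤s z≤n)
    (cong (λ z → 1 ≤ᵇ z + 0) off) (runs-skip (s≤s z≤n) (inj₂ (out₀ , none)))
  runs-output {σ} inp₀ (inj₁ (R , one , flags , sol)) out₀ = runs-then {b = flagged OK (lit 0)} (s≤s z≤n)
    (cong (λ z → 1 ≤ᵇ z + 0) one)
    (runs-seq (runs-assign (ret (lit 1)) {λ ρ → ρ ≡ write σ 1 0 1} (s≤s z≤n) refl) λ { _ refl →
      runs-weaken edges≤X (λ ρ (h , h′) → inj₁ (R , h′ 0 (s≤s z≤n) , (λ e → trans (h (toℕ e) (toℕ<n e)) (kept e)) , sol))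
        (runs-fill 1 m 1 refl (λ _ _ → inp₀ 4) (λ _ _ → refl) (λ _ → refl)) })
    where
    kept : ∀ e → 1 ∸ σ SF (toℕ e) ≡ bit (lookup (∁ R) e)
    kept e = trans (cong (1 ∸_) (flags e)) (trans (flip-bit (lookup R e)) (cong bit (sym (lookup-map e not R))))
      where
      flip-bit : ∀ b → 1 ∸ bit b ≡ bit (not b)
      flip-bit true  = refl
      flip-bit false = refl

  -- If a search takes place, the failing edge is kept as evidence: it implies that the tightness is
  -- positive and that `Y` exceeds `m`.
  record Solved : Set where
    field
      time     : ℕ
      solution : Runs solve (load (encode I)) time Answer
      timed    : time ≡ X ⊎ (∃₂ λ rounds last → time ≡ suc rounds * Z + X × rounds ≤ suc last ^ suc W̄ ×
                   (∀ a → a < last → Fails a) × last ≤ k × ∃ λ e → Settles e × ¬ Good (∁ TN) e)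

  private
    Setup Classify : Memory → Memory → Set
    Setup    σ ρ = Frame setup σ ρ × Ready ρ × Heads₂ ρ × Heads₄ ρ
    Classify σ ρ = Frame classify σ ρ × Classified-TN ρ

    σ₀ : Memory
    σ₀ = load (encode I)

    assemble : ∀ {N} (r₁ : Runs setup σ₀ X (Setup σ₀)) (r₂ : Runs classify (Runs.end r₁) X (Classify (Runs.end r₁))) →
      X ≤ N → Runs (ifte (flagged CRIT (lit 0)) enumerate skip) (Runs.end r₂) N (λ ρ → HasInput ρ × Result ρ × ρ 1 0 ≡ 0) →
      Runs solve σ₀ N Answer
    assemble r₁ r₂ X≤N r₃ =
      runs-seq (runs-slower X≤N (exactly r₁)) λ { _ refl →
      runs-seq (runs-slower X≤N (exactly r₂)) λ { _ refl →
      runs-seq r₃ λ ρ (inp₃ , res , out₀) → runs-slower X≤N (runs-output inp₃ res out₀) } }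

    uncritical : ∀ {σ} → Flags SF TN σ → σ OK 0 ≡ bit (W̄ ≤ᵇ removedWeight TN) →
      (∀ e → Settles e → Good (∁ TN) e) → Dec (W̄ ≤ removedWeight TN) → Result σ
    uncritical flags okay₂ good (yes le) = inj₁ (TN , trans okay₂ (cong bit (≤ᵇ-true le)) , flags , uncritical-solution good le)
    uncritical flags okay₂ good (no ≰)  = inj₂ (trans okay₂ (cong bit (≤ᵇ-false ≰)) , light-no-solution ≰)

    after-classify : (r₁ : Runs setup σ₀ X (Setup σ₀)) (r₂ : Runs classify (Runs.end r₁) X (Classify (Runs.end r₁))) → Solved
    after-classify r₁@(runs _ ρ₁ _ _ (f₁ , _ , _ , heads)) r₂@(runs _ ρ₂ _ _ (f₂ , sorted , flags , okay₂ , verdict)) =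
      go verdict
      where
      fresh : ∀ c → writes classify c ≡ false → writes setup c ≡ false → ∀ j → σ₀ c j ≡ 0 → ρ₂ c j ≡ 0
      fresh c h₂ h₁ j eq = trans (f₂ c h₂ j) (trans (f₁ c h₁ j) eq)
      enumerated : ∀ {e} (1≤Y : 1 ≤ Y) → Settles e → ¬ Good (∁ TN) e → ρ₂ CRIT 0 ≡ 1 → Enumeration 1≤Y ρ₂ → Solved
      enumerated {e} 1≤Y s bad on E = record
        { time     = suc (rounds E) * Z + X
        ; solution = assemble r₁ r₂ (m≤n+m X (suc (rounds E) * Z))
            (runs-then {b = flagged CRIT (lit 0)} (m≤n⇒m≤o+n (suc (rounds E) * Z) (s≤s z≤n)) (cong (λ z → 1 ≤ᵇ z + 0) on)
              (runs-weaken (m≤m+n _ X) (λ ρ (fr , inp₃ , res) → inp₃ , res , trans (fr 1 refl 0) (fresh 1 refl refl 0 refl))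
                (framed (enumeration E))))
        ; timed    = inj₂ (rounds E , last E , refl , few E , failed E , last≤ E , e , s , bad)
        }
        where open Enumeration
      go : Verdict ρ₂ → Solved
      go (inj₁ (off , good)) = record
        { time     = X
        ; solution = assemble r₁ r₂ ≤-refl (runs-else {b = flagged CRIT (lit 0)} (s≤s z≤n) (cong (λ z → 1 ≤ᵇ z + 0) off)
            (runs-skip (s≤s z≤n) (input (ready sorted) , uncritical {ρ₂} flags okay₂ good (W̄ ≤? removedWeight TN) , fresh 1 refl refl 0 refl)))
        ; timed    = inj₁ refl
        }
      go (inj₂ (on , e , s , bad)) = enumerated (≤-trans (s≤s z≤n) (spsp-size e)) s bad on
        (enumerates (≤-trans (s≤s z≤n) (spsp-size e)) sorted (λ i i< → trans (f₂ G4 refl (2 + i)) (heads i i<))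
          (λ j → fresh CNT refl refl j refl) (λ j → fresh NT refl refl j refl) (λ j → fresh CS refl refl j refl))

    after-setup : Runs setup σ₀ X (Setup σ₀) → Solved
    after-setup r₁@(runs _ ρ₁ _ _ (f₁ , ready₁ , heads₁ , _)) =
      after-classify r₁ (framed (runs-classify ready₁ heads₁ (f₁ ZERO refl) (f₁ CRIT refl 0)))

  abstract
    solved : Solved
    solved = after-setup (framed (runs-setup {σ₀} (λ _ → refl) refl))

-- Arithmetic of the time bound

-- From `k` = 3 on, 4 is at most `suc k`. The factor 2 is needed for the smaller cases and is
-- attained at `k` = 1.
4^≤ : ∀ k → 4 ^ k ≤ 2 * suc k ^ k
4^≤ 0 = s≤s z≤n
4^≤ 1 = ≤-refl
4^≤ 2 = m≤m+n 16 2
4^≤ (suc (suc (suc k))) = ≤-trans (^-monoˡ-≤ (3 + k) {4} {4 + k} (m≤m+n 4 k)) (m≤m+n _ _)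

^-distribʳ-* : ∀ k a b → (a * b) ^ k ≡ a ^ k * b ^ k
^-distribʳ-* zero    a b = refl
^-distribʳ-* (suc k) a b = trans (cong (a * b *_) (^-distribʳ-* k a b)) (shuffle a b (a ^ k) (b ^ k))
  where
  shuffle : ∀ a b x y → a * b * (x * y) ≡ a * x * (b * y)
  shuffle = solve-∀

-- Of the `suc W` factors 4, two become the constant 16 and the other `W - 1` are at most 2 times as
-- many factors `W`. With the `suc W` factors `W` of the power and the one outside this makes
-- `2 * W + 1`.
power-bound : ∀ W τ → 1 ≤ W → 1 ≤ τ → (4 * (W * τ)) ^ suc W * W ≤ 32 * (W ^ (2 * W + 1) * τ ^ (2 * W))
power-bound W@(suc k) τ 1≤W 1≤τ = begin
  (4 * (W * τ)) ^ suc W * W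
    ≡⟨ cong (_* W) (trans (^-distribʳ-* (suc W) 4 (W * τ)) (cong (4 ^ suc W *_) (^-distribʳ-* (suc W) W τ))) ⟩
  4 ^ suc W * (W ^ suc W * τ ^ suc W) * W
    ≡⟨ shuffle₁ (4 ^ k) (W ^ suc W) (τ ^ suc W) W ⟩
  16 * 4 ^ k * (W ^ suc W * W) * τ ^ suc W
    ≤⟨ *-mono-≤ (*-monoˡ-≤ (W ^ suc W * W) (*-monoʳ-≤ 16 (4^≤ k)))
                (^-monoʳ-≤ τ {{>-nonZero 1≤τ}} (s≤s (≤-trans (m≤m+n W 0) (m≤n+m (W + 0) k)))) ⟩
  16 * (2 * W ^ k) * (W ^ suc W * W) * τ ^ (2 * W)
    ≡⟨ shuffle₂ (W ^ k) (W ^ suc W) W (τ ^ (2 * W)) ⟩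
  32 * (W ^ k * (W * W ^ suc W) * τ ^ (2 * W))
    ≡⟨ cong (λ z → 32 * (z * τ ^ (2 * W))) (trans (sym (^-distribˡ-+-* W k (suc (suc W)))) (cong (W ^_) (exponent k))) ⟩
  32 * (W ^ (2 * W + 1) * τ ^ (2 * W)) ∎
  where
  open ≤-Reasoning
  shuffle₁ : ∀ f a t w → 4 * (4 * f) * (a * t) * w ≡ 16 * f * (a * w) * t
  shuffle₁ = solve-∀
  shuffle₂ : ∀ f a w t → 16 * (2 * f) * (a * w) * t ≡ 32 * (f * (w * a) * t)
  shuffle₂ = solve-∀
  exponent : ∀ k → k + suc (suc (suc k)) ≡ 2 * suc k + 1
  exponent = solve-∀

-- 128 is 4 times the 32 of `power-bound`: one factor 2 pays for the additional round, the other for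
-- the loops over the edges in each round.
search-bound : ∀ W τ m Y A rounds last → 1 ≤ τ → suc m ≤ Y → suc m ≤ A →
  rounds ≤ suc last ^ suc W → last ≤ W * suc (2 * τ) →
  suc rounds * (suc m + W * Y) ≤ 128 * (W ^ (2 * W + 1) * τ ^ (2 * W) * Y) + 2 * A
-- The first summand is 0 here, since `0 ^ 1` is. At most two rounds remain, without any query, and
-- `2 * A` pays for them.
search-bound zero τ m Y A rounds .zero 1≤τ m<Y m<A few z≤n = ≤-trans
  (*-mono-≤ (s≤s few) (≤-trans (≤-reflexive (+-identityʳ (suc m))) m<A)) (m≤n+m (2 * A) (128 * (0 * τ ^ 0 * Y)))
search-bound W@(suc _) τ m Y A rounds last 1≤τ m<Y m<A few last≤ = begin
  suc rounds * (suc m + W * Y)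
    ≤⟨ *-mono-≤ (≤-trans (s≤s few′) (+-monoˡ-≤ R 1≤R)) (+-monoˡ-≤ (W * Y) (≤-trans m<Y (m≤n*m Y W))) ⟩
  (R + R) * (W * Y + W * Y)
    ≡⟨ shuffle₁ R W Y ⟩
  4 * (R * W) * Y
    ≤⟨ *-monoˡ-≤ Y (*-monoʳ-≤ 4 (power-bound W τ (s≤s z≤n) 1≤τ)) ⟩
  4 * (32 * (W ^ (2 * W + 1) * τ ^ (2 * W))) * Y
    ≡⟨ shuffle₂ (W ^ (2 * W + 1) * τ ^ (2 * W)) Y ⟩
  128 * (W ^ (2 * W + 1) * τ ^ (2 * W) * Y)
    ≤⟨ m≤m+n _ (2 * A) ⟩
  128 * (W ^ (2 * W + 1) * τ ^ (2 * W) * Y) + 2 * A ∎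
  where
  open ≤-Reasoning
  R = (4 * (W * τ)) ^ suc W
  1≤Wτ : 1 ≤ W * τ
  1≤Wτ = *-mono-≤ (s≤s (z≤n {W ∸ 1})) 1≤τ
  base≤ : suc last ≤ 4 * (W * τ)
  base≤ = begin
    suc last                        ≤⟨ s≤s last≤ ⟩
    1 + W * suc (2 * τ)             ≡⟨ shuffle W τ ⟩
    1 + (W * 1 + 2 * (W * τ))       ≤⟨ +-mono-≤ 1≤Wτ (+-monoˡ-≤ (2 * (W * τ)) (*-monoʳ-≤ W 1≤τ)) ⟩
    W * τ + (W * τ + 2 * (W * τ))   ≡⟨⟩
    4 * (W * τ) ∎
    where
    shuffle : ∀ W τ → 1 + W * suc (2 * τ) ≡ 1 + (W * 1 + 2 * (W * τ))
    shuffle = solve-∀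
  few′ : rounds ≤ R
  few′ = ≤-trans few (^-monoˡ-≤ (suc W) base≤)
  1≤R : 1 ≤ R
  1≤R = m^n>0 (4 * (W * τ)) {{>-nonZero (≤-trans (s≤s z≤n) base≤)}} (suc W)
  shuffle₁ : ∀ R W Y → (R + R) * (W * Y + W * Y) ≡ 4 * (R * W) * Y
  shuffle₁ = solve-∀
  shuffle₂ : ∀ E Y → 4 * (32 * E) * Y ≡ 128 * (E * Y)
  shuffle₂ = solve-∀

n≤2^n : ∀ n → n ≤ 2 ^ n
n≤2^n n = <⇒≤ (go n)
  where
  go : ∀ n → n < 2 ^ n
  go zero    = s≤s z≤n
  go (suc n) = +-mono-≤ (m^n>0 2 n) (≤-trans (go n) (m≤m+n (2 ^ n) 0))

-- A computable bound for the factor of the time bound that depends on the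
-- parameters. As the RAM has no products, the exponent s * s is a sum.

side : ℕ → ℕ → ℕ
side x y = ((x + x) + (y + y)) + 1

tower : ℕ → ℕ → ℕ
tower x y = 2 ^ (side x y * side x y)

1≤tower : ∀ x y → 1 ≤ tower x y
1≤tower x y = m^n>0 2 (side x y * side x y)

-- `n ≤ 2 ^ n` turns both factors into powers of 2, whose exponents add up to at most the square of
-- `side`.
tower-bound : ∀ W τ → W ^ (2 * W + 1) * τ ^ (2 * W) ≤ tower W τ
tower-bound W τ = begin
  W ^ (2 * W + 1) * τ ^ (2 * W)
    ≤⟨ *-mono-≤ (^-monoˡ-≤ (2 * W + 1) (n≤2^n W)) (^-monoˡ-≤ (2 * W) (n≤2^n τ)) ⟩
  (2 ^ W) ^ (2 * W + 1) * (2 ^ τ) ^ (2 * W)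
    ≡⟨ cong₂ _*_ (^-*-assoc 2 W (2 * W + 1)) (^-*-assoc 2 τ (2 * W)) ⟩
  2 ^ (W * (2 * W + 1)) * 2 ^ (τ * (2 * W))
    ≡⟨ ^-distribˡ-+-* 2 (W * (2 * W + 1)) (τ * (2 * W)) ⟨
  2 ^ (W * (2 * W + 1) + τ * (2 * W))
    ≤⟨ ^-monoʳ-≤ 2 (≤-trans (m≤m+n (W * (2 * W + 1) + τ * (2 * W)) _) (≤-reflexive (square W τ))) ⟩
  tower W τ ∎
  where
  open ≤-Reasoning
  square : ∀ W τ → W * (2 * W + 1) + τ * (2 * W) + (2 * (W * W) + 6 * (W * τ) + 4 * (τ * τ) + 3 * W + 4 * τ + 1)
         ≡ (((W + W) + (τ + τ)) + 1) * (((W + W) + (τ + τ)) + 1)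
  square = solve-∀

towerProgram : Cmd
towerProgram =
  for sideE (3 ⟦ lit 0 ⟧← ret (cell 3 ⊕ sideE)) ⨾
  ((1 ⟦ lit 0 ⟧≔ lit 1) ⨾ for (cell 3) (1 ⟦ lit 0 ⟧← ret (cell 1 ⊕ cell 1)))
  where
  sideE : Exp
  sideE = (((0 ⟦ lit 0 ⟧) ⊕ (0 ⟦ lit 0 ⟧)) ⊕ ((0 ⟦ lit 1 ⟧) ⊕ (0 ⟦ lit 1 ⟧))) ⊕ lit 1

tower-computable : Computable₂ tower
tower-computable = towerProgram , λ x y →
  let s = side x y
      σ₀ = load (x ∷ y ∷ [])
      r₁ = runs-fold 3 {σ = σ₀} s (_* s) refl (λ _ _ → refl) refl
             (λ e g g0 → trans (cong (_+ s) g0) (+-comm (toℕ e * s) s))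
      runs s₁ ρ₁ run₁ _ h₁ = r₁
      r₂ = runs-fold 1 {cell 3} {σ = write ρ₁ 1 0 1} (s * s) (2 ^_) refl (λ _ _ → h₁) refl
             (λ e g g0 → trans (cong₂ _+_ g0 g0) (cong (2 ^ toℕ e +_) (sym (+-identityʳ (2 ^ toℕ e)))))
      runs s₂ ρ₂ run₂ _ h₂ = r₂
  in _ , _ , ρ₂ , ⇓seq run₁ (⇓seq ⇓assign run₂) , cong (_∷ []) h₂ , ≤-refl

-- Map every vertex to the first edge of a shortest path to a root.

module _ (G : Network) (connected : Network.Connected G) where
  open Network G
  open Paths G

  private
    module _ (root : Fin n) where

      Shortest : Fin n → Set
      Shortest v = Σ (Path v root) λ P → ∀ (Q : Path v root) → pathLength P ≤ pathLength Q

      shortest : ∀ v → Shortest v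
      shortest v with dist-exists (connected v root) (within-⊤ (connected v root))
      ... | _ , ((P , _ , refl) , min) , _ = P , λ Q → min Q (within-⊤ Q)

      first-edge : ∀ {v} → Path v root → Fin (suc m)
      first-edge stop         = zero
      first-edge (step e _ _) = suc e

      -- Two different vertices with the same first edge would be its two ends, each strictly nearer
      -- to the root than the other.
      first-edge-injective : ∀ {u v} (P : Shortest u) (Q : Shortest v) →
        first-edge (proj₁ P) ≡ first-edge (proj₁ Q) → u ≡ v
      first-edge-injective (stop , _) (stop , _) _ = refl
      first-edge-injective (step e j P , min) (step .e j′ Q , min′) refl with joins-end j j′
      ... | inj₁ refl = refl
      ... | inj₂ refl with joins-end j (joins-sym j′)
      ...   | inj₂ refl = contradiction j′ (loopless e _)
      ...   | inj₁ refl = contradiction (+-mono-≤ (ℓ-positive e) (≤-trans (m≤n+m _ (ℓ e)) (min Q)))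
        (<⇒≱ (s≤s (min′ P)))

  -- The encoding stores `n` in binary, so a polynomial in `n` is polynomial in the encoding length
  -- only because a connected graph has at least `n - 1` edges.
  nodes≤ : n ≤ suc m
  nodes≤ = go n refl
    where
    go : ∀ k → n ≡ k → n ≤ suc m
    go zero    eq = ≤-trans (≤-reflexive eq) z≤n
    go (suc k) eq = injective⇒≤ {f = λ v → first-edge root (proj₁ (shortest root v))}
      (λ {u} {v} → first-edge-injective root (shortest root u) (shortest root v))
      where
      root : Fin n
      root = subst Fin (sym eq) zero

length≤sum : ∀ xs → length xs ≤ sum (map (λ k → suc ⌊log₂ k ⌋) xs)
length≤sum []       = z≤n
length≤sum (x ∷ xs) = s≤s (≤-trans (length≤sum xs) (m≤n+m _ ⌊log₂ x ⌋))

size≤encoding : ∀ I → let open Instance I in suc (n + m) ≤ encodingLength I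
size≤encoding I = begin
  suc (n + m)       ≤⟨ s≤s (+-monoˡ-≤ m (nodes≤ G connected)) ⟩
  suc (suc m + m)   ≤⟨ m≤m+n _ (3 + 2 * m) ⟩
  suc (suc m + m) + (3 + 2 * m) ≡⟨ shuffle m ⟩
  5 + 4 * m         ≡⟨ Input.length-encode I ⟨
  length (encode I) ≤⟨ length≤sum (encode I) ⟩
  encodingLength I ∎
  where
  open Instance I
  open ≤-Reasoning
  shuffle : ∀ m → suc (suc m + m) + (3 + 2 * m) ≡ 5 + 4 * m
  shuffle = solve-∀

bits-cells : ∀ {m} (F : Subset m) (g : ℕ → ℕ) → g 0 ≡ 1 → (∀ e → g (suc (toℕ e)) ≡ bit (lookup F e)) →
  ∀ i → i < length (1 ∷ bits F) → g i ≡ nth (1 ∷ bits F) i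
bits-cells F g g0 gs zero    _        = g0
bits-cells {m} F g g0 gs (suc i) (s≤s i<) = begin
  g (suc i)              ≡⟨ cong (g ∘ suc) (toℕ-fromℕ< i<m) ⟨
  g (suc (toℕ e))        ≡⟨ gs e ⟩
  bit (lookup F e)       ≡⟨ nth-map-allFin (λ e → bit (lookup F e)) e ⟨
  nth (bits F) (toℕ e)   ≡⟨ cong (nth (bits F)) (toℕ-fromℕ< i<m) ⟩
  nth (bits F) i ∎
  where
  open ≡-Reasoning
  i<m : i < m
  i<m = subst (i <_) (length-map-allFin (λ e → bit (lookup F e))) i<
  e : Fin m
  e = fromℕ< i<m

-- The time bound in terms of the tightness

module Theorem (spsp apsp₂ : Cmd) (SPSP APSP₂ : ℕ → ℕ → ℕ)
  (solves-spsp : SolvesSPSP spsp SPSP) (solves : SolvesAPSP₂ apsp₂ APSP₂) where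

  solver : Cmd
  solver = Program.solve spsp apsp₂

  -- Opaque, since unfolding the numeral would blow up the products below.
  abstract
    factor : ℕ
    factor = cost solver

    cost≤factor : cost solver ≤ factor
    cost≤factor = ≤-refl

  module _ (I : Instance) where
    open Instance I
    private
      module S = Algorithm I spsp apsp₂ SPSP APSP₂ solves-spsp solves
      module R = Runs (S.Solved.solution S.solved)
      module T = Tightness I S.d S.d-dist S.classes
      module L = Listing T.isN

    -- Counts the steps actually taken, because the time has to be a function of the instance alone
    -- and no `τ` is computed from it. The summand `suc m` covers a bare verdict as well as a
    -- verdict with a witness.
    runningTime : ℕ
    runningTime = length (encode I) + R.steps + suc m

    answers : S.Answer R.end →
      (∃ λ F → IsSolution F × Outputs solver (encode I) (1 ∷ []) runningTime ×
                              Outputs solver (encode I) (1 ∷ bits F) runningTime)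
      ⊎ (¬ ∃ IsSolution × Outputs solver (encode I) (0 ∷ []) runningTime)
    answers (inj₂ (zero≡ , none)) = inj₂ (none , R.steps , R.end , R.run , cong (_∷ []) zero≡ ,
      +-monoʳ-≤ (length (encode I) + R.steps) (s≤s z≤n))
    answers (inj₁ (F , one , kept , sol)) = inj₁ (∁ F , sol ,
      (R.steps , R.end , R.run , cong (_∷ []) one , +-monoʳ-≤ (length (encode I) + R.steps) (s≤s z≤n)) ,
      (R.steps , R.end , R.run , nth-ext (1 ∷ bits (∁ F)) (bits-cells (∁ F) (R.end 1) one kept) ,
       +-monoʳ-≤ (length (encode I) + R.steps) (≤-reflexive (cong suc (length-map-allFin (λ e → bit (lookup (∁ F) e)))))))

    answer = answers R.post

    -- If `last` were larger, some valid tuple would have digits at most `last - 1`, although these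
    -- have all failed. Arguing by contradiction absorbs the double negation of `early-tuple`.
    last-bound : ∀ {τ last} → IsTightness τ → (∀ a → a < last → S.Fails a) →
      last ≤ L.cnt m → last ≤ W̄ * suc (2 * τ)
    last-bound {last = zero}  tight failed last≤ = z≤n
    last-bound {τ} {suc K} tight failed last≤ = ≮⇒≥ λ enough →
      T.early-tuple L.nt L.pos L.nt-0 (λ isn → L.nt-pos (S.isN⇐ isn)) tight (L.count (<⇒≤ last≤)) (s≤s⁻¹ enough)
        λ (c , c≤ , valid) → failed K ≤-refl c c≤ valid

    time-bound : ∀ τ → IsTightness τ →
      S.Solved.time S.solved ≤ 128 * (W̄ ^ (2 * W̄ + 1) * τ ^ (2 * W̄) * SPSP n m) + 4 * APSP₂ n m
    time-bound τ tight = go (S.Solved.timed S.solved)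
      where
      A = APSP₂ n m
      E = W̄ ^ (2 * W̄ + 1) * τ ^ (2 * W̄) * SPSP n m
      2+m≤A : 2 + m ≤ A
      2+m≤A = ≤-trans (+-monoʳ-≤ 2 (m≤n+m m (m + m))) (≤-trans (m≤m+n _ (n * (n + n))) S.apsp-size)
      sucA : suc A ≤ 2 * A
      sucA = ≤-trans (+-monoˡ-≤ A (≤-trans (s≤s z≤n) 2+m≤A)) (≤-reflexive (cong (A +_) (sym (+-identityʳ A))))
      go : _ → S.Solved.time S.solved ≤ 128 * E + 4 * A
      go (inj₁ eq) = ≤-trans (≤-reflexive eq) (≤-trans sucA (≤-trans (*-monoˡ-≤ A (s≤s (s≤s (z≤n {2})))) (m≤n+m (4 * A) (128 * E))))
      go (inj₂ (rounds , last , eq , few , failed , last≤ , e , settles , bad)) = begin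
        S.Solved.time S.solved             ≡⟨ eq ⟩
        suc rounds * (suc m + W̄ * SPSP n m) + suc A
          ≤⟨ +-mono-≤ (search-bound W̄ τ m (SPSP n m) A rounds last (T.tightness-positive tight settles bad)
               (S.spsp-size e) (≤-trans (n≤1+n _) 2+m≤A) few (last-bound tight failed last≤)) sucA ⟩
        (128 * E + 2 * A) + 2 * A          ≡⟨ shuffle E A ⟩
        128 * E + 4 * A ∎
        where
        open ≤-Reasoning
        shuffle : ∀ E A → (128 * E + 2 * A) + 2 * A ≡ 128 * E + 4 * A
        shuffle = solve-∀

    running-time-bound : ∀ τ → IsTightness τ →
      runningTime ≤ (3 + 128 * factor) * (W̄ ^ (2 * W̄ + 1) * τ ^ (2 * W̄) * SPSP n m + APSP₂ n m)
    running-time-bound τ tight = begin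
      length (encode I) + R.steps + suc m
        ≡⟨ cong (λ l → l + R.steps + suc m) (Input.length-encode I) ⟩
      5 + 4 * m + R.steps + suc m
        ≡⟨ shuffle₁ m R.steps ⟩
      6 + 5 * m + R.steps
        ≤⟨ +-mono-≤ io (≤-trans R.fast (*-mono-≤ cost≤factor (time-bound τ tight))) ⟩
      3 * A + factor * (128 * E + 4 * A)
        ≤⟨ +-mono-≤ (*-monoʳ-≤ 3 (m≤n+m A E)) (*-monoʳ-≤ factor (+-monoʳ-≤ (128 * E) (*-monoˡ-≤ A {4} {128} (m≤m+n 4 124)))) ⟩
      3 * (E + A) + factor * (128 * E + 128 * A)
        ≡⟨ shuffle₂ factor E A ⟩
      (3 + 128 * factor) * (E + A) ∎
      where
      open ≤-Reasoning
      A = APSP₂ n m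
      E = W̄ ^ (2 * W̄ + 1) * τ ^ (2 * W̄) * SPSP n m
      shuffle₁ : ∀ m s → 5 + 4 * m + s + suc m ≡ 6 + 5 * m + s
      shuffle₁ = solve-∀
      shuffle₂ : ∀ c E A → 3 * (E + A) + c * (128 * E + 128 * A) ≡ (3 + 128 * c) * (E + A)
      shuffle₂ = solve-∀
      shuffle₃ : ∀ m → 6 + 5 * m + 4 * m ≡ 3 * (2 + (m + m) + m)
      shuffle₃ = solve-∀
      io : 6 + 5 * m ≤ 3 * A
      io = ≤-trans (m≤m+n (6 + 5 * m) (4 * m)) (≤-trans (≤-reflexive (shuffle₃ m))
             (*-monoʳ-≤ 3 (≤-trans (m≤m+n _ (n * (n + n))) S.apsp-size)))

  fpt : PolynomiallyBounded SPSP → PolynomiallyBounded APSP₂ → FPT runningTime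
  fpt (c₁ , k₁ , spsp≤) (c₂ , k₂ , apsp≤) = tower , tower-computable , c * (c₁ + c₂) , k₁ + k₂ , bound
    where
    c = 3 + 128 * factor
    bound : ∀ I τ → Instance.IsTightness I τ →
      runningTime I ≤ c * (c₁ + c₂) * (tower (Instance.W̄ I) τ * encodingLength I ^ (k₁ + k₂))
    bound I τ tight = begin
      runningTime I
        ≤⟨ running-time-bound I τ tight ⟩
      c * (W̄ ^ (2 * W̄ + 1) * τ ^ (2 * W̄) * SPSP n m + APSP₂ n m)
        ≤⟨ *-monoʳ-≤ c (+-mono-≤
             (*-mono-≤ (tower-bound W̄ τ) (≤-trans (spsp≤ n m) (*-monoʳ-≤ c₁ (power k₁ (m≤m+n k₁ k₂)))))
             (≤-trans (apsp≤ n m) (*-monoʳ-≤ c₂ (≤-trans (power k₂ (m≤n+m k₂ k₁)) (m≤n*m (L ^ (k₁ + k₂)) t {{>-nonZero (1≤tower W̄ τ)}}))))) ⟩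
      c * (t * (c₁ * L ^ (k₁ + k₂)) + c₂ * (t * L ^ (k₁ + k₂)))
        ≡⟨ shuffle c c₁ c₂ t (L ^ (k₁ + k₂)) ⟩
      c * (c₁ + c₂) * (t * L ^ (k₁ + k₂)) ∎
      where
      open ≤-Reasoning
      open Instance I
      L = encodingLength I
      t = tower W̄ τ
      shuffle : ∀ c c₁ c₂ t p → c * (t * (c₁ * p) + c₂ * (t * p)) ≡ c * (c₁ + c₂) * (t * p)
      shuffle = solve-∀
      power : ∀ k → k ≤ k₁ + k₂ → suc (n + m) ^ k ≤ L ^ (k₁ + k₂)
      power k k≤ = ≤-trans (^-monoˡ-≤ k (size≤encoding I))
        (^-monoʳ-≤ L {{>-nonZero (≤-trans (s≤s z≤n) (size≤encoding I))}} k≤)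

theorem3 : (spsp apsp₂ : Cmd) (SPSP APSP₂ : ℕ → ℕ → ℕ) →
    SolvesSPSP spsp SPSP →
    SolvesAPSP₂ apsp₂ APSP₂ →
    ∃ λ (decide : Cmd) → ∃ λ (find : Cmd) → ∃ λ (𝓣 : Instance → ℕ) →
    DecidesSpanner decide 𝓣 ×
    (∃ λ (c : ℕ) → ∀ (I : Instance) (τ : ℕ) → let open Instance I in
    IsTightness τ →
    𝓣 I ≤ c * (W̄ ^ (2 * W̄ + 1) * τ ^ (2 * W̄) * SPSP n m + APSP₂ n m)) ×
    (∃ λ (c : ℕ) → FindsSpanner find (λ I → let open Instance I in
    c * (𝓣 I + n ^ 2 * m ^ 2))) ×
    (PolynomiallyBounded SPSP → PolynomiallyBounded APSP₂ → FPT 𝓣)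
theorem3 spsp apsp₂ SPSP APSP₂ solves-spsp solves =
  -- One program serves both purposes: the flags of the successful trial are written out next to the
  -- verdict, so the witness costs nothing extra and the constant can be 1.
  solver , solver , runningTime ,
  (λ I → [ (λ (F , sol , out , _) → inj₁ ((F , sol) , out)) , inj₂ ]′ (answer I)) ,
  (3 + 128 * factor , running-time-bound) ,
  (1 , λ I → [ (λ (F , sol , _ , out) → inj₁ (F , sol , slower I out)) , (λ (none , out) → inj₂ (none , slower I out)) ]′ (answer I)) ,
  fpt
  where
  open Theorem spsp apsp₂ SPSP APSP₂ solves-spsp solves
  slower : ∀ I {ys} → Outputs solver (encode I) ys (runningTime I) →
    Outputs solver (encode I) ys (let open Instance I in 1 * (runningTime I + n ^ 2 * m ^ 2))
  slower I (s , ρ , run , out , le) = s , ρ , run , out , ≤-trans le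
    (≤-trans (m≤m+n (runningTime I) _) (≤-reflexive (sym (+-identityʳ _))))
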